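{- Suppose $f\colon\mathbb{N}\to[0,\infty)$ is a sub-identical order function such that $\sum_{m=0}^\infty f(2^m)/2^m$ converges to a recursive real. Then there is an order function $g\colon\mathbb{N}\to[0,\infty)$ such that $\mathrm{SC}(f) \leq_{\mathrm{s}} \mathrm{COMPLEX}(g)$ and $\lim_{n \to \infty} g(n)/n=0$.
   Context: An order function is a computable (i.e. its values are uniformly computable reals), nondecreasing, unbounded function $\mathbb{N}\to\mathbb{R}$. A function $f\colon\mathbb{N}\to[0,\infty)$ is sub-identical if $\lim_{n\to\infty}(n-f(n))=\infty$. A real is recursive if it is computable. Prefix-free complexity: a prefix-free machine is a partial recursive $M$ from $\{0,1\}^*$ to $\{0,1\}^*$ with prefix-free domain; $U$ is universal if for each prefix-free machine $M$ there is $\rho$ with $U(\rho^\frown\tau)\simeq M(\tau)$ for all $\tau$. Fix a universal $U$ and let $K(\sigma)=\min\{|\tau| : U(\tau)=\sigma\}$. For $f\colon\mathbb{N}\to\mathbb{R}$, $\mathrm{COMPLEX}(f)$ is the set of $X\in\{0,1\}^{\mathbb{N}}$ for which there is $c\in\mathbb{N}$ with $K(X\upharpoonright n)\geq f(n)-c$ for all $n$; $\mathrm{SC}(f)$ is the set of $X\in\{0,1\}^{\mathbb{N}}$ for which there is $c\in\mathbb{N}$ with $K(\tau)\geq f(|\tau|)-c$ for every (contiguous, finite) substring $\tau$ of $X$. For $P,Q\subseteq\mathbb{N}^{\mathbb{N}}$, $P\leq_{\mathrm{s}}Q$ means there is a partial recursive functional defined on all of $Q$ that maps $Q$ into $P$.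 -}

module Defs where

open import Data.Bool.Base using (Bool; true; false)
open import Data.Empty using (⊥)
open import Data.Fin.Base using (Fin)
open import Data.Integer.Base as ℤ using (+_)
open import Data.List.Base using (List; []; _∷_; _++_; length; applyUpTo)
open import Data.List.Relation.Binary.Prefix.Heterogeneous using (Prefix)
open import Data.Nat.Base as ℕ using (ℕ; zero; suc)
import Data.Nat.Properties as ℕ
open import Data.Product using (Σ; Σ-syntax; ∃; ∃-syntax; _×_; _,_)
open import Data.Rational.Base as ℚ using (ℚ; 0ℚ; 1ℚ; ½)
import Data.Rational.Properties as ℚ
open import Data.Rational.Solver using (module +-*-Solver)
open import Data.Sum.Base using (inj₁; inj₂)
open import Data.Unit.Base using (⊤)
open import Data.Vec.Base as Vec using (Vec; []; _∷_; lookup)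
open import Function.Bundles using (_⇔_)
open import Level using (0ℓ)
open import Relation.Binary.PropositionalEquality
  using (_≡_; refl; sym; trans; cong; cong₂; subst; subst₂)
open import Relation.Unary using (Pred)

2^-_ : ℕ → ℚ
2^- zero  = 1ℚ
2^- suc k = ½ ℚ.* (2^- k)

-- A real is given by rational approximations, the k-th being within 2^-k
-- of the real.
record ℝ : Set where
  constructor mkℝ
  field
    approx  : ℕ → ℚ
    regular : ∀ j k → ℚ.∣ approx j ℚ.- approx k ∣ ℚ.≤ 2^- j ℚ.+ 2^- k

open ℝ public

private
  module Q = +-*-Solver
  open Q using (solve; _:=_; _:+_; _:*_; _:-_; con; :-_)

  0≤2^- : ∀ k → 0ℚ ℚ.≤ 2^- k
  0≤2^- zero    = ℚ.nonNegative⁻¹ 1ℚ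
  0≤2^- (suc k) = ℚ.nonNegative⁻¹ _
    {{ℚ.nonNeg*nonNeg⇒nonNeg ½ (2^- k) {{ℚ.nonNegative (0≤2^- k)}}}}

  0≤2^-+2^- : ∀ j k → 0ℚ ℚ.≤ 2^- j ℚ.+ 2^- k
  0≤2^-+2^- j k = ℚ.+-mono-≤ (0≤2^- j) (0≤2^- k)

  abs-bound : ∀ p {r} → p ℚ.≤ r → ℚ.- p ℚ.≤ r → ℚ.∣ p ∣ ℚ.≤ r
  abs-bound p p≤r -p≤r with ℚ.∣p∣≡p∨∣p∣≡-p p
  ... | inj₁ eq = subst (ℚ._≤ _) (sym eq) p≤r
  ... | inj₂ eq = subst (ℚ._≤ _) (sym eq) -p≤r

  ∣p∣-∣q∣≤∣p-q∣ : ∀ p q → ℚ.∣ p ∣ ℚ.- ℚ.∣ q ∣ ℚ.≤ ℚ.∣ p ℚ.- q ∣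
  ∣p∣-∣q∣≤∣p-q∣ p q = begin
    ℚ.∣ p ∣ ℚ.- ℚ.∣ q ∣
      ≡⟨ cong (λ z → ℚ.∣ z ∣ ℚ.- ℚ.∣ q ∣)
           (solve 2 (λ p q → p := (p :- q) :+ q) refl p q) ⟩
    ℚ.∣ (p ℚ.- q) ℚ.+ q ∣ ℚ.- ℚ.∣ q ∣
      ≤⟨ ℚ.+-monoˡ-≤ (ℚ.- ℚ.∣ q ∣) (ℚ.∣p+q∣≤∣p∣+∣q∣ (p ℚ.- q) q) ⟩
    (ℚ.∣ p ℚ.- q ∣ ℚ.+ ℚ.∣ q ∣) ℚ.- ℚ.∣ q ∣
      ≡⟨ solve 2 (λ x y → (x :+ y) :- y := x) refl ℚ.∣ p ℚ.- q ∣ ℚ.∣ q ∣ ⟩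
    ℚ.∣ p ℚ.- q ∣ ∎
    where open ℚ.≤-Reasoning

  ∣∣p∣-∣q∣∣≤∣p-q∣ : ∀ p q → ℚ.∣ ℚ.∣ p ∣ ℚ.- ℚ.∣ q ∣ ∣ ℚ.≤ ℚ.∣ p ℚ.- q ∣
  ∣∣p∣-∣q∣∣≤∣p-q∣ p q = abs-bound _ (∣p∣-∣q∣≤∣p-q∣ p q)
    (subst₂ ℚ._≤_
      (solve 2 (λ x y → y :- x := :- (x :- y)) refl ℚ.∣ p ∣ ℚ.∣ q ∣)
      (trans
        (cong ℚ.∣_∣ (solve 2 (λ x y → y :- x := :- (x :- y)) refl p q))
        (ℚ.∣-p∣≡∣p∣ (p ℚ.- q)))
      (∣p∣-∣q∣≤∣p-q∣ q p))

  halves : ∀ k → 2^- suc k ℚ.+ 2^- suc k ≡ 2^- k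
  halves k = solve 1 (λ x → con ½ :* x :+ con ½ :* x := x) refl (2^- k)

  1/n≤1 : ∀ n .{{_ : ℕ.NonZero n}} → + 1 ℚ./ n ℚ.≤ 1ℚ
  1/n≤1 n@(suc m) = ℚ.toℚᵘ-cancel-≤ (begin
      ℚ.toℚᵘ (+ 1 ℚ./ n)  ≃⟨ ℚ.toℚᵘ-fromℚᵘ (ℚᵘ.mkℚᵘ (+ 1) m) ⟩
      ℚᵘ.mkℚᵘ (+ 1) m     ≤⟨ ℚᵘ.*≤* (ℤ.+≤+ (ℕ.s≤s ℕ.z≤n)) ⟩
      ℚᵘ.1ℚᵘ              ∎)
    where
    import Data.Rational.Unnormalised.Base as ℚᵘ
    import Data.Rational.Unnormalised.Properties as ℚᵘ
    open ℚᵘ.≤-Reasoning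

  0≤1/n : ∀ n .{{_ : ℕ.NonZero n}} → ℚ.NonNegative (+ 1 ℚ./ n)
  0≤1/n n = ℚ.normalize-nonNeg 1 n

fromℚ : ℚ → ℝ
fromℚ q = mkℝ (λ _ → q) λ j k →
  subst (λ z → ℚ.∣ z ∣ ℚ.≤ _) (sym (ℚ.+-inverseʳ q)) (0≤2^-+2^- j k)

fromℕ : ℕ → ℝ
fromℕ n = fromℚ (+ n ℚ./ 1)

0ℝ : ℝ
0ℝ = fromℚ 0ℚ

infixl 6 _+ᴿ_ _-ᴿ_
infixl 7 _÷_
infix  4 _≤ᴿ_

_+ᴿ_ : ℝ → ℝ → ℝ
x +ᴿ y = mkℝ (λ k → approx x (suc k) ℚ.+ approx y (suc k)) reg
  where
  open ℚ.≤-Reasoning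
  reg : ∀ j k → ℚ.∣ (approx x (suc j) ℚ.+ approx y (suc j))
              ℚ.- (approx x (suc k) ℚ.+ approx y (suc k)) ∣ ℚ.≤ 2^- j ℚ.+ 2^- k
  reg j k = begin
    ℚ.∣ (a ℚ.+ b) ℚ.- (c ℚ.+ d) ∣
      ≡⟨ cong ℚ.∣_∣ (solve 4 (λ a b c d →
           (a :+ b) :- (c :+ d) := (a :- c) :+ (b :- d)) refl a b c d) ⟩
    ℚ.∣ (a ℚ.- c) ℚ.+ (b ℚ.- d) ∣
      ≤⟨ ℚ.∣p+q∣≤∣p∣+∣q∣ (a ℚ.- c) (b ℚ.- d) ⟩
    ℚ.∣ a ℚ.- c ∣ ℚ.+ ℚ.∣ b ℚ.- d ∣
      ≤⟨ ℚ.+-mono-≤ (regular x (suc j) (suc k)) (regular y (suc j) (suc k)) ⟩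
    (2^- suc j ℚ.+ 2^- suc k) ℚ.+ (2^- suc j ℚ.+ 2^- suc k)
      ≡⟨ solve 2 (λ u v → (u :+ v) :+ (u :+ v) := (u :+ u) :+ (v :+ v)) refl
           (2^- suc j) (2^- suc k) ⟩
    (2^- suc j ℚ.+ 2^- suc j) ℚ.+ (2^- suc k ℚ.+ 2^- suc k)
      ≡⟨ cong₂ ℚ._+_ (halves j) (halves k) ⟩
    2^- j ℚ.+ 2^- k ∎
    where
    a = approx x (suc j)
    b = approx y (suc j)
    c = approx x (suc k)
    d = approx y (suc k)

-ᴿ_ : ℝ → ℝ
-ᴿ x = mkℝ (λ k → ℚ.- approx x k) λ j k →
  subst (ℚ._≤ _)
    (trans (sym (ℚ.∣-p∣≡∣p∣ (approx x j ℚ.- approx x k)))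
      (cong ℚ.∣_∣ (solve 2 (λ a b → :- (a :- b) := (:- a) :- (:- b)) refl
                     (approx x j) (approx x k))))
    (regular x j k)

_-ᴿ_ : ℝ → ℝ → ℝ
x -ᴿ y = x +ᴿ (-ᴿ y)

∣_∣ᴿ : ℝ → ℝ
∣ x ∣ᴿ = mkℝ (λ k → ℚ.∣ approx x k ∣) λ j k →
  ℚ.≤-trans (∣∣p∣-∣q∣∣≤∣p-q∣ (approx x j) (approx x k)) (regular x j k)

-- Since 1/n ≤ 1, the approximations can be scaled without reindexing.
_÷_ : ℝ → (n : ℕ) .{{_ : ℕ.NonZero n}} → ℝ
x ÷ n = mkℝ (λ k → approx x k ℚ.* r) reg
  where
  open ℚ.≤-Reasoning
  r = + 1 ℚ./ n
  reg : ∀ j k → ℚ.∣ approx x j ℚ.* r ℚ.- approx x k ℚ.* r ∣ ℚ.≤ 2^- j ℚ.+ 2^- k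
  reg j k = begin
    ℚ.∣ a ℚ.* r ℚ.- b ℚ.* r ∣
      ≡⟨ cong ℚ.∣_∣ (solve 3 (λ a b r →
           a :* r :- b :* r := (a :- b) :* r) refl a b r) ⟩
    ℚ.∣ (a ℚ.- b) ℚ.* r ∣
      ≡⟨ ℚ.∣p*q∣≡∣p∣*∣q∣ (a ℚ.- b) r ⟩
    ℚ.∣ a ℚ.- b ∣ ℚ.* ℚ.∣ r ∣
      ≡⟨ cong (ℚ.∣ a ℚ.- b ∣ ℚ.*_)
           (ℚ.0≤p⇒∣p∣≡p (ℚ.nonNegative⁻¹ r {{0≤1/n n}})) ⟩
    ℚ.∣ a ℚ.- b ∣ ℚ.* r
      ≤⟨ ℚ.*-monoˡ-≤-nonNeg ℚ.∣ a ℚ.- b ∣ {{ℚ.∣-∣-nonNeg (a ℚ.- b)}} (1/n≤1 n) ⟩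
    ℚ.∣ a ℚ.- b ∣ ℚ.* 1ℚ
      ≡⟨ ℚ.*-identityʳ _ ⟩
    ℚ.∣ a ℚ.- b ∣
      ≤⟨ regular x j k ⟩
    2^- j ℚ.+ 2^- k ∎
    where
    a = approx x j
    b = approx x k

-- The k-th approximations of x and y are each off by at most 2^-k.
_≤ᴿ_ : ℝ → ℝ → Set
x ≤ᴿ y = ∀ k → approx x k ℚ.≤ approx y k ℚ.+ (2^- k ℚ.+ 2^- k)

ConvergesTo : (ℕ → ℝ) → ℝ → Set
ConvergesTo a x =
  ∀ k → ∃[ N ] ∀ n → N ℕ.≤ n → ∣ a n -ᴿ x ∣ᴿ ≤ᴿ fromℚ (2^- k)

DivergesTo∞ : (ℕ → ℝ) → Set
DivergesTo∞ a = ∀ b → ∃[ N ] ∀ n → N ℕ.≤ n → fromℕ b ≤ᴿ a n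

partialSum : (ℕ → ℝ) → ℕ → ℝ
partialSum a zero    = 0ℝ
partialSum a (suc n) = partialSum a n +ᴿ a n

SumsTo : (ℕ → ℝ) → ℝ → Set
SumsTo a s = ConvergesTo (partialSum a) s

-- Kleene's schemata, relative to a family of oracles indexed by O: O = ⊥ gives
-- the partial recursive functions, O = ⊤ functionals of one element of ℕ^ℕ.
data Code (O : Set) : ℕ → Set where
  zeroᶜ   : Code O 0
  sucᶜ    : Code O 1
  projᶜ   : ∀ {n} → Fin n → Code O n
  compᶜ   : ∀ {m n} → Code O m → Vec (Code O n) m → Code O n
  precᶜ   : ∀ {n} → Code O n → Code O (2 ℕ.+ n) → Code O (suc n)
  muᶜ     : ∀ {n} → Code O (suc n) → Code O n
  oracleᶜ : O → Code O 1

infix 4 _⊢_[_]⇓_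

-- α ⊢ c [ xs ]⇓ y : with oracles α, the program c halts on xs with output y.
data _⊢_[_]⇓_ {O : Set} (α : O → ℕ → ℕ) :
       ∀ {n} → Code O n → Vec ℕ n → ℕ → Set where
  zero⇓   : α ⊢ zeroᶜ [ [] ]⇓ 0
  suc⇓    : ∀ {x} → α ⊢ sucᶜ [ x ∷ [] ]⇓ suc x
  proj⇓   : ∀ {n} {i : Fin n} {xs} → α ⊢ projᶜ i [ xs ]⇓ lookup xs i
  comp⇓   : ∀ {m n} {g : Code O m} {hs : Vec (Code O n) m} {xs ys z} →
            (∀ i → α ⊢ lookup hs i [ xs ]⇓ lookup ys i) →
            α ⊢ g [ ys ]⇓ z → α ⊢ compᶜ g hs [ xs ]⇓ z
  prec0⇓  : ∀ {n} {g : Code O n} {h xs y} →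
            α ⊢ g [ xs ]⇓ y → α ⊢ precᶜ g h [ 0 ∷ xs ]⇓ y
  precs⇓  : ∀ {n} {g : Code O n} {h xs k r y} →
            α ⊢ precᶜ g h [ k ∷ xs ]⇓ r → α ⊢ h [ k ∷ r ∷ xs ]⇓ y →
            α ⊢ precᶜ g h [ suc k ∷ xs ]⇓ y
  mu⇓     : ∀ {n} {g : Code O (suc n)} {xs y} →
            (∀ z → z ℕ.< y → ∃[ w ] α ⊢ g [ z ∷ xs ]⇓ suc w) →
            α ⊢ g [ y ∷ xs ]⇓ 0 → α ⊢ muᶜ g [ xs ]⇓ y
  oracle⇓ : ∀ {o x} → α ⊢ oracleᶜ o [ x ∷ [] ]⇓ α o x

PartialRecursive : ℕ → Set
PartialRecursive n = Code ⊥ n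

infix 4 _[_]⇓_

_[_]⇓_ : ∀ {n} → PartialRecursive n → Vec ℕ n → ℕ → Set
c [ xs ]⇓ y = (λ ()) ⊢ c [ xs ]⇓ y

Recursive : ∀ {n} → (Vec ℕ n → ℕ) → Set
Recursive {n} F = Σ[ c ∈ PartialRecursive n ] ∀ xs → c [ xs ]⇓ F xs

-- The values F xs are uniformly computable: a recursive sequence of rationals
-- (p - q) / (1 + d) approximates F xs to within 2^-k, uniformly in k and xs.
Computable : ∀ {n} → (Vec ℕ n → ℝ) → Set
Computable {n} F =
  Σ[ p ∈ (Vec ℕ (suc n) → ℕ) ] Σ[ q ∈ (Vec ℕ (suc n) → ℕ) ]
  Σ[ d ∈ (Vec ℕ (suc n) → ℕ) ]
    Recursive p × Recursive q × Recursive d ×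
    (∀ k xs →
      ∣ F xs -ᴿ fromℚ ((+ p (k ∷ xs) ℤ.- + q (k ∷ xs)) ℚ./ suc (d (k ∷ xs))) ∣ᴿ
        ≤ᴿ fromℚ (2^- k))

RecursiveReal : ℝ → Set
RecursiveReal x = Computable {0} (λ _ → x)

record OrderFunction (f : ℕ → ℝ) : Set where
  field
    computable : Computable {1} (λ xs → f (Vec.head xs))
    monotone   : ∀ {m n} → m ℕ.≤ n → f m ≤ᴿ f n
    unbounded  : ∀ b → ∃[ n ] fromℕ b ≤ᴿ f n

NonNegativeValued : (ℕ → ℝ) → Set
NonNegativeValued f = ∀ n → 0ℝ ≤ᴿ f n

SubIdentical : (ℕ → ℝ) → Set
SubIdentical f = DivergesTo∞ (λ n → fromℕ n -ᴿ f n)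

dyadicTerm : (ℕ → ℝ) → ℕ → ℝ
dyadicTerm f m = (f (2 ℕ.^ m) ÷ (2 ℕ.^ m)) {{ℕ.m^n≢0 2 m}}

-- The sequence n ↦ h(n)/n is indexed from n = 1, avoiding division by 0.
ratioToIndex : (ℕ → ℝ) → ℕ → ℝ
ratioToIndex h n = h (suc n) ÷ suc n

-- Bijective base-2 numeration, a bijection between strings and ℕ.
encode : List Bool → ℕ
encode []          = 0
encode (false ∷ σ) = 1 ℕ.+ 2 ℕ.* encode σ
encode (true  ∷ σ) = 2 ℕ.+ 2 ℕ.* encode σ

-- As encode is a bijection, PartialRecursive 1 represents exactly the partial
-- recursive functions from strings to strings.
infix 4 _⟨_⟩≃_

_⟨_⟩≃_ : PartialRecursive 1 → List Bool → List Bool → Set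
M ⟨ τ ⟩≃ σ = M [ encode τ ∷ [] ]⇓ encode σ

Dom : PartialRecursive 1 → Pred (List Bool) 0ℓ
Dom M τ = ∃[ y ] M [ encode τ ∷ [] ]⇓ y

PrefixFreeMachine : PartialRecursive 1 → Set
PrefixFreeMachine M = ∀ σ τ → Dom M σ → Dom M τ → Prefix _≡_ σ τ → σ ≡ τ

record UniversalPrefixFree (U : PartialRecursive 1) : Set where
  field
    prefixFree : PrefixFreeMachine U
    universal  : ∀ M → PrefixFreeMachine M →
                 ∃[ ρ ] ∀ τ σ → (U ⟨ ρ ++ τ ⟩≃ σ) ⇔ (M ⟨ τ ⟩≃ σ)

-- K[ U ] σ ≡ k, as a relation: k is the minimal length of a U-program for σ.
-- Minimisation over the domain of U is not effective, so K is not a function.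
IsK : PartialRecursive 1 → List Bool → ℕ → Set
IsK U σ k = (∃[ τ ] length τ ≡ k × U ⟨ τ ⟩≃ σ)
          × (∀ τ → U ⟨ τ ⟩≃ σ → k ℕ.≤ length τ)

K[_]_≥_ : PartialRecursive 1 → List Bool → ℝ → Set
K[ U ] σ ≥ r = ∀ k → IsK U σ k → r ≤ᴿ fromℕ k

Cantor Baire : Set
Cantor = ℕ → Bool
Baire  = ℕ → ℕ

_↾_ : Cantor → ℕ → List Bool
X ↾ n = applyUpTo X n

_SubstringOf_ : List Bool → Cantor → Set
τ SubstringOf X = ∃[ i ] τ ≡ applyUpTo (λ j → X (i ℕ.+ j)) (length τ)

COMPLEX : PartialRecursive 1 → (ℕ → ℝ) → Pred Cantor 0ℓ
COMPLEX U f X = ∃[ c ] ∀ n → K[ U ] (X ↾ n) ≥ (f n -ᴿ fromℕ c)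

SC : PartialRecursive 1 → (ℕ → ℝ) → Pred Cantor 0ℓ
SC U f X = ∃[ c ] ∀ τ → τ SubstringOf X → K[ U ] τ ≥ (f (length τ) -ᴿ fromℕ c)

bit : Bool → ℕ
bit false = 0
bit true  = 1

-- A subset of {0,1}^ℕ regarded as a subset of ℕ^ℕ.
⌜_⌝ : Pred Cantor 0ℓ → Pred Baire 0ℓ
⌜ P ⌝ x = Σ[ X ∈ Cantor ] (∀ n → x n ≡ bit (X n)) × P X

infix 4 _≤ₛ_

_≤ₛ_ : Pred Baire 0ℓ → Pred Baire 0ℓ → Set
P ≤ₛ Q = Σ[ Φ ∈ Code ⊤ 1 ] ∀ y → Q y →
         Σ[ x ∈ Baire ] (∀ n → (λ _ → y) ⊢ Φ [ n ∷ [] ]⇓ x n) × P x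

{-# OPTIONS --safe #-}
-- The bits of X are spread over a sequence Y in such a way that, for every m, each window
-- of 2^m consecutive positions of Y contains the first N m bits of X, at places that depend
-- only on residues mod 2^m; there is room for this as soon as Σ (N m)/2^m ≤ 1.  A substring τ
-- of Y with 2^(m+1) ≤ |τ| < 2^(m+2), preceded by a self-delimiting code of length 2m + 1 for
-- its starting point mod 2^m, is a description of X ↾ N m, so K(τ) ≥ K(X ↾ N m) - 2m - O(1).
-- It therefore suffices that g(N m) ≥ G m for some G m ≥ f(2^(m+2)) + 2m - O(1), and g(n) is
-- taken to be the maximum of the G m with N m ≤ n.  As the sum of the series is recursive, its
-- tails can be bounded effectively, which yields an unbounded recursive h such that
-- N m = (G m)(h m) still satisfies Σ (N m)/2^m ≤ 1; since h is unbounded, g(n)/n tends to 0.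
module Submission where

open import Defs
open import Data.Nat.Base as ℕ using (ℕ; zero; suc)
open import Data.Product using (Σ-syntax; ∃-syntax; _×_; _,_)
import Data.Rational.Base as ℚ
open import Relation.Binary.PropositionalEquality using (_≡_)

-- The summand 2m in `G m` is affordable because Σ 2m/2^m converges, and asking for f(2^(m+2)) at
-- level m only multiplies the given series by 4. The function h is raised greedily: its k-th
-- increase adds one more copy of the remaining tail of Σ (G m)/2^m, and is made only once that tail
-- is certified to be at most 2^-k, so the total stays below Σ 2^-k = 1. Since inequalities between
-- reals are undecidable, the certificate is an inequality between natural numbers formed from
-- rounded approximations; it has to be sound whenever it holds, and it has to hold from some level
-- on. Places are allotted greedily too: the residue classes mod 2^m that are still free are ranked,
-- the first N m of them serve level m, and each of the others splits into two classes mod 2^(m+1).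
-- Minimal programs exist only classically, but every conclusion drawn from them is a decidable
-- inequality, so their double-negated existence suffices.

-- Recursive functions: determinism, relativisation, basic arithmetic.

module Recursion where
  open import Data.Fin.Base using (Fin; zero; suc)
  open import Data.Fin.Patterns using (0F; 1F; 2F; 3F)
  open import Data.Nat.Base
  open import Data.Nat.Properties
  open import Data.Nat.DivMod using (m%n≡m∸m/n*n; m*n/n≡m; /-monoˡ-≤; m<n*o⇒m/o<n)
  open import Data.Product using (_,_; proj₁; proj₂; _×_)
  open import Data.Sum.Base using (inj₁; inj₂)
  open import Data.Empty using (⊥; ⊥-elim)
  open import Data.Vec.Base using (Vec; []; _∷_; lookup; tabulate)
  open import Data.Vec.Properties using (lookup∘tabulate)
  open import Relation.Binary.PropositionalEquality
  open import Relation.Binary.Definitions using (tri<; tri≈; tri>)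
  open import Relation.Nullary using (yes; no)

  -- Lets the values of subcomputations be read off an arbitrary halting derivation. In the `mu⇓`
  -- case the smaller of two outputs would be a zero of `g` that the other derivation declares
  -- positive.
  deterministic : ∀ {O : Set} {α : O → ℕ → ℕ} {n} {c : Code O n} {xs y z} →
                  α ⊢ c [ xs ]⇓ y → α ⊢ c [ xs ]⇓ z → y ≡ z
  deterministic zero⇓ zero⇓ = refl
  deterministic suc⇓ suc⇓ = refl
  deterministic proj⇓ proj⇓ = refl
  deterministic {α = α} (comp⇓ {g = g} {ys = ys} ds d) (comp⇓ {ys = zs} es e) =
    deterministic d (subst (λ vs → α ⊢ g [ vs ]⇓ _) (sym (lookup-ext ys zs λ i → deterministic (ds i) (es i))) e)
    where
    lookup-ext : ∀ {m} (us vs : Vec ℕ m) → (∀ i → lookup us i ≡ lookup vs i) → us ≡ vs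
    lookup-ext [] [] eq = refl
    lookup-ext (u ∷ us) (v ∷ vs) eq = cong₂ _∷_ (eq zero) (lookup-ext us vs (λ i → eq (suc i)))
  deterministic (prec0⇓ d) (prec0⇓ e) = deterministic d e
  deterministic {α = α} (precs⇓ {h = h} d₁ d₂) (precs⇓ e₁ e₂) =
    deterministic d₂ (subst (λ r → α ⊢ h [ _ ∷ r ∷ _ ]⇓ _) (sym (deterministic d₁ e₁)) e₂)
  deterministic (mu⇓ {y = y} below d) (mu⇓ {y = z} below′ e) with <-cmp y z
  ... | tri≈ _ y≡z _ = y≡z
  ... | tri< y<z _ _ = ⊥-elim (0≢1+n (deterministic d (proj₂ (below′ y y<z))))
  ... | tri> _ _ z<y = ⊥-elim (1+n≢0 (deterministic (proj₂ (below z z<y)) e))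
  deterministic oracle⇓ oracle⇓ = refl

  mutual
    -- Allows the oracle-free code of a place to be composed with an oracle query at that place.
    relativise : ∀ {O : Set} {n} → Code ⊥ n → Code O n
    relativise zeroᶜ        = zeroᶜ
    relativise sucᶜ         = sucᶜ
    relativise (projᶜ i)    = projᶜ i
    relativise (compᶜ g hs) = compᶜ (relativise g) (relativises hs)
    relativise (precᶜ g h)  = precᶜ (relativise g) (relativise h)
    relativise (muᶜ g)      = muᶜ (relativise g)

    relativises : ∀ {O : Set} {m n} → Vec (Code ⊥ n) m → Vec (Code O n) m
    relativises []       = []
    relativises (h ∷ hs) = relativise h ∷ relativises hs

  lookup-relativises : ∀ {O : Set} {m n} (hs : Vec (Code ⊥ n) m) i →
                       lookup (relativises {O} hs) i ≡ relativise (lookup hs i)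
  lookup-relativises (h ∷ hs) zero    = refl
  lookup-relativises (h ∷ hs) (suc i) = lookup-relativises hs i

  relativise-⇓ : ∀ {O : Set} {α : ⊥ → ℕ → ℕ} {β : O → ℕ → ℕ} {n} {c : Code ⊥ n} {xs y} →
                 α ⊢ c [ xs ]⇓ y → β ⊢ relativise c [ xs ]⇓ y
  relativise-⇓ zero⇓ = zero⇓
  relativise-⇓ suc⇓ = suc⇓
  relativise-⇓ proj⇓ = proj⇓
  relativise-⇓ {β = β} (comp⇓ {hs = hs} ds d) =
    comp⇓ (λ i → subst (λ h → β ⊢ h [ _ ]⇓ _) (sym (lookup-relativises hs i)) (relativise-⇓ (ds i)))
          (relativise-⇓ d)
  relativise-⇓ (prec0⇓ d) = prec0⇓ (relativise-⇓ d)
  relativise-⇓ (precs⇓ d e) = precs⇓ (relativise-⇓ d) (relativise-⇓ e)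
  relativise-⇓ (mu⇓ below d) =
    mu⇓ (λ z z<y → proj₁ (below z z<y) , relativise-⇓ (proj₂ (below z z<y))) (relativise-⇓ d)

  -- A record rather than a synonym, so that `f` can be inferred from the type; unification would
  -- not recover it from an abstraction over vectors.
  record Recursive₁ (f : ℕ → ℕ) : Set where
    constructor curried₁
    field uncurried : Recursive {1} (λ xs → f (lookup xs 0F))

  record Recursive₂ (f : ℕ → ℕ → ℕ) : Set where
    constructor curried₂
    field uncurried : Recursive {2} (λ xs → f (lookup xs 0F) (lookup xs 1F))

  record Recursive₃ (f : ℕ → ℕ → ℕ → ℕ) : Set where
    constructor curried₃
    field uncurried : Recursive {3} (λ xs → f (lookup xs 0F) (lookup xs 1F) (lookup xs 2F))

  comp₁ : ∀ {n} {F : Vec ℕ 1 → ℕ} {G : Vec ℕ n → ℕ} →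
          Recursive F → Recursive G → Recursive (λ xs → F (G xs ∷ []))
  comp₁ (f , F⇓) (g , G⇓) =
    compᶜ f (g ∷ []) , λ xs → comp⇓ (λ { 0F → G⇓ xs }) (F⇓ _)

  comp₂ : ∀ {n} {F : Vec ℕ 2 → ℕ} {G H : Vec ℕ n → ℕ} →
          Recursive F → Recursive G → Recursive H → Recursive (λ xs → F (G xs ∷ H xs ∷ []))
  comp₂ (f , F⇓) (g , G⇓) (h , H⇓) =
    compᶜ f (g ∷ h ∷ []) , λ xs → comp⇓ (λ { 0F → G⇓ xs ; 1F → H⇓ xs }) (F⇓ _)

  comp₃ : ∀ {n} {F : Vec ℕ 3 → ℕ} {G H K : Vec ℕ n → ℕ} →
          Recursive F → Recursive G → Recursive H → Recursive K →
          Recursive (λ xs → F (G xs ∷ H xs ∷ K xs ∷ []))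
  comp₃ (f , F⇓) (g , G⇓) (h , H⇓) (k , K⇓) =
    compᶜ f (g ∷ h ∷ k ∷ []) ,
    λ xs → comp⇓ (λ { 0F → G⇓ xs ; 1F → H⇓ xs ; 2F → K⇓ xs }) (F⇓ _)

  ap₁ : ∀ {f : ℕ → ℕ} {n} {F : Vec ℕ n → ℕ} →
        Recursive₁ f → Recursive F → Recursive (λ xs → f (F xs))
  ap₁ (curried₁ rf) rF = comp₁ rf rF

  ap₂ : ∀ {f : ℕ → ℕ → ℕ} {n} {F G : Vec ℕ n → ℕ} →
        Recursive₂ f → Recursive F → Recursive G → Recursive (λ xs → f (F xs) (G xs))
  ap₂ (curried₂ rf) rF rG = comp₂ rf rF rG

  ap₃ : ∀ {f : ℕ → ℕ → ℕ → ℕ} {n} {F G H : Vec ℕ n → ℕ} →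
        Recursive₃ f → Recursive F → Recursive G → Recursive H →
        Recursive (λ xs → f (F xs) (G xs) (H xs))
  ap₃ (curried₃ rf) rF rG rH = comp₃ rf rF rG rH

  var : ∀ {n} (i : Fin n) → Recursive (λ xs → lookup xs i)
  var i = projᶜ i , λ xs → proj⇓

  sucʳ : ∀ {n} {F : Vec ℕ n → ℕ} → Recursive F → Recursive (λ xs → suc (F xs))
  sucʳ (f , F⇓) = compᶜ sucᶜ (f ∷ []) , λ xs → comp⇓ (λ { 0F → F⇓ xs }) suc⇓

  const : ∀ {n} k → Recursive {n} (λ _ → k)
  const zero    = compᶜ zeroᶜ [] , λ xs → comp⇓ (λ ()) zero⇓
  const (suc k) = sucʳ (const k)

  natrec : ℕ → (ℕ → ℕ → ℕ) → ℕ → ℕ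
  natrec z s zero    = z
  natrec z s (suc k) = s k (natrec z s k)

  natrecʳ : ∀ {n} {Z T : Vec ℕ n → ℕ} {S : Vec ℕ (2 + n) → ℕ} →
            Recursive Z → Recursive S → Recursive T →
            Recursive (λ xs → natrec (Z xs) (λ k r → S (k ∷ r ∷ xs)) (T xs))
  natrecʳ {n} {Z} {T} {S} (z , Z⇓) (s , S⇓) (t , T⇓) =
    compᶜ (precᶜ z s) (t ∷ tabulate projᶜ) , λ xs → comp⇓ (args xs) (loop xs (T xs))
    where
    args : ∀ xs i → lookup (t ∷ tabulate projᶜ) i [ xs ]⇓ lookup (T xs ∷ xs) i
    args xs zero    = T⇓ xs
    args xs (suc i) = subst (_[ xs ]⇓ lookup xs i) (sym (lookup∘tabulate projᶜ i)) proj⇓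
    loop : ∀ xs k → precᶜ z s [ k ∷ xs ]⇓ natrec (Z xs) (λ k r → S (k ∷ r ∷ xs)) k
    loop xs zero    = prec0⇓ (Z⇓ xs)
    loop xs (suc k) = precs⇓ (loop xs k) (S⇓ _)

  Recursive-resp-≗ : ∀ {n} {F G : Vec ℕ n → ℕ} → (∀ xs → F xs ≡ G xs) → Recursive F → Recursive G
  Recursive-resp-≗ F≗G (f , F⇓) = f , λ xs → subst (f [ xs ]⇓_) (F≗G xs) (F⇓ xs)

  +ʳ : Recursive₂ _+_
  +ʳ = curried₂ (Recursive-resp-≗ (λ xs → eq (lookup xs 0F) (lookup xs 1F)) (natrecʳ (var 1F) (sucʳ (var 1F)) (var 0F)))
    where
    eq : ∀ m n → natrec n (λ _ → suc) m ≡ m + n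
    eq zero    n = refl
    eq (suc m) n = cong suc (eq m n)

  *ʳ : Recursive₂ _*_
  *ʳ = curried₂ (Recursive-resp-≗ (λ xs → eq (lookup xs 0F) (lookup xs 1F))
         (natrecʳ (const 0) (ap₂ +ʳ (var 3F) (var 1F)) (var 0F)))
    where
    eq : ∀ m n → natrec 0 (λ _ → n +_) m ≡ m * n
    eq zero    n = refl
    eq (suc m) n = cong (n +_) (eq m n)

  2^ʳ : Recursive₁ (2 ^_)
  2^ʳ = curried₁ (Recursive-resp-≗ (λ xs → eq (lookup xs 0F)) (natrecʳ (const 1) (ap₂ *ʳ (const 2) (var 1F)) (var 0F)))
    where
    eq : ∀ m → natrec 1 (λ _ → 2 *_) m ≡ 2 ^ m
    eq zero    = refl
    eq (suc m) = cong (2 *_) (eq m)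

  predʳ : Recursive₁ pred
  predʳ = curried₁ (Recursive-resp-≗ (λ xs → eq (lookup xs 0F)) (natrecʳ (const 0) (var 0F) (var 0F)))
    where
    eq : ∀ m → natrec 0 (λ k _ → k) m ≡ pred m
    eq zero    = refl
    eq (suc m) = refl

  ∸ʳ : Recursive₂ _∸_
  ∸ʳ = curried₂ (Recursive-resp-≗ (λ xs → eq (lookup xs 0F) (lookup xs 1F))
         (natrecʳ (var 0F) (ap₁ predʳ (var 1F)) (var 1F)))
    where
    eq : ∀ m n → natrec m (λ _ → pred) n ≡ m ∸ n
    eq m zero    = refl
    eq m (suc n) = trans (cong pred (eq m n)) (pred[m∸n]≡m∸[1+n] m n)

  ifzero : ℕ → ℕ → ℕ → ℕ
  ifzero zero    x y = x
  ifzero (suc _) x y = y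

  ifzeroʳ : Recursive₃ ifzero
  ifzeroʳ = curried₃ (Recursive-resp-≗ (λ xs → eq (lookup xs 0F) (lookup xs 1F) (lookup xs 2F))
              (natrecʳ (var 1F) (var 4F) (var 0F)))
    where
    open import Data.Fin.Patterns using (4F)
    eq : ∀ c x y → natrec x (λ _ _ → y) c ≡ ifzero c x y
    eq zero    x y = refl
    eq (suc _) x y = refl

  -- Zero codes truth: `m ∸ n` serves as the characteristic function of `m ≤ n` in all the tests
  -- that follow.
  ifzero-≤ : ∀ {m n} → m ≤ n → ∀ {x y} → ifzero (m ∸ n) x y ≡ x
  ifzero-≤ m≤n rewrite m≤n⇒m∸n≡0 m≤n = refl

  ifzero-> : ∀ {m n} → n < m → ∀ {x y} → ifzero (m ∸ n) x y ≡ y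
  ifzero-> {m} {n} n<m with m ∸ n in eq
  ... | zero  = ⊥-elim (<⇒≱ n<m (m∸n≡0⇒m≤n eq))
  ... | suc _ = refl

  -- Counts up through the dividends, raising the quotient whenever the next multiple of the divisor
  -- is reached; the inequalities of `spec` determine the quotient.
  /ʳ : Recursive₂ (λ x d → x / suc d)
  /ʳ = curried₂ (Recursive-resp-≗ (λ xs → quot≡/ (lookup xs 0F) (lookup xs 1F))
         (natrecʳ (const 0)
           (ap₃ ifzeroʳ (ap₂ ∸ʳ (ap₂ *ʳ (sucʳ (var 1F)) (sucʳ (var 3F))) (sucʳ (var 0F)))
             (sucʳ (var 1F)) (var 1F))
           (var 0F)))
    where
    step : ℕ → ℕ → ℕ → ℕ
    step d k q = ifzero (suc q * suc d ∸ suc k) (suc q) q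
    quot : ℕ → ℕ → ℕ
    quot x d = natrec 0 (step d) x
    spec : ∀ x d → quot x d * suc d ≤ x × x < suc (quot x d) * suc d
    spec zero    d = z≤n , s≤s z≤n
    spec (suc x) d with spec x d | suc (quot x d) * suc d ≤? suc x
    ... | lo , hi | yes p rewrite ifzero-≤ p {suc (quot x d)} {quot x d} =
      p , ≤-trans (s≤s hi) (+-monoˡ-≤ _ (s≤s z≤n))
    ... | lo , hi | no ¬p rewrite ifzero-> (≰⇒> ¬p) {suc (quot x d)} {quot x d} =
      m≤n⇒m≤1+n lo , ≰⇒> ¬p
    quot≡/ : ∀ x d → quot x d ≡ x / suc d
    quot≡/ x d = ≤-antisym (subst (_≤ x / suc d) (m*n/n≡m (quot x d) (suc d)) (/-monoˡ-≤ (suc d) (proj₁ (spec x d))))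
                   (s≤s⁻¹ (m<n*o⇒m/o<n {x} {suc (quot x d)} {suc d} (proj₂ (spec x d))))

  %ʳ : Recursive₂ (λ x d → x % suc d)
  %ʳ = curried₂ (Recursive-resp-≗ (λ xs → sym (m%n≡m∸m/n*n (lookup xs 0F) (suc (lookup xs 1F))))
         (ap₂ ∸ʳ (var 0F) (ap₂ *ʳ (ap₂ /ʳ (var 0F) (var 1F)) (sucʳ (var 1F)))))

  ⊔ʳ : Recursive₂ _⊔_
  ⊔ʳ = curried₂ (Recursive-resp-≗ (λ xs → eq (lookup xs 0F) (lookup xs 1F))
         (ap₂ +ʳ (var 0F) (ap₂ ∸ʳ (var 1F) (var 0F))))
    where
    eq : ∀ m n → m + (n ∸ m) ≡ m ⊔ n
    eq m n with ≤-total m n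
    ... | inj₁ m≤n = trans (m+[n∸m]≡n m≤n) (sym (m≤n⇒m⊔n≡n m≤n))
    ... | inj₂ n≤m = trans (cong (m +_) (m≤n⇒m∸n≡0 n≤m)) (trans (+-identityʳ m) (sym (m≥n⇒m⊔n≡m n≤m)))

-- Rational arithmetic with natural numbers and powers of two.

module Rationals where
  open import Data.Nat.Base as ℕ using (ℕ; zero; suc)
  import Data.Nat.Properties as ℕ
  import Data.Integer.Base as ℤ
  import Data.Integer.Properties as ℤ
  open import Data.Rational.Base hiding (_÷_)
  open import Data.Rational.Properties
  open import Data.Rational.Unnormalised.Base as ℚᵘ using (mkℚᵘ; *≤*; *≡*)
  import Data.Rational.Unnormalised.Properties as ℚᵘ
  open import Data.Rational.Solver using (module +-*-Solver)
  open +-*-Solver using (solve; con; _:=_; _:+_; _:*_; _:-_; :-_)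
  open import Data.Empty using (⊥-elim)
  open import Relation.Binary.PropositionalEquality
  open import Relation.Nullary using (yes; no)

  -- The device for linear inequalities: the known ones are added up to `p ≤ q`, and the ring solver
  -- checks that the goal has the same gap.
  fromDiff : ∀ {p q r s} → p ≤ q → s - r ≡ q - p → r ≤ s
  fromDiff {p} {q} {r} {s} p≤q eq =
    subst₂ _≤_ (solve 2 (λ p r → p :+ (r :- p) := r) refl p r)
      (trans (solve 3 (λ p q r → q :+ (r :- p) := r :+ (q :- p)) refl p q r)
        (trans (cong (r +_) (sym eq)) (solve 2 (λ r s → r :+ (s :- r) := s) refl r s)))
      (+-monoˡ-≤ (r - p) p≤q)

  -- Defined by recursion so that closed numerals compute and successors unfold to sums inside the
  -- ring solver.
  ι : ℕ → ℚ
  ι zero    = 0ℚ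
  ι (suc n) = 1ℚ + ι n

  ι-+ : ∀ m n → ι (m ℕ.+ n) ≡ ι m + ι n
  ι-+ zero    n = sym (+-identityˡ (ι n))
  ι-+ (suc m) n = trans (cong (1ℚ +_) (ι-+ m n)) (sym (+-assoc 1ℚ (ι m) (ι n)))

  ι-* : ∀ m n → ι (m ℕ.* n) ≡ ι m * ι n
  ι-* zero    n = sym (*-zeroˡ (ι n))
  ι-* (suc m) n = begin
    ι (n ℕ.+ m ℕ.* n)        ≡⟨ ι-+ n (m ℕ.* n) ⟩
    ι n + ι (m ℕ.* n)        ≡⟨ cong (ι n +_) (ι-* m n) ⟩
    ι n + ι m * ι n          ≡⟨ solve 2 (λ x y → y :+ x :* y := (con 1ℚ :+ x) :* y) refl (ι m) (ι n) ⟩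
    (1ℚ + ι m) * ι n         ∎
    where open ≡-Reasoning

  ι-def : ∀ n → ι n ≡ ℤ.+ n / 1
  ι-def zero    = refl
  ι-def (suc n) = toℚᵘ-injective (begin
    toℚᵘ (1ℚ + ι n)                        ≈⟨ toℚᵘ-homo-+ 1ℚ (ι n) ⟩
    ℚᵘ.1ℚᵘ ℚᵘ.+ toℚᵘ (ι n)                 ≡⟨ cong (λ q → ℚᵘ.1ℚᵘ ℚᵘ.+ toℚᵘ q) (ι-def n) ⟩
    ℚᵘ.1ℚᵘ ℚᵘ.+ toℚᵘ (ℤ.+ n / 1)           ≈⟨ ℚᵘ.+-congʳ ℚᵘ.1ℚᵘ (toℚᵘ-fromℚᵘ (mkℚᵘ (ℤ.+ n) 0)) ⟩
    ℚᵘ.1ℚᵘ ℚᵘ.+ mkℚᵘ (ℤ.+ n) 0             ≈⟨ *≡* (cong (λ i → (ℤ.+ 1 ℤ.+ i) ℤ.* ℤ.+ 1) (ℤ.*-identityʳ (ℤ.+ n))) ⟩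
    mkℚᵘ (ℤ.+ suc n) 0                     ≈⟨ toℚᵘ-fromℚᵘ (mkℚᵘ (ℤ.+ suc n) 0) ⟨
    toℚᵘ (ℤ.+ suc n / 1)                   ∎)
    where open ℚᵘ.≃-Reasoning

  ιᵘ : ∀ n → toℚᵘ (ι n) ℚᵘ.≃ mkℚᵘ (ℤ.+ n) 0
  ιᵘ n = subst (λ q → toℚᵘ q ℚᵘ.≃ mkℚᵘ (ℤ.+ n) 0) (sym (ι-def n)) (toℚᵘ-fromℚᵘ (mkℚᵘ (ℤ.+ n) 0))

  ι-mono-≤ : ∀ {m n} → m ℕ.≤ n → ι m ≤ ι n
  ι-mono-≤ {m} {n} m≤n = toℚᵘ-cancel-≤ (begin
    toℚᵘ (ι m)     ≃⟨ ιᵘ m ⟩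
    mkℚᵘ (ℤ.+ m) 0 ≤⟨ *≤* (ℤ.*-monoʳ-≤-nonNeg (ℤ.+ 1) (ℤ.+≤+ m≤n)) ⟩
    mkℚᵘ (ℤ.+ n) 0 ≃⟨ ιᵘ n ⟨
    toℚᵘ (ι n)     ∎)
    where open ℚᵘ.≤-Reasoning

  ι-cancel-≤ : ∀ {m n} → ι m ≤ ι n → m ℕ.≤ n
  ι-cancel-≤ {m} {n} le with ℚᵘ.≤-respˡ-≃ (ιᵘ m) (ℚᵘ.≤-respʳ-≃ (ιᵘ n) (toℚᵘ-mono-≤ le))
  ... | *≤* p = ℤ.drop‿+≤+ (ℤ.*-cancelʳ-≤-pos (ℤ.+ m) (ℤ.+ n) (ℤ.+ 1) p)

  0≤ι : ∀ n → 0ℚ ≤ ι n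
  0≤ι n = ι-mono-≤ {0} {n} ℕ.z≤n

  /-def : ∀ i d → (i / suc d) * ι (suc d) ≡ i / 1
  /-def i d = toℚᵘ-injective (begin
    toℚᵘ (i / suc d * ι (suc d))                    ≈⟨ toℚᵘ-homo-* (i / suc d) (ι (suc d)) ⟩
    toℚᵘ (i / suc d) ℚᵘ.* toℚᵘ (ι (suc d))          ≈⟨ ℚᵘ.*-cong (toℚᵘ-fromℚᵘ (mkℚᵘ i d)) (ιᵘ (suc d)) ⟩
    mkℚᵘ i d ℚᵘ.* mkℚᵘ (ℤ.+ suc d) 0                ≈⟨ *≡* (trans (ℤ.*-identityʳ _) (cong (λ n → i ℤ.* ℤ.+ suc n) (sym (ℕ.*-identityʳ d)))) ⟩
    mkℚᵘ i 0                                        ≈⟨ toℚᵘ-fromℚᵘ (mkℚᵘ i 0) ⟨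
    toℚᵘ (i / 1)                                    ∎)
    where open ℚᵘ.≃-Reasoning

  /-mono-≤ : ∀ {i j} → i ℤ.≤ j → i / 1 ≤ j / 1
  /-mono-≤ {i} {j} i≤j = toℚᵘ-cancel-≤ (begin
    toℚᵘ (i / 1)     ≃⟨ toℚᵘ-fromℚᵘ (mkℚᵘ i 0) ⟩
    mkℚᵘ i 0         ≤⟨ *≤* (ℤ.*-monoʳ-≤-nonNeg (ℤ.+ 1) i≤j) ⟩
    mkℚᵘ j 0         ≃⟨ toℚᵘ-fromℚᵘ (mkℚᵘ j 0) ⟨
    toℚᵘ (j / 1)     ∎)
    where open ℚᵘ.≤-Reasoning

  0≤2^- : ∀ k → 0ℚ ≤ 2^- k
  0≤2^- zero    = nonNegative⁻¹ 1ℚ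
  0≤2^- (suc k) = subst (_≤ ½ * 2^- k) (*-zeroʳ ½) (*-monoˡ-≤-nonNeg ½ (0≤2^- k))

  *-monoʳ : ∀ {p q r} → 0ℚ ≤ r → p ≤ q → p * r ≤ q * r
  *-monoʳ {r = r} 0≤r p≤q = *-monoʳ-≤-nonNeg r {{nonNegative 0≤r}} p≤q

  *-nonNeg : ∀ {p q} → 0ℚ ≤ p → 0ℚ ≤ q → 0ℚ ≤ p * q
  *-nonNeg {p} {q} 0≤p 0≤q = subst (_≤ p * q) (*-zeroˡ q) (*-monoʳ 0≤q 0≤p)

  2^-inverse : ∀ m → ι (2 ℕ.^ m) * 2^- m ≡ 1ℚ
  2^-inverse zero    = refl
  2^-inverse (suc m) = begin
    ι (2 ℕ.* 2 ℕ.^ m) * (½ * 2^- m)     ≡⟨ cong (_* (½ * 2^- m)) (ι-* 2 (2 ℕ.^ m)) ⟩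
    ι 2 * ι (2 ℕ.^ m) * (½ * 2^- m)     ≡⟨ solve 2 (λ x y → con (ι 2) :* x :* (con ½ :* y) := x :* y) refl (ι (2 ℕ.^ m)) (2^- m) ⟩
    ι (2 ℕ.^ m) * 2^- m                 ≡⟨ 2^-inverse m ⟩
    1ℚ                                  ∎
    where open ≡-Reasoning

  1/2^≡2^- : ∀ m → (ℤ.+ 1 / (2 ℕ.^ m)) {{ℕ.m^n≢0 2 m}} ≡ 2^- m
  1/2^≡2^- m = go (2 ℕ.^ m) {{ℕ.m^n≢0 2 m}} (2^-inverse m)
    where
    -- The power of two is generalised to `n` so that it can be matched against a successor.
    go : ∀ n .{{_ : ℕ.NonZero n}} → ι n * 2^- m ≡ 1ℚ → ℤ.+ 1 / n ≡ 2^- m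
    go (suc n) eq = begin
      r                            ≡⟨ *-identityʳ r ⟨
      r * 1ℚ                       ≡⟨ cong (r *_) eq ⟨
      r * (ι (suc n) * 2^- m)      ≡⟨ *-assoc r (ι (suc n)) (2^- m) ⟨
      r * ι (suc n) * 2^- m        ≡⟨ cong (_* 2^- m) (/-def (ℤ.+ 1) n) ⟩
      1ℚ * 2^- m                   ≡⟨ *-identityˡ (2^- m) ⟩
      2^- m                        ∎
      where
      open ≡-Reasoning
      r = ℤ.+ 1 / suc n

  ≤-of-*2^ : ∀ m {p q} → p * ι (2 ℕ.^ m) ≤ q * ι (2 ℕ.^ m) → p ≤ q
  ≤-of-*2^ m {p} {q} le = subst₂ _≤_ (cancel p) (cancel q) (*-monoʳ (0≤2^- m) le)
    where
    cancel : ∀ p → p * ι (2 ℕ.^ m) * 2^- m ≡ p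
    cancel p = trans (*-assoc p _ _) (trans (cong (p *_) (2^-inverse m)) (*-identityʳ p))

  2^>n : ∀ n → n ℕ.< 2 ℕ.^ n
  2^>n zero    = ℕ.s≤s ℕ.z≤n
  2^>n (suc n) = ℕ.≤-trans (ℕ.s≤s (2^>n n)) (ℕ.+-mono-≤ (ℕ.m^n>0 2 n) (ℕ.≤-reflexive (sym (ℕ.+-identityʳ _))))

  -- A positive rational n/d is at least 1/d, hence exceeds 2^-d.
  archimedean : ∀ {p q} → (∀ j → p ≤ q + 2^- j) → p ≤ q
  archimedean {p} {q} bound with p ≤? q
  ... | yes p≤q = p≤q
  ... | no p≰q  = ⊥-elim (ℕ.<⇒≱ (2^>n (suc d)) (ι-cancel-≤ {2 ℕ.^ suc d} (≤-trans (≤-reflexive lhs) (≤-trans scaled (≤-reflexive rhs)))))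
    where
    δ = p - q
    d = ℚ.denominator-1 δ
    0<δ : 0ℚ < δ
    0<δ = subst (_< δ) (+-inverseʳ q) (+-monoˡ-< (- q) (≰⇒> p≰q))
    δ·d : δ * ι (suc d) ≡ ℚ.numerator δ / 1
    δ·d = trans (cong (_* ι (suc d)) (sym (↥p/↧p≡p δ))) (/-def (ℚ.numerator δ) d)
    1≤num : 1ℚ ≤ ℚ.numerator δ / 1
    1≤num = go δ (positive 0<δ)
      where
      go : ∀ r → Positive r → 1ℚ ≤ ℚ.numerator r / 1
      go (mkℚ ℤ.+[1+ n ] _ _) _ = /-mono-≤ {ℤ.+ 1} {ℤ.+[1+ n ]} (ℤ.+≤+ (ℕ.s≤s ℕ.z≤n))
    δ≤ : δ ≤ 2^- suc d
    δ≤ = fromDiff (bound (suc d)) (solve 3 (λ p q e → e :- (p :- q) := (q :+ e) :- p) refl p q (2^- suc d))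
    open ≤-Reasoning
    scaled : 1ℚ * ι (2 ℕ.^ suc d) ≤ 2^- suc d * ι (suc d) * ι (2 ℕ.^ suc d)
    scaled = *-monoʳ (0≤ι (2 ℕ.^ suc d)) (≤-trans 1≤num (subst (_≤ 2^- suc d * ι (suc d)) δ·d (*-monoʳ (0≤ι (suc d)) δ≤)))
    lhs : ι (2 ℕ.^ suc d) ≡ 1ℚ * ι (2 ℕ.^ suc d)
    lhs = sym (*-identityˡ _)
    rhs : 2^- suc d * ι (suc d) * ι (2 ℕ.^ suc d) ≡ ι (suc d)
    rhs = trans (solve 3 (λ a b c → a :* b :* c := b :* (c :* a)) refl (2^- suc d) (ι (suc d)) (ι (2 ℕ.^ suc d)))
            (trans (cong (ι (suc d) *_) (2^-inverse (suc d))) (*-identityʳ _))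

  2^-+ : ∀ m n → 2^- (m ℕ.+ n) ≡ 2^- m * 2^- n
  2^-+ zero    n = sym (*-identityˡ (2^- n))
  2^-+ (suc m) n = trans (cong (½ *_) (2^-+ m n)) (sym (*-assoc ½ (2^- m) (2^- n)))

  -- Constant factors of the error are harmless: j may be replaced by c + j, and c ≤ 2^c.
  archimedean-* : ∀ c {p q} → (∀ j → p ≤ q + ι c * 2^- j) → p ≤ q
  archimedean-* c {p} {q} bound = archimedean λ j → ≤-trans (bound (c ℕ.+ j)) (+-monoʳ-≤ q (begin
    ι c * 2^- (c ℕ.+ j)          ≡⟨ trans (cong (ι c *_) (2^-+ c j)) (sym (*-assoc (ι c) (2^- c) (2^- j))) ⟩
    ι c * 2^- c * 2^- j          ≤⟨ *-monoʳ (0≤2^- j) (*-monoʳ (0≤2^- c) (ι-mono-≤ (ℕ.<⇒≤ (2^>n c)))) ⟩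
    ι (2 ℕ.^ c) * 2^- c * 2^- j  ≡⟨ cong (_* 2^- j) (2^-inverse c) ⟩
    1ℚ * 2^- j                   ≡⟨ *-identityˡ (2^- j) ⟩
    2^- j                        ∎))
    where open ≤-Reasoning

  0≤1/n : ∀ n .{{_ : ℕ.NonZero n}} → 0ℚ ≤ ℤ.+ 1 / n
  0≤1/n n = nonNegative⁻¹ (ℤ.+ 1 / n) {{normalize-nonNeg 1 n}}

  1/n≤1 : ∀ n .{{_ : ℕ.NonZero n}} → ℤ.+ 1 / n ≤ 1ℚ
  1/n≤1 (suc d) = subst₂ _≤_ (*-identityˡ r) (trans (*-comm (ι (suc d)) r) (/-def (ℤ.+ 1) d))
                    (*-monoʳ {r = r} (0≤1/n (suc d)) (ι-mono-≤ {1} {suc d} (ℕ.s≤s ℕ.z≤n)))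
    where r = ℤ.+ 1 / suc d

  ≤-of-*ι : ∀ d {p q} → p * ι (suc d) ≤ q * ι (suc d) → p ≤ q
  ≤-of-*ι d {p} {q} le = subst₂ _≤_ (cancel p) (cancel q) (*-monoʳ (0≤1/n (suc d)) le)
    where
    cancel : ∀ p → p * ι (suc d) * (ℤ.+ 1 / suc d) ≡ p
    cancel p = trans (*-assoc p (ι (suc d)) _) (trans (cong (p *_)
      (trans (*-comm (ι (suc d)) _) (/-def (ℤ.+ 1) d))) (*-identityʳ p))

-- Rational bounds on reals.

module Bounds where
  open Rationals
  open import Data.Nat.Base as ℕ using (ℕ; suc)
  import Data.Integer.Base as ℤ
  open import Data.Rational.Base hiding (_÷_)
  open import Data.Rational.Properties
  open import Data.Rational.Solver using (module +-*-Solver)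
  open +-*-Solver using (solve; con; _:=_; _:+_; _:*_; _:-_; :-_)
  open import Data.Sum.Base using (inj₁; inj₂)
  open import Relation.Binary.PropositionalEquality

  -- Reals enter the argument through rational bounds only; stating such a bound for every
  -- approximation lets it pass through the real operations without loss.
  record Upper (x : ℝ) (q : ℚ) : Set where
    constructor upper
    field approx≤ : ∀ j → approx x j ≤ q + 2^- j

  record Lower (q : ℚ) (x : ℝ) : Set where
    constructor lower
    field ≤approx : ∀ j → q ≤ approx x j + 2^- j

  open Upper
  open Lower

  p≤∣p∣ : ∀ p → p ≤ ∣ p ∣
  p≤∣p∣ p with ≤-total 0ℚ p
  ... | inj₁ 0≤p = ≤-reflexive (sym (0≤p⇒∣p∣≡p 0≤p))
  ... | inj₂ p≤0 = ≤-trans p≤0 (0≤∣p∣ p)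

  ∣p-q∣≤r⇒p≤q+r : ∀ p q {r} → ∣ p - q ∣ ≤ r → p ≤ q + r
  ∣p-q∣≤r⇒p≤q+r p q {r} le = fromDiff (≤-trans (p≤∣p∣ (p - q)) le)
    (solve 3 (λ p q r → (q :+ r) :- p := r :- (p :- q)) refl p q r)

  ∣p-q∣≤r⇒q≤p+r : ∀ p q {r} → ∣ p - q ∣ ≤ r → q ≤ p + r
  ∣p-q∣≤r⇒q≤p+r p q {r} le = ∣p-q∣≤r⇒p≤q+r q p (subst (_≤ r)
    (trans (sym (∣-p∣≡∣p∣ (p - q))) (cong ∣_∣ (solve 2 (λ p q → :- (p :- q) := q :- p) refl p q))) le)

  -- By regularity the k-th approximation is within 2^-k + 2^-(j+1) of the (j+1)-st, and j is
  -- arbitrary. The index is shifted because real addition evaluates its summands at `suc j`.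
  Upper-of : ∀ c {x q} → (∀ j → approx x (suc j) ≤ q + ι c * 2^- j) → Upper x q
  Upper-of c {x} {q} bound = upper λ k → archimedean-* (suc c) λ j → fromDiff
    (+-mono-≤ (+-mono-≤ (bound j) (∣p-q∣≤r⇒p≤q+r (approx x k) (approx x (suc j)) (regular x k (suc j)))) (0≤2^- (suc j)))
    (solve 6 (λ a b q e c d → (q :+ e :+ (con 1ℚ :+ c) :* d) :- a
        := (q :+ c :* d :+ (b :+ (e :+ con ½ :* d)) :+ con ½ :* d) :- (b :+ a :+ con 0ℚ))
      refl (approx x k) (approx x (suc j)) q (2^- k) (ι c) (2^- j))

  Lower-of : ∀ c {x q} → (∀ j → q ≤ approx x (suc j) + ι c * 2^- j) → Lower q x
  Lower-of c {x} {q} bound = lower λ k → archimedean-* (suc c) λ j → fromDiff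
    (+-mono-≤ (+-mono-≤ (bound j) (∣p-q∣≤r⇒q≤p+r (approx x k) (approx x (suc j)) (regular x k (suc j)))) (0≤2^- (suc j)))
    (solve 6 (λ a b q e c d → (a :+ e :+ (con 1ℚ :+ c) :* d) :- q
        := (b :+ c :* d :+ (a :+ (e :+ con ½ :* d)) :+ con ½ :* d) :- (q :+ b :+ con 0ℚ))
      refl (approx x k) (approx x (suc j)) q (2^- k) (ι c) (2^- j))

  Upper-weaken : ∀ {x p q} → p ≤ q → Upper x p → Upper x q
  Upper-weaken p≤q u = upper λ j → ≤-trans (approx≤ u j) (+-monoˡ-≤ (2^- j) p≤q)

  Lower-weaken : ∀ {x p q} → p ≤ q → Lower q x → Lower p x
  Lower-weaken p≤q l = lower λ j → ≤-trans p≤q (≤approx l j)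

  Upper-+ : ∀ {x y p q} → Upper x p → Upper y q → Upper (x +ᴿ y) (p + q)
  Upper-+ {p = p} {q} u v = upper λ j → ≤-trans (+-mono-≤ (approx≤ u (suc j)) (approx≤ v (suc j))) (≤-reflexive
    (solve 3 (λ p q e → (p :+ con ½ :* e) :+ (q :+ con ½ :* e) := p :+ q :+ e) refl p q (2^- j)))

  Lower-+ : ∀ {x y p q} → Lower p x → Lower q y → Lower (p + q) (x +ᴿ y)
  Lower-+ {x} {y} l m = lower λ j → ≤-trans (+-mono-≤ (≤approx l (suc j)) (≤approx m (suc j))) (≤-reflexive
    (solve 3 (λ p q e → (p :+ con ½ :* e) :+ (q :+ con ½ :* e) := p :+ q :+ e) refl
      (approx x (suc j)) (approx y (suc j)) (2^- j)))

  Upper-÷ : ∀ {x q} n .{{_ : ℕ.NonZero n}} → Upper x q → Upper (x ÷ n) (q * (ℤ.+ 1 / n))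
  Upper-÷ {x} {q} n u = upper λ j → begin
    approx x j * r      ≤⟨ *-monoʳ (0≤1/n n) (approx≤ u j) ⟩
    (q + 2^- j) * r     ≡⟨ *-distribʳ-+ r q (2^- j) ⟩
    q * r + 2^- j * r   ≤⟨ +-monoʳ-≤ (q * r) (≤-trans (*-monoˡ-≤-nonNeg (2^- j) {{nonNegative (0≤2^- j)}} (1/n≤1 n)) (≤-reflexive (*-identityʳ (2^- j)))) ⟩
    q * r + 2^- j       ∎
    where
    open ≤-Reasoning
    r = ℤ.+ 1 / n

  Lower-÷ : ∀ {x q} n .{{_ : ℕ.NonZero n}} → Lower q x → Lower (q * (ℤ.+ 1 / n)) (x ÷ n)
  Lower-÷ {x} {q} n l = lower λ j → begin
    q * r                        ≤⟨ *-monoʳ (0≤1/n n) (≤approx l j) ⟩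
    (approx x j + 2^- j) * r     ≡⟨ *-distribʳ-+ r (approx x j) (2^- j) ⟩
    approx x j * r + 2^- j * r   ≤⟨ +-monoʳ-≤ (approx x j * r) (≤-trans (*-monoˡ-≤-nonNeg (2^- j) {{nonNegative (0≤2^- j)}} (1/n≤1 n)) (≤-reflexive (*-identityʳ (2^- j)))) ⟩
    approx x j * r + 2^- j       ∎
    where
    open ≤-Reasoning
    r = ℤ.+ 1 / n

  Lower≤Upper : ∀ {x p q} → Lower p x → Upper x q → p ≤ q
  Lower≤Upper {x} {p} {q} l u = archimedean-* 2 λ j → fromDiff (+-mono-≤ (≤approx l j) (approx≤ u j))
    (solve 4 (λ p q a e → (q :+ con (ι 2) :* e) :- p := (a :+ e :+ (q :+ e)) :- (p :+ a)) refl p q (approx x j) (2^- j))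

  ≤ᴿ-Upper : ∀ {x y q} → x ≤ᴿ y → Upper y q → Upper x q
  ≤ᴿ-Upper {x} {y} {q} x≤y u = Upper-of 2 λ j → fromDiff
    (+-mono-≤ (+-mono-≤ (x≤y (suc j)) (approx≤ u (suc j))) (0≤2^- (suc j)))
    (solve 4 (λ a b q e → (q :+ con (ι 2) :* e) :- a
       := (b :+ (con ½ :* e :+ con ½ :* e) :+ (q :+ con ½ :* e) :+ con ½ :* e) :- (a :+ b :+ con 0ℚ))
      refl (approx x (suc j)) (approx y (suc j)) q (2^- j))

  0≤ᴿ-Lower : ∀ {x} → 0ℝ ≤ᴿ x → Lower 0ℚ x
  0≤ᴿ-Lower {x} 0≤x = Lower-of 1 λ j → ≤-trans (0≤x (suc j))
    (≤-reflexive (solve 2 (λ a e → a :+ (con ½ :* e :+ con ½ :* e) := a :+ con (ι 1) :* e) refl (approx x (suc j)) (2^- j)))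

  distance-Upper : ∀ {x q r} → ∣ x -ᴿ fromℚ q ∣ᴿ ≤ᴿ fromℚ r → Upper x (q + r)
  distance-Upper {x} {q} {r} d = Upper-of 2 λ j → ≤-trans (∣p-q∣≤r⇒p≤q+r (approx x (suc j)) q (d j))
    (≤-reflexive (solve 3 (λ q r e → q :+ (r :+ (e :+ e)) := q :+ r :+ con (ι 2) :* e) refl q r (2^- j)))

  distance-Lower : ∀ {x q r} → ∣ x -ᴿ fromℚ q ∣ᴿ ≤ᴿ fromℚ r → Lower (q - r) x
  distance-Lower {x} {q} {r} d = Lower-of 2 λ j → fromDiff (∣p-q∣≤r⇒q≤p+r (approx x (suc j)) q (d j))
    (solve 4 (λ a q r e → (a :+ con (ι 2) :* e) :- (q :- r) := (a :+ (r :+ (e :+ e))) :- q) refl (approx x (suc j)) q r (2^- j))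

  distance-≤ : ∀ {x y p q r} → ∣ x -ᴿ y ∣ᴿ ≤ᴿ fromℚ r → Lower p x → Upper y q → p ≤ q + r
  distance-≤ {x} {y} {p} {q} {r} d l u = archimedean-* 3 λ j → fromDiff
    (+-mono-≤ (+-mono-≤ (∣p-q∣≤r⇒p≤q+r (approx x (suc j)) (approx y (suc j)) (d j)) (≤approx l (suc j))) (approx≤ u (suc j)))
    (solve 6 (λ a b p q r e → (q :+ r :+ con (ι 3) :* e) :- p
        := (b :+ (r :+ (e :+ e)) :+ (a :+ con ½ :* e) :+ (q :+ con ½ :* e)) :- (a :+ p :+ b))
      refl (approx x (suc j)) (approx y (suc j)) p q r (2^- j))

  distance-≥ : ∀ {x y p q r} → ∣ x -ᴿ y ∣ᴿ ≤ᴿ fromℚ r → Upper x p → Lower q y → q ≤ p + r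
  distance-≥ {x} {y} {p} {q} {r} d u l = archimedean-* 3 λ j → fromDiff
    (+-mono-≤ (+-mono-≤ (∣p-q∣≤r⇒q≤p+r (approx x (suc j)) (approx y (suc j)) (d j)) (≤approx l (suc j))) (approx≤ u (suc j)))
    (solve 6 (λ a b p q r e → (p :+ r :+ con (ι 3) :* e) :- q
        := (a :+ (r :+ (e :+ e)) :+ (b :+ con ½ :* e) :+ (p :+ con ½ :* e)) :- (b :+ q :+ a))
      refl (approx x (suc j)) (approx y (suc j)) p q r (2^- j))

  Upper-fromℚ : ∀ q → Upper (fromℚ q) q
  Upper-fromℚ q = upper λ j → subst (_≤ q + 2^- j) (+-identityʳ q) (+-monoʳ-≤ q (0≤2^- j))

  Lower-fromℚ : ∀ q → Lower q (fromℚ q)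
  Lower-fromℚ q = lower (approx≤ (Upper-fromℚ q))

  -- A diagonal argument: at precision k + 1 the k-th member of the sequence is compared with the
  -- limit, at the cost of a fixed multiple of 2^-k.
  limit-Lower : ∀ (x : ℕ → ℝ) {y q} → (∀ k → ∣ x k -ᴿ y ∣ᴿ ≤ᴿ fromℚ (2^- k)) → (∀ k → Lower q (x k)) → Lower q y
  limit-Lower x {y} {q} d l = Lower-of 4 λ k → fromDiff
    (+-mono-≤ (+-mono-≤ (∣p-q∣≤r⇒p≤q+r (approx (x k) (suc k)) (approx y (suc k)) (d k k)) (≤approx (l k) (suc k))) (0≤2^- (suc k)))
    (solve 4 (λ a b q e → (b :+ con (ι 4) :* e) :- q
        := (b :+ (e :+ (e :+ e)) :+ (a :+ con ½ :* e) :+ con ½ :* e) :- (a :+ q :+ con 0ℚ)) refl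
      (approx (x k) (suc k)) (approx y (suc k)) q (2^- k))

  Upper-neg : ∀ {x q} → Lower q x → Upper (-ᴿ x) (- q)
  Upper-neg {x} {q} l = upper λ j → fromDiff (≤approx l j)
    (solve 3 (λ a q e → (:- q :+ e) :- :- a := a :+ e :- q) refl (approx x j) q (2^- j))

  Lower-neg : ∀ {x q} → Upper x q → Lower (- q) (-ᴿ x)
  Lower-neg {x} {q} u = lower λ j → fromDiff (approx≤ u j)
    (solve 3 (λ a q e → (:- a :+ e) :- :- q := q :+ e :- a) refl (approx x j) q (2^- j))

  Upper⇒≤ᴿ : ∀ {x q} → Upper x q → x ≤ᴿ fromℚ q
  Upper⇒≤ᴿ {x} {q} u j = fromDiff (+-mono-≤ (approx≤ u j) (0≤2^- j))
    (solve 3 (λ a q e → (q :+ (e :+ e)) :- a := q :+ e :+ e :- (a :+ con 0ℚ)) refl (approx x j) q (2^- j))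

  Upper-fromℕ : ∀ n → Upper (fromℕ n) (ι n)
  Upper-fromℕ n = subst (Upper (fromℕ n)) (sym (ι-def n)) (Upper-fromℚ _)

  Lower-fromℕ : ∀ n → Lower (ι n) (fromℕ n)
  Lower-fromℕ n = subst (λ q → Lower q (fromℕ n)) (sym (ι-def n)) (Lower-fromℚ _)

  fromℕ-mono : ∀ {m n} → m ℕ.≤ n → fromℕ m ≤ᴿ fromℕ n
  fromℕ-mono {m} {n} m≤n = subst (λ q → fromℕ m ≤ᴿ fromℚ q) (ι-def n)
    (Upper⇒≤ᴿ {fromℕ m} (Upper-weaken (ι-mono-≤ m≤n) (Upper-fromℕ m)))

  -- Turns the hypothesis given by `COMPLEX` into an inequality of natural numbers; `Upper-∸-≤`
  -- makes the return trip for `SC`.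
  fromℕ-∸-≤ : ∀ {a c k} → fromℕ a -ᴿ fromℕ c ≤ᴿ fromℕ k → a ℕ.≤ k ℕ.+ c
  fromℕ-∸-≤ {a} {c} {k} le = ι-cancel-≤ (subst (ι a ≤_) (sym (ι-+ k c)) (fromDiff
    (Lower≤Upper {fromℕ a -ᴿ fromℕ c} (Lower-+ {fromℕ a} { -ᴿ fromℕ c} (Lower-fromℕ a) (Lower-neg {fromℕ c} (Upper-fromℕ c))) (≤ᴿ-Upper {fromℕ a -ᴿ fromℕ c} {fromℕ k} le (Upper-fromℕ k)))
    (solve 3 (λ a c k → (k :+ c) :- a := k :- (a :- c)) refl (ι a) (ι c) (ι k))))

  Upper-∸-≤ : ∀ {x a c k} → Upper x (ι a) → a ℕ.≤ k ℕ.+ c → x -ᴿ fromℕ c ≤ᴿ fromℕ k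
  Upper-∸-≤ {x} {a} {c} {k} u a≤ = subst (λ q → x -ᴿ fromℕ c ≤ᴿ fromℚ q) (ι-def k)
    (Upper⇒≤ᴿ {x -ᴿ fromℕ c} (Upper-weaken {x -ᴿ fromℕ c} {ι a - ι c} {ι k}
      (fromDiff (subst (ι a ≤_) (ι-+ k c) (ι-mono-≤ a≤)) (solve 3 (λ a c k → k :- (a :- c) := (k :+ c) :- a) refl (ι a) (ι c) (ι k)))
      (Upper-+ {x} { -ᴿ fromℕ c} u (Upper-neg {fromℕ c} (Lower-fromℕ c)))))

-- Dyadic approximation of computable nonnegative reals.

module Approximation where
  open Rationals
  open Bounds
  open Recursion
  open import Data.Fin.Patterns using (0F)
  open import Data.Nat.Base as ℕ using (ℕ; suc)
  import Data.Nat.Properties as ℕ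
  import Data.Nat.DivMod as ℕ
  import Data.Integer.Base as ℤ
  import Data.Integer.Properties as ℤ
  open import Data.Rational.Base hiding (_÷_)
  open import Data.Rational.Properties
  open import Data.Rational.Solver using (module +-*-Solver)
  open +-*-Solver using (solve; con; _:=_; _:+_; _:*_; _:-_; :-_)
  open import Data.Product using (_,_; _×_; Σ-syntax)
  open import Data.Sum.Base using (_⊎_; inj₁; inj₂)
  open import Data.Vec.Base using (Vec; _∷_; lookup)
  open import Relation.Binary.PropositionalEquality

  m-n≤m∸n : ∀ m n → ℤ.+ m ℤ.- ℤ.+ n ℤ.≤ ℤ.+ (m ℕ.∸ n)
  m-n≤m∸n m n with ℕ.≤-total n m
  ... | inj₁ n≤m = ℤ.≤-reflexive (trans (ℤ.m-n≡m⊖n m n) (ℤ.⊖-≥ n≤m))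
  ... | inj₂ m≤n = ℤ.≤-trans (ℤ.≤-reflexive (trans (ℤ.m-n≡m⊖n m n) (ℤ.⊖-≤ m≤n)))
                     (ℤ.≤-trans (ℤ.neg-≤-pos {n ℕ.∸ m} {0}) (ℤ.+≤+ ℕ.z≤n))

  module _ (p q d k : ℕ) where
    private
      v = (ℤ.+ p ℤ.- ℤ.+ q) / suc d
      A = ((p ℕ.∸ q) ℕ.* 2 ℕ.^ k) ℕ./ suc d

    numerator≤ : v * ι (suc d) ≤ ι (p ℕ.∸ q)
    numerator≤ = begin
      v * ι (suc d)             ≡⟨ /-def (ℤ.+ p ℤ.- ℤ.+ q) d ⟩
      (ℤ.+ p ℤ.- ℤ.+ q) / 1     ≤⟨ /-mono-≤ (m-n≤m∸n p q) ⟩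
      ℤ.+ (p ℕ.∸ q) / 1         ≡⟨ ι-def (p ℕ.∸ q) ⟨
      ι (p ℕ.∸ q)               ∎
      where open ≤-Reasoning

    quotient-upper : v ≤ (ι A + ι 1) * 2^- k
    quotient-upper = ≤-of-*ι d (≤-of-*2^ k (begin
      v * ι (suc d) * ι (2 ℕ.^ k)              ≤⟨ *-monoʳ (0≤ι (2 ℕ.^ k)) numerator≤ ⟩
      ι (p ℕ.∸ q) * ι (2 ℕ.^ k)                ≡⟨ ι-* (p ℕ.∸ q) (2 ℕ.^ k) ⟨
      ι ((p ℕ.∸ q) ℕ.* 2 ℕ.^ k)                ≤⟨ ι-mono-≤ x≤ ⟩
      ι (suc A ℕ.* suc d)                      ≡⟨ ι-* (suc A) (suc d) ⟩
      (1ℚ + ι A) * ι (suc d)                   ≡⟨ *-identityʳ _ ⟨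
      (1ℚ + ι A) * ι (suc d) * 1ℚ              ≡⟨ cong ((1ℚ + ι A) * ι (suc d) *_) (2^-inverse k) ⟨
      (1ℚ + ι A) * ι (suc d) * (ι (2 ℕ.^ k) * 2^- k)
        ≡⟨ solve 4 (λ a d t u → (con 1ℚ :+ a) :* d :* (t :* u) := (a :+ con (ι 1)) :* u :* d :* t) refl
             (ι A) (ι (suc d)) (ι (2 ℕ.^ k)) (2^- k) ⟩
      (ι A + ι 1) * 2^- k * ι (suc d) * ι (2 ℕ.^ k) ∎))
      where
      open ≤-Reasoning
      x = (p ℕ.∸ q) ℕ.* 2 ℕ.^ k
      x≤ : x ℕ.≤ suc A ℕ.* suc d
      x≤ = ℕ.≤-trans (ℕ.≤-reflexive (ℕ.m≡m%n+[m/n]*n x (suc d)))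
             (ℕ.+-monoˡ-≤ (A ℕ.* suc d) (ℕ.<⇒≤ (ℕ.m%n<n x (suc d))))

    -- The second alternative covers a negative numerator, where truncated subtraction rounds the
    -- approximation up to 0.
    quotient-lower : ι A * 2^- k ≤ v ⊎ A ≡ 0
    quotient-lower with ℕ.≤-total q p
    ... | inj₂ p≤q = inj₂ (cong (λ z → (z ℕ.* 2 ℕ.^ k) ℕ./ suc d) (ℕ.m≤n⇒m∸n≡0 p≤q))
    ... | inj₁ q≤p = inj₁ (≤-of-*ι d (≤-of-*2^ k (begin
      ι A * 2^- k * ι (suc d) * ι (2 ℕ.^ k)
        ≡⟨ solve 4 (λ a d t u → a :* u :* d :* t := a :* d :* (t :* u)) refl
             (ι A) (ι (suc d)) (ι (2 ℕ.^ k)) (2^- k) ⟩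
      ι A * ι (suc d) * (ι (2 ℕ.^ k) * 2^- k)  ≡⟨ cong (ι A * ι (suc d) *_) (2^-inverse k) ⟩
      ι A * ι (suc d) * 1ℚ                     ≡⟨ *-identityʳ _ ⟩
      ι A * ι (suc d)                          ≡⟨ ι-* A (suc d) ⟨
      ι (A ℕ.* suc d)                          ≤⟨ ι-mono-≤ {_} {(p ℕ.∸ q) ℕ.* 2 ℕ.^ k} (ℕ.m/n*n≤m _ (suc d)) ⟩
      ι ((p ℕ.∸ q) ℕ.* 2 ℕ.^ k)                ≡⟨ ι-* (p ℕ.∸ q) (2 ℕ.^ k) ⟩
      ι (p ℕ.∸ q) * ι (2 ℕ.^ k)                ≡⟨ cong (_* ι (2 ℕ.^ k)) numerator ⟨
      v * ι (suc d) * ι (2 ℕ.^ k)              ∎)))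
      where
      open ≤-Reasoning
      numerator : v * ι (suc d) ≡ ι (p ℕ.∸ q)
      numerator = trans (/-def (ℤ.+ p ℤ.- ℤ.+ q) d)
        (trans (cong (_/ 1) (trans (ℤ.m-n≡m⊖n p q) (ℤ.⊖-≥ q≤p))) (sym (ι-def (p ℕ.∸ q))))

  abstract
    -- Replaces signed fractions by natural multiples of 2^-k. Above, one unit of error comes from
    -- the given approximation and one from rounding down; below, nonnegativity of `F` covers the
    -- case in which the numerator was truncated to 0.
    dyadicApprox : ∀ {n} {F : Vec ℕ n → ℝ} → Computable F → (∀ xs → Lower 0ℚ (F xs)) →
      Σ[ A ∈ (Vec ℕ (suc n) → ℕ) ] Recursive A ×
        (∀ k xs → Upper (F xs) ((ι (A (k ∷ xs)) + ι 2) * 2^- k)) ×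
        (∀ k xs → Lower ((ι (A (k ∷ xs)) - ι 2) * 2^- k) (F xs))
    dyadicApprox {n} {F} (p , q , d , pʳ , qʳ , dʳ , close) 0≤F = A , Aʳ , up , low
      where
      A : Vec ℕ (suc n) → ℕ
      A ys = ((p ys ℕ.∸ q ys) ℕ.* 2 ℕ.^ lookup ys 0F) ℕ./ suc (d ys)
      Aʳ : Recursive A
      Aʳ = ap₂ /ʳ (ap₂ *ʳ (ap₂ ∸ʳ pʳ qʳ) (ap₁ 2^ʳ (var 0F))) dʳ
      up : ∀ k xs → Upper (F xs) ((ι (A (k ∷ xs)) + ι 2) * 2^- k)
      up k xs = Upper-weaken
        (fromDiff (quotient-upper (p ys) (q ys) (d ys) k)
          (solve 3 (λ a u v → (a :+ con (ι 2)) :* u :- (v :+ u) := (a :+ con (ι 1)) :* u :- v) refl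
            (ι (A ys)) (2^- k) ((ℤ.+ p ys ℤ.- ℤ.+ q ys) / suc (d ys))))
        (distance-Upper (close k xs))
        where
        ys : Vec ℕ (suc n)
        ys = k ∷ xs
      low : ∀ k xs → Lower ((ι (A (k ∷ xs)) - ι 2) * 2^- k) (F xs)
      low k xs with quotient-lower (p (k ∷ xs)) (q (k ∷ xs)) (d (k ∷ xs)) k
      ... | inj₁ le = Lower-weaken
        (fromDiff (+-mono-≤ le (0≤2^- k))
          (solve 3 (λ a u v → (v :- u) :- (a :- con (ι 2)) :* u := v :+ u :- (a :* u :+ con 0ℚ)) refl
            (ι (A (k ∷ xs))) (2^- k) ((ℤ.+ p (k ∷ xs) ℤ.- ℤ.+ q (k ∷ xs)) / suc (d (k ∷ xs)))))
        (distance-Lower (close k xs))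
      ... | inj₂ A≡0 = Lower-weaken
        (fromDiff (*-nonNeg (0≤ι 2) (0≤2^- k))
          (trans (cong (λ a → 0ℚ - (ι a - ι 2) * 2^- k) A≡0)
            (solve 1 (λ u → con 0ℚ :- (con (ι 0) :- con (ι 2)) :* u := con (ι 2) :* u :- con 0ℚ) refl (2^- k))))
        (0≤F xs)

-- Finite sums of the form Σ c(m)/2^m.

module DyadicSums where
  open Rationals
  open Bounds
  open import Data.Nat.Base as ℕ using (ℕ; zero; suc)
  import Data.Nat.Properties as ℕ
  open import Data.Rational.Base hiding (_÷_)
  open import Data.Rational.Properties
  open import Data.Rational.Solver using (module +-*-Solver)
  open +-*-Solver using (solve; con; _:=_; _:+_; _:*_; _:-_; :-_)
  open import Relation.Binary.PropositionalEquality

  -- The terms summed are those with N ≤ m < N + l; writing the index as `l + N` makes it reduce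
  -- when `l` is a successor.
  sum : (ℕ → ℚ) → ℕ → ℕ → ℚ
  sum w N zero    = 0ℚ
  sum w N (suc l) = sum w N l + w (l ℕ.+ N)

  dyadic : (ℕ → ℕ) → ℕ → ℕ → ℚ
  dyadic c = sum (λ m → ι (c m) * 2^- m)

  -- The bound `q` on the first N terms is kept separate because `Close-tail` rounds these terms at
  -- precision k and the later ones at precision 0.
  partialSum-Lower : ∀ {t w} → (∀ m → Lower (w m) (t m)) → ∀ {q N} → Lower q (partialSum t N) →
                     ∀ l → Lower (q + sum w N l) (partialSum t (l ℕ.+ N))
  partialSum-Lower {t} {w} tw {q} {N} base zero = subst (λ p → Lower p (partialSum t N)) (sym (+-identityʳ q)) base
  partialSum-Lower {t} {w} tw {q} {N} base (suc l) =
    subst (λ p → Lower p (partialSum t (suc l ℕ.+ N))) (+-assoc q (sum w N l) (w (l ℕ.+ N)))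
      (Lower-+ {partialSum t (l ℕ.+ N)} {t (l ℕ.+ N)} (partialSum-Lower tw base l) (tw (l ℕ.+ N)))

  partialSum-Upper : ∀ {t w} → (∀ m → Upper (t m) (w m)) → ∀ l → Upper (partialSum t l) (sum w 0 l)
  partialSum-Upper tw zero    = Upper-fromℚ 0ℚ
  partialSum-Upper {t} {w} tw (suc l) =
    subst (λ m → Upper (partialSum t l +ᴿ t l) (sum w 0 l + w m)) (sym (ℕ.+-identityʳ l))
      (Upper-+ {partialSum t l} {t l} (partialSum-Upper tw l) (tw l))

  dyadic-mono : ∀ c N {l l′} → l ℕ.≤ l′ → dyadic c N l ≤ dyadic c N l′
  dyadic-mono c N l≤l′ = go (ℕ.≤⇒≤′ l≤l′)
    where
    go : ∀ {l l′} → l ℕ.≤′ l′ → dyadic c N l ≤ dyadic c N l′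
    go ℕ.≤′-refl = ≤-refl
    go (ℕ.≤′-step {m} p) = subst (_≤ dyadic c N m + ι (c (m ℕ.+ N)) * 2^- (m ℕ.+ N)) (+-identityʳ _)
      (+-mono-≤ (go p) (*-nonNeg (0≤ι (c (m ℕ.+ N))) (0≤2^- (m ℕ.+ N))))

  dyadic-front : ∀ c N l → dyadic c N (suc l) ≡ ι (c N) * 2^- N + dyadic c (suc N) l
  dyadic-front c N zero    = trans (+-identityˡ (ι (c N) * 2^- N)) (sym (+-identityʳ _))
  dyadic-front c N (suc l) = begin
    dyadic c N (suc l) + t (suc (l ℕ.+ N))             ≡⟨ cong₂ _+_ (dyadic-front c N l) (cong t (sym (ℕ.+-suc l N))) ⟩
    t N + dyadic c (suc N) l + t (l ℕ.+ suc N)         ≡⟨ +-assoc (t N) _ _ ⟩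
    t N + (dyadic c (suc N) l + t (l ℕ.+ suc N))       ∎
    where
    open ≡-Reasoning
    t : ℕ → ℚ
    t m = ι (c m) * 2^- m

  -- The closed form of Σ_{m ≥ N} 2m/2^m is (4N + 4)/2^N.
  dyadic-linear : ∀ N l → dyadic (2 ℕ.*_) N l + (ι 4 * ι (l ℕ.+ N) + ι 4) * 2^- (l ℕ.+ N) ≡ (ι 4 * ι N + ι 4) * 2^- N
  dyadic-linear N zero    = +-identityˡ _
  dyadic-linear N (suc l) = trans
    (trans (cong (λ z → dyadic (2 ℕ.*_) N l + z * u + (ι 4 * (1ℚ + n) + ι 4) * (½ * u)) (ι-* 2 (l ℕ.+ N)))
      (solve 3 (λ s n u → s :+ con (ι 2) :* n :* u :+ (con (ι 4) :* (con 1ℚ :+ n) :+ con (ι 4)) :* (con ½ :* u)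
              := s :+ (con (ι 4) :* n :+ con (ι 4)) :* u) refl (dyadic (2 ℕ.*_) N l) n u))
    (dyadic-linear N l)
    where
    n = ι (l ℕ.+ N)
    u = 2^- (l ℕ.+ N)

  dyadic-linear-≤ : ∀ N l → dyadic (2 ℕ.*_) N l ≤ (ι 4 * ι N + ι 4) * 2^- N
  dyadic-linear-≤ N l = subst₂ _≤_ (+-identityʳ _) (dyadic-linear N l)
    (+-monoʳ-≤ (dyadic (2 ℕ.*_) N l) (*-nonNeg (+-mono-≤ (*-nonNeg (0≤ι 4) (0≤ι (l ℕ.+ N))) (0≤ι 4)) (0≤2^- (l ℕ.+ N))))

  -- The coefficient 2 is the rounding error of `dyadicApprox`, which is incurred once per term; its
  -- accumulated effect telescopes.
  dyadic-two : ∀ N l → dyadic (λ _ → 2) N l + ι 4 * 2^- (l ℕ.+ N) ≡ ι 4 * 2^- N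
  dyadic-two N zero    = +-identityˡ _
  dyadic-two N (suc l) = trans
    (solve 2 (λ s u → s :+ con (ι 2) :* u :+ con (ι 4) :* (con ½ :* u) := s :+ con (ι 4) :* u) refl
      (dyadic (λ _ → 2) N l) (2^- (l ℕ.+ N)))
    (dyadic-two N l)

  dyadic-two-≤ : ∀ N l → dyadic (λ _ → 2) N l ≤ ι 4 * 2^- N
  dyadic-two-≤ N l = subst₂ _≤_ (+-identityʳ _) (dyadic-two N l)
    (+-monoʳ-≤ (dyadic (λ _ → 2) N l) (*-nonNeg (0≤ι 4) (0≤2^- (l ℕ.+ N))))

  sum-lower : ∀ c k N l → sum (λ m → (ι (c m) - ι 2) * 2^- k * 2^- m) N l ≡ (dyadic c N l - dyadic (λ _ → 2) N l) * 2^- k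
  sum-lower c k N zero    = sym (*-zeroˡ (2^- k))
  sum-lower c k N (suc l) = trans
    (cong (_+ (ι (c m) - ι 2) * 2^- k * 2^- m) (sum-lower c k N l))
    (solve 5 (λ x y a k u → (x :- y) :* k :+ (a :- con (ι 2)) :* k :* u
                         := (x :+ a :* u :- (y :+ con (ι 2) :* u)) :* k) refl
      (dyadic c N l) (dyadic (λ _ → 2) N l) (ι (c m)) (2^- k) (2^- m))
    where m = l ℕ.+ N

  sum-upper : ∀ c k N l → sum (λ m → (ι (c m) + ι 2) * 2^- k * 2^- m) N l ≡ (dyadic c N l + dyadic (λ _ → 2) N l) * 2^- k
  sum-upper c k N zero    = sym (*-zeroˡ (2^- k))
  sum-upper c k N (suc l) = trans
    (cong (_+ (ι (c m) + ι 2) * 2^- k * 2^- m) (sum-upper c k N l))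
    (solve 5 (λ x y a k u → (x :+ y) :* k :+ (a :+ con (ι 2)) :* k :* u
                         := (x :+ a :* u :+ (y :+ con (ι 2) :* u)) :* k) refl
      (dyadic c N l) (dyadic (λ _ → 2) N l) (ι (c m)) (2^- k) (2^- m))
    where m = l ℕ.+ N

  -- The integer 2^N * Σ_{m<N} c(m)/2^m. For the layout it counts the residue classes mod 2^N used
  -- up below level N, since each class mod 2^m splits into two at the next level.
  scaledSum : (ℕ → ℕ) → ℕ → ℕ
  scaledSum c zero    = 0
  scaledSum c (suc N) = 2 ℕ.* (scaledSum c N ℕ.+ c N)

  scaledSum-*2^- : ∀ c N → ι (scaledSum c N) * 2^- N ≡ dyadic c 0 N
  scaledSum-*2^- c zero    = *-zeroˡ 1ℚ
  scaledSum-*2^- c (suc N) = begin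
    ι (2 ℕ.* (T ℕ.+ c N)) * (½ * u)        ≡⟨ cong (_* (½ * u)) (trans (ι-* 2 (T ℕ.+ c N)) (cong (ι 2 *_) (ι-+ T (c N)))) ⟩
    ι 2 * (ι T + ι (c N)) * (½ * u)        ≡⟨ solve 3 (λ x y u → con (ι 2) :* (x :+ y) :* (con ½ :* u) := x :* u :+ y :* u) refl (ι T) (ι (c N)) u ⟩
    ι T * u + ι (c N) * u                  ≡⟨ cong₂ (λ x n → x + ι (c n) * 2^- n) (scaledSum-*2^- c N) (sym (ℕ.+-identityʳ N)) ⟩
    dyadic c 0 N + ι (c (N ℕ.+ 0)) * 2^- (N ℕ.+ 0) ∎
    where
    open ≡-Reasoning
    u = 2^- N
    T = scaledSum c N

  scaledSum-dyadic : ∀ c N → ι (scaledSum c N) ≡ dyadic c 0 N * ι (2 ℕ.^ N)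
  scaledSum-dyadic c N = begin
    ι T                           ≡⟨ *-identityʳ _ ⟨
    ι T * 1ℚ                      ≡⟨ cong (ι T *_) (2^-inverse N) ⟨
    ι T * (ι (2 ℕ.^ N) * 2^- N)   ≡⟨ solve 3 (λ x y z → x :* (y :* z) := x :* z :* y) refl (ι T) (ι (2 ℕ.^ N)) (2^- N) ⟩
    ι T * 2^- N * ι (2 ℕ.^ N)     ≡⟨ cong (_* ι (2 ℕ.^ N)) (scaledSum-*2^- c N) ⟩
    dyadic c 0 N * ι (2 ℕ.^ N)    ∎
    where
    open ≡-Reasoning
    T = scaledSum c N

-- Effective bounds on the tails of a series with recursive sum.

module SeriesTail
  (t : ℕ → ℝ) (s : ℝ) (sums : SumsTo t s)
  (a : ℕ → ℕ → ℕ) (b : ℕ → ℕ)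
  (t≤ : ∀ k m → Bounds.Upper (t m) ((Rationals.ι (a k m) ℚ.+ Rationals.ι 2) ℚ.* 2^- k ℚ.* 2^- m))
  (≤t : ∀ k m → Bounds.Lower ((Rationals.ι (a k m) ℚ.- Rationals.ι 2) ℚ.* 2^- k ℚ.* 2^- m) (t m))
  (s≤ : ∀ k → Bounds.Upper s ((Rationals.ι (b k) ℚ.+ Rationals.ι 2) ℚ.* 2^- k))
  (≤s : ∀ k → Bounds.Lower ((Rationals.ι (b k) ℚ.- Rationals.ι 2) ℚ.* 2^- k) s)
  where
  open Rationals
  open Bounds
  open DyadicSums
  import Data.Nat.Properties as ℕ
  open import Data.Rational.Base hiding (_÷_)
  open import Data.Rational.Properties
  open import Data.Rational.Solver using (module +-*-Solver)
  open +-*-Solver using (solve; con; _:=_; _:+_; _:*_; _:-_; :-_)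
  open import Data.Product using (_,_; proj₁; proj₂; ∃-syntax)
  open import Relation.Binary.PropositionalEquality

  -- Up to rounding, s exceeds the N-th partial sum by at most 8/2^k: b k and a k m are the
  -- approximations of s and of the m-th term in units of 2^-k and 2^-(k + m).
  Close : ℕ → ℕ → Set
  Close k N = b k ℕ.* 2 ℕ.^ N ℕ.≤ scaledSum (a k) N ℕ.+ 8 ℕ.* 2 ℕ.^ N

  scaled : ∀ k N → ι (scaledSum (a k) N ℕ.+ 8 ℕ.* 2 ℕ.^ N) ≡ (dyadic (a k) 0 N + ι 8) * ι (2 ℕ.^ N)
  scaled k N = trans (ι-+ (scaledSum (a k) N) (8 ℕ.* 2 ℕ.^ N)) (trans (cong₂ _+_ (scaledSum-dyadic (a k) N) (ι-* 8 (2 ℕ.^ N)))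
    (sym (*-distribʳ-+ (ι (2 ℕ.^ N)) (dyadic (a k) 0 N) (ι 8))))

  Close⇒ : ∀ k N → Close k N → ι (b k) ≤ dyadic (a k) 0 N + ι 8
  Close⇒ k N close = ≤-of-*2^ N (subst₂ _≤_ (ι-* (b k) (2 ℕ.^ N)) (scaled k N) (ι-mono-≤ close))

  ⇒Close : ∀ k N → ι (b k) ≤ dyadic (a k) 0 N + ι 8 → Close k N
  ⇒Close k N le = ι-cancel-≤ (subst₂ _≤_ (sym (ι-* (b k) (2 ℕ.^ N))) (sym (scaled k N)) (*-monoʳ (0≤ι (2 ℕ.^ N)) le))

  -- The tail is at most s minus the first N terms, up to errors. The 15 units of 2^-k are 2 for
  -- rounding s, 1 for convergence, 4 for rounding the first N terms and 8 from `Close`; the tail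
  -- terms, rounded at precision 0, add 4 * 2^-N.
  Close-tail : ∀ k N → Close k N → ∀ l → dyadic (a 0) N l ≤ ι 15 * 2^- k + ι 4 * 2^- N
  Close-tail k N close l = begin
    dyadic (a 0) N l    ≤⟨ dyadic-mono (a 0) N (ℕ.m≤n+m l N₀) ⟩
    dyadic (a 0) N l′   ≤⟨ fromDiff
        (+-mono-≤ (+-mono-≤ (+-mono-≤ dist (dyadic-two-≤ N l′)) (*-monoʳ (0≤2^- k) (dyadic-two-≤ 0 N))) (*-monoʳ (0≤2^- k) (Close⇒ k N close)))
        (solve 7 (λ d dk e ek b u v →
           (con (ι 15) :* u :+ con (ι 4) :* v) :- d
             := ((b :+ con (ι 2)) :* u :+ u :+ con (ι 4) :* v :+ con (ι 4) :* con 1ℚ :* u :+ (dk :+ con (ι 8)) :* u)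
                :- (con 0ℚ :+ (dk :- ek) :* u :+ (d :- e) :* con 1ℚ :+ e :+ ek :* u :+ b :* u)) refl
          (dyadic (a 0) N l′) (dyadic (a k) 0 N) (dyadic (λ _ → 2) N l′) (dyadic (λ _ → 2) 0 N) (ι (b k)) (2^- k) (2^- N)) ⟩
    ι 15 * 2^- k + ι 4 * 2^- N ∎
    where
    open ≤-Reasoning
    -- The tail is lengthened so that it ends where the partial sum is within 2^-k of `s`. This
    -- modulus of convergence appears in the proof only, so it need not be recursive.
    N₀ = proj₁ (sums k)
    l′ = N₀ ℕ.+ l
    lowerSum : Lower (0ℚ + sum (λ m → (ι (a k m) - ι 2) * 2^- k * 2^- m) 0 N
                       + sum (λ m → (ι (a 0 m) - ι 2) * 2^- 0 * 2^- m) N l′)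
                     (partialSum t (l′ ℕ.+ N))
    lowerSum = partialSum-Lower (≤t 0)
      (subst (λ n → Lower (0ℚ + sum (λ m → (ι (a k m) - ι 2) * 2^- k * 2^- m) 0 N) (partialSum t n))
        (ℕ.+-identityʳ N) (partialSum-Lower (≤t k) (Lower-fromℚ 0ℚ) N)) l′
    dist : 0ℚ + (dyadic (a k) 0 N - dyadic (λ _ → 2) 0 N) * 2^- k
             + (dyadic (a 0) N l′ - dyadic (λ _ → 2) N l′) * 1ℚ
             ≤ (ι (b k) + ι 2) * 2^- k + 2^- k
    dist = subst₂ (λ x y → 0ℚ + x + y ≤ (ι (b k) + ι 2) * 2^- k + 2^- k)
      (sum-lower (a k) k 0 N) (sum-lower (a 0) 0 N l′)
      (distance-≤ (proj₂ (sums k) (l′ ℕ.+ N) (ℕ.≤-trans (ℕ.m≤m+n N₀ l) (ℕ.m≤m+n l′ N))) lowerSum (s≤ k))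

  -- Convergence and the rounding errors account for 2 + 4 + 1 = 7 units, which the 8 in `Close`
  -- covers.
  Close-eventually : ∀ k → ∃[ N₀ ] ∀ N → N₀ ℕ.≤ N → Close k N
  Close-eventually k = proj₁ (sums k) , λ N N₀≤N → ⇒Close k N (≤-of-*2^- (fromDiff
    (+-mono-≤ (dist N N₀≤N) (*-monoʳ (0≤2^- k) (+-mono-≤ (dyadic-two-≤ 0 N) (0≤ι 1))))
    (solve 4 (λ b d e u → (d :+ con (ι 8)) :* u :- b :* u
       := ((d :+ e) :* u :+ u :+ (con (ι 4) :* con 1ℚ :+ con (ι 1)) :* u) :- ((b :- con (ι 2)) :* u :+ (e :+ con 0ℚ) :* u)) refl
      (ι (b k)) (dyadic (a k) 0 N) (dyadic (λ _ → 2) 0 N) (2^- k))))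
    where
    dist : ∀ N → proj₁ (sums k) ℕ.≤ N → (ι (b k) - ι 2) * 2^- k ≤ (dyadic (a k) 0 N + dyadic (λ _ → 2) 0 N) * 2^- k + 2^- k
    dist N N₀≤N = subst (λ x → (ι (b k) - ι 2) * 2^- k ≤ x + 2^- k) (sum-upper (a k) k 0 N)
      (distance-≥ (proj₂ (sums k) N N₀≤N) (partialSum-Upper (t≤ k) N) (≤s k))
    ≤-of-*2^- : ∀ {p q} → p * 2^- k ≤ q * 2^- k → p ≤ q
    ≤-of-*2^- {p} {q} le = subst₂ _≤_ (cancel p) (cancel q) (*-monoʳ (0≤ι (2 ℕ.^ k)) le)
      where
      cancel : ∀ p → p * 2^- k * ι (2 ℕ.^ k) ≡ p
      cancel p = trans (*-assoc p _ _) (trans (cong (p *_) (trans (*-comm (2^- k) _) (2^-inverse k))) (*-identityʳ p))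

-- Multiplicities, weights and the slow order function.

module Weights
  (G : ℕ → ℕ) (test : ℕ → ℕ → ℕ)
  (test-sound : ∀ K N → test K N ≡ 0 → ∀ l → DyadicSums.dyadic G N l ℚ.≤ 2^- K)
  (test-eventually : ∀ K → ∃[ N₀ ] ∀ N → N₀ ℕ.≤ N → test K N ≡ 0)
  where
  open Rationals
  open DyadicSums
  open Recursion using (ifzero)
  open import Relation.Binary.PropositionalEquality

  -- The function h of the overview. It rises by at most one per level, and only on a passed test
  -- for the tail that starts at the next level, which makes it recursive without any search.
  multiplicity : ℕ → ℕ
  multiplicity zero    = 0
  multiplicity (suc m) = ifzero (test (suc (multiplicity m)) (suc m)) (suc (multiplicity m)) (multiplicity m)

  weight : ℕ → ℕ
  weight m = G m ℕ.* multiplicity m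

  module _ where
    open import Data.Rational.Base
    open import Data.Rational.Properties
    open import Data.Rational.Solver using (module +-*-Solver)
    open +-*-Solver using (solve; con; _:=_; _:+_; _:*_; _:-_; :-_)
    import Data.Nat.Properties as ℕ

    -- Raising the multiplicity from h to h + 1 costs one more copy of the tail, which
    -- the test bounds by 2^-(h + 1).
    potential : ∀ m l → dyadic weight 0 m + ι (multiplicity m) * dyadic G m l ≤ 1ℚ - 2^- (multiplicity m)
    potential zero    l = ≤-reflexive (trans (+-identityˡ _) (*-zeroˡ (dyadic G 0 l)))
    potential (suc m) l = raise (test (suc h) (suc m)) refl
      where
      h = multiplicity m
      -- Moving level m from the tail to the weights already fixed leaves the total unchanged.
      spent : dyadic weight 0 (suc m) + ι h * dyadic G (suc m) l ≤ 1ℚ - 2^- h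
      spent = subst (_≤ 1ℚ - 2^- h) (begin
        dyadic weight 0 m + ι h * dyadic G m (suc l)
          ≡⟨ cong (λ x → dyadic weight 0 m + ι h * x) (dyadic-front G m l) ⟩
        dyadic weight 0 m + ι h * (ι (G m) * 2^- m + dyadic G (suc m) l)
          ≡⟨ solve 5 (λ d h g u t → d :+ h :* (g :* u :+ t) := d :+ g :* h :* u :+ h :* t) refl
               (dyadic weight 0 m) (ι h) (ι (G m)) (2^- m) (dyadic G (suc m) l) ⟩
        dyadic weight 0 m + ι (G m) * ι h * 2^- m + ι h * dyadic G (suc m) l
          ≡⟨ cong (λ x → dyadic weight 0 m + x * 2^- m + ι h * dyadic G (suc m) l) (ι-* (G m) h) ⟨
        dyadic weight 0 m + ι (weight m) * 2^- m + ι h * dyadic G (suc m) l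
          ≡⟨ cong (λ n → dyadic weight 0 m + ι (weight n) * 2^- n + ι h * dyadic G (suc m) l) (ℕ.+-identityʳ m) ⟨
        dyadic weight 0 (suc m) + ι h * dyadic G (suc m) l ∎)
        (potential m (suc l))
        where open ≡-Reasoning
      raise : ∀ t → test (suc h) (suc m) ≡ t →
              dyadic weight 0 (suc m) + ι (ifzero t (suc h) h) * dyadic G (suc m) l ≤ 1ℚ - 2^- (ifzero t (suc h) h)
      raise (suc _) _  = spent
      raise zero    eq = fromDiff (+-mono-≤ spent (test-sound (suc h) (suc m) eq l))
        (solve 4 (λ d h t u → con 1ℚ :- con ½ :* u :- (d :+ (con 1ℚ :+ h) :* t) := con 1ℚ :- u :+ con ½ :* u :- (d :+ h :* t :+ t)) refl
          (dyadic weight 0 (suc m)) (ι h) (dyadic G (suc m) l) (2^- h))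

    weights≤1 : ∀ m → dyadic weight 0 m ≤ 1ℚ
    weights≤1 m = fromDiff (+-mono-≤ (potential m 0) (0≤2^- (multiplicity m)))
      (solve 3 (λ d h u → con 1ℚ :- d := con 1ℚ :- u :+ u :- (d :+ h :* con 0ℚ :+ con 0ℚ)) refl
        (dyadic weight 0 m) (ι (multiplicity m)) (2^- (multiplicity m)))

    -- The bound 1 on the weights through level m, scaled by 2^(m+1) and halved.
    capacity : ∀ m → scaledSum weight m ℕ.+ weight m ℕ.≤ 2 ℕ.^ m
    capacity m = ℕ.*-cancelˡ-≤ 2 (ι-cancel-≤ {scaledSum weight (suc m)} {2 ℕ.^ suc m}
      (subst₂ _≤_ (sym (scaledSum-dyadic weight (suc m))) (*-identityˡ _) (*-monoʳ (0≤ι (2 ℕ.^ suc m)) (weights≤1 (suc m)))))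

  open import Data.Nat.Base
  open import Data.Nat.Properties
  open import Data.Sum.Base using (_⊎_; inj₁; inj₂)
  open import Relation.Nullary using (yes; no)

  multiplicity-step : ∀ m → multiplicity m ≤ multiplicity (suc m)
  multiplicity-step m with test (suc (multiplicity m)) (suc m)
  ... | zero  = n≤1+n _
  ... | suc _ = ≤-refl

  multiplicity-mono : ∀ {m n} → m ≤ n → multiplicity m ≤ multiplicity n
  multiplicity-mono m≤n = go (≤⇒≤′ m≤n)
    where
    go : ∀ {m n} → m ≤′ n → multiplicity m ≤ multiplicity n
    go ≤′-refl            = ≤-refl
    go (≤′-step {n} p)    = ≤-trans (go p) (multiplicity-step n)

  -- Once the value b is reached and the test for b + 1 passes at all later levels, the next level
  -- raises the value unless it is larger already.
  multiplicity-unbounded : ∀ b → ∃[ M ] ∀ m → M ≤ m → b ≤ multiplicity m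
  multiplicity-unbounded zero    = 0 , λ _ _ → z≤n
  multiplicity-unbounded (suc b) with multiplicity-unbounded b | test-eventually (suc b)
  ... | M , b≤ | N₀ , passes = suc (M + N₀) , λ m le → ≤-trans bumped (multiplicity-mono le)
    where
    h = multiplicity (M + N₀)
    bumped : suc b ≤ multiplicity (suc (M + N₀))
    bumped with m≤n⇒m<n∨m≡n (b≤ (M + N₀) (m≤m+n M N₀))
    ... | inj₁ b<h = ≤-trans b<h (multiplicity-step (M + N₀))
    ... | inj₂ b≡h rewrite sym b≡h | passes (suc (M + N₀)) (m≤n⇒m≤1+n (m≤n+m N₀ M)) = ≤-refl

  candidate : ℕ → ℕ → ℕ
  candidate n m = ifzero (weight m ∸ n) (G m) 0

  best : ℕ → ℕ → ℕ
  best n zero    = 0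
  best n (suc b) = best n b ⊔ candidate n b

  -- Restricting the maximum to m ≤ n makes it a finite, recursive one. When `G` dominates the
  -- identity, levels of positive multiplicity with weight at most n satisfy m ≤ n anyway, by
  -- `m≤weight`.
  growth : ℕ → ℕ
  growth n = best n (suc n)

  candidate-mono : ∀ {n n′} m → n ≤ n′ → candidate n m ≤ candidate n′ m
  candidate-mono {n} {n′} m n≤n′ with weight m ≤? n
  ... | yes le = ≤-reflexive (trans (Recursion.ifzero-≤ le) (sym (Recursion.ifzero-≤ (≤-trans le n≤n′))))
  ... | no ¬le = subst (_≤ candidate n′ m) (sym (Recursion.ifzero-> (≰⇒> ¬le))) z≤n

  best-monoˡ : ∀ {n n′} b → n ≤ n′ → best n b ≤ best n′ b
  best-monoˡ zero    n≤n′ = z≤n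
  best-monoˡ (suc b) n≤n′ = ⊔-mono-≤ (best-monoˡ b n≤n′) (candidate-mono b n≤n′)

  best-monoʳ : ∀ n {b b′} → b ≤ b′ → best n b ≤ best n b′
  best-monoʳ n b≤b′ = go (≤⇒≤′ b≤b′)
    where
    go : ∀ {b b′} → b ≤′ b′ → best n b ≤ best n b′
    go ≤′-refl         = ≤-refl
    go (≤′-step {b} p) = ≤-trans (go p) (m≤m⊔n (best n b) (candidate n b))

  growth-mono : ∀ {n n′} → n ≤ n′ → growth n ≤ growth n′
  growth-mono {n} n≤n′ = ≤-trans (best-monoˡ (suc n) n≤n′) (best-monoʳ _ (s≤s n≤n′))

  G≤growth : ∀ {m n} → m ≤ n → weight m ≤ n → G m ≤ growth n
  G≤growth {m} {n} m≤n w≤n = ≤-trans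
    (≤-trans (≤-reflexive (sym (Recursion.ifzero-≤ w≤n))) (m≤n⊔m (best n m) (candidate n m)))
    (best-monoʳ n (s≤s m≤n))

  growth-≤ : ∀ {n} c {B} → (∀ m → weight m ≤ n → G m * c ≤ B) → growth n * c ≤ B
  growth-≤ {n} c {B} bound = go (suc n)
    where
    candidate-≤ : ∀ m → candidate n m * c ≤ B
    candidate-≤ m with weight m ≤? n
    ... | yes le rewrite Recursion.ifzero-≤ le {G m} {0} = bound m le
    ... | no ¬le rewrite Recursion.ifzero-> (≰⇒> ¬le) {G m} {0} = z≤n
    go : ∀ b → best n b * c ≤ B
    go zero    = z≤n
    go (suc b) = subst (_≤ B) (sym (*-distribʳ-⊔ c (best n b) (candidate n b))) (⊔-lub (go b) (candidate-≤ b))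

  G-bounded-below : ∀ c M → ∃[ B ] ∀ m → m < M → G m * c ≤ B
  G-bounded-below c zero    = 0 , λ _ ()
  G-bounded-below c (suc M) with G-bounded-below c M
  ... | B , bound = B ⊔ G M * c , λ m m<1+M → below m (m≤n⇒m<n∨m≡n (s≤s⁻¹ m<1+M))
    where
    below : ∀ m → m < M ⊎ m ≡ M → G m * c ≤ B ⊔ G M * c
    below m (inj₁ m<M)  = ≤-trans (bound m m<M) (m≤m⊔n B _)
    below m (inj₂ refl) = m≤n⊔m B _

  -- At levels of multiplicity at least c, `G m * c` is bounded by the weight and hence by n; the
  -- finitely many other levels contribute a constant.
  growth-sublinear : ∀ c → ∃[ n₀ ] ∀ n → n₀ ≤ n → growth n * c ≤ n
  growth-sublinear c with multiplicity-unbounded c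
  ... | M , c≤ with G-bounded-below c M
  ... | B , bound = B , λ n B≤n → growth-≤ c (λ m w≤n → step n B≤n m w≤n (<-≤-connex m M))
    where
    step : ∀ n → B ≤ n → ∀ m → weight m ≤ n → m < M ⊎ M ≤ m → G m * c ≤ n
    step n B≤n m w≤n (inj₁ m<M) = ≤-trans (bound m m<M) B≤n
    step n B≤n m w≤n (inj₂ M≤m) = ≤-trans (*-monoʳ-≤ (G m) (c≤ m M≤m)) w≤n

  m≤weight : (∀ m → m ≤ G m) → ∀ m → 1 ≤ multiplicity m → m ≤ weight m
  m≤weight m≤G m 1≤h = ≤-trans (m≤G m) (subst (_≤ weight m) (*-identityʳ (G m)) (*-monoʳ-≤ (G m) 1≤h))

  module _ (Gʳ : Recursion.Recursive₁ G) (testʳ : Recursion.Recursive₂ test) where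
    open Recursion
    open import Data.Fin.Patterns
    open import Data.Vec.Base using (lookup)

    multiplicityʳ : Recursive₁ multiplicity
    multiplicityʳ = curried₁ (Recursive-resp-≗ (λ xs → eq (lookup xs 0F)) (natrecʳ (const 0)
      (ap₃ ifzeroʳ (ap₂ testʳ (sucʳ (var 1F)) (sucʳ (var 0F))) (sucʳ (var 1F)) (var 1F)) (var 0F)))
      where
      eq : ∀ m → natrec 0 (λ k r → ifzero (test (suc r) (suc k)) (suc r) r) m ≡ multiplicity m
      eq zero    = refl
      eq (suc m) = cong (λ r → ifzero (test (suc r) (suc m)) (suc r) r) (eq m)

    weightʳ : Recursive₁ weight
    weightʳ = curried₁ (ap₂ *ʳ (ap₁ Gʳ (var 0F)) (ap₁ multiplicityʳ (var 0F)))

    growthʳ : Recursive₁ growth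
    growthʳ = curried₁ (Recursive-resp-≗ (λ xs → eq (lookup xs 0F) (suc (lookup xs 0F))) (natrecʳ (const 0)
      (ap₂ ⊔ʳ (var 1F) (ap₃ ifzeroʳ (ap₂ ∸ʳ (ap₁ weightʳ (var 0F)) (var 2F)) (ap₁ Gʳ (var 0F)) (const 0))) (sucʳ (var 0F))))
      where
      eq : ∀ n b → natrec 0 (λ m r → r ⊔ candidate n m) b ≡ best n b
      eq n zero    = refl
      eq n (suc b) = cong (_⊔ candidate n b) (eq n b)

-- Allocation of residue classes to the bits.

module Layout
  (N : ℕ → ℕ) (capacity : ∀ m → DyadicSums.scaledSum N m ℕ.+ N m ℕ.≤ 2 ℕ.^ m)
  where
  open DyadicSums using (scaledSum)
  open Recursion
  open import Data.Fin.Patterns using (0F; 1F; 2F)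
  open import Data.Nat.Base
  open import Data.Nat.Properties
  open import Data.Nat.DivMod
  open import Data.Nat.Divisibility using (divides-refl)
  open import Data.Nat.Solver using (module +-*-Solver)
  open import Data.Product using (_×_)
  open import Data.Vec.Base using (lookup)
  open import Relation.Binary.PropositionalEquality
  open import Relation.Nullary using (yes; no; contradiction)

  halves : ℕ → ℕ → ℕ
  halves i n = natrec n (λ _ r → r / 2) i

  digit : ℕ → ℕ → ℕ
  digit i n = halves i n % 2

  -- rank m n is 0 if position n was used at a level below m; otherwise it is one more
  -- than the rank of the class of n among the free residue classes mod 2^m.
  rank : ℕ → ℕ → ℕ
  rank zero    n = 1
  rank (suc m) n = ifzero (rank m n ∸ N m) 0 (suc (2 * (rank m n ∸ suc (N m)) + digit m n))

  -- label m n ≡ suc j means that position n carries the j-th bit for level m.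
  label : ℕ → ℕ → ℕ
  label m n = ifzero (rank m n ∸ N m) (rank m n) 0

  -- A position carries a nonzero label on at most one level, so summation retrieves that label
  -- without knowing the level.
  labelSum : ℕ → ℕ → ℕ
  labelSum b n = natrec 0 (λ m r → r + label m n) b

  -- Levels below n suffice because the decoder reads, at level m, only positions beyond m.
  -- Positions without a label receive bit 0 of X by default.
  index : ℕ → ℕ
  index n = pred (labelSum n n)

  q*2x≡qx*2 : ∀ q x → q * (2 * x) ≡ q * x * 2
  q*2x≡qx*2 = solve 2 (λ q x → q :* (con 2 :* x) := q :* x :* con 2) refl
    where open +-*-Solver

  halves-+ : ∀ i d n q → halves i (n + q * 2 ^ (i + d)) ≡ halves i n + q * 2 ^ d
  halves-+ zero    d n q = refl
  halves-+ (suc i) d n q = begin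
    halves i (n + q * 2 ^ suc (i + d)) / 2     ≡⟨ cong (λ e → halves i (n + q * 2 ^ e) / 2) (sym (+-suc i d)) ⟩
    halves i (n + q * 2 ^ (i + suc d)) / 2     ≡⟨ cong (_/ 2) (halves-+ i (suc d) n q) ⟩
    (halves i n + q * (2 * 2 ^ d)) / 2         ≡⟨ cong (λ x → (halves i n + x) / 2) (q*2x≡qx*2 q (2 ^ d)) ⟩
    (halves i n + q * 2 ^ d * 2) / 2           ≡⟨ +-distrib-/-∣ʳ (halves i n) (divides-refl (q * 2 ^ d)) ⟩
    halves i n / 2 + q * 2 ^ d * 2 / 2         ≡⟨ cong (halves i n / 2 +_) (m*n/n≡m (q * 2 ^ d) 2) ⟩
    halves i n / 2 + q * 2 ^ d                 ∎
    where
    open ≡-Reasoning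

  halves-< : ∀ i d p → p < 2 ^ (i + d) → halves i p < 2 ^ d
  halves-< zero    d p p< = p<
  halves-< (suc i) d p p< = m<n*o⇒m/o<n (subst (halves i p <_) (*-comm 2 (2 ^ d))
    (halves-< i (suc d) p (subst (λ e → p < 2 ^ e) (sym (+-suc i d)) p<)))

  digit-periodic : ∀ {i m} n q → i < m → digit i (n + q * 2 ^ m) ≡ digit i n
  digit-periodic {i} n q i<m with m≤n⇒∃[o]m+o≡n i<m
  ... | d , refl = begin
    halves i (n + q * 2 ^ suc (i + d)) % 2   ≡⟨ cong (λ e → halves i (n + q * 2 ^ e) % 2) (sym (+-suc i d)) ⟩
    halves i (n + q * 2 ^ (i + suc d)) % 2   ≡⟨ cong (_% 2) (halves-+ i (suc d) n q) ⟩
    (halves i n + q * (2 * 2 ^ d)) % 2       ≡⟨ cong (λ x → (halves i n + x) % 2) (q*2x≡qx*2 q (2 ^ d)) ⟩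
    (halves i n + q * 2 ^ d * 2) % 2         ≡⟨ [m+kn]%n≡m%n (halves i n) (q * 2 ^ d) 2 ⟩
    halves i n % 2                           ∎
    where
    open ≡-Reasoning

  digit-top : ∀ m p b → p < 2 ^ m → b < 2 → digit m (p + b * 2 ^ m) ≡ b
  digit-top m p b p<2^m b<2 = begin
    halves m (p + b * 2 ^ m) % 2         ≡⟨ cong (λ e → halves m (p + b * 2 ^ e) % 2) (sym (+-identityʳ m)) ⟩
    halves m (p + b * 2 ^ (m + 0)) % 2   ≡⟨ cong (_% 2) (halves-+ m 0 p b) ⟩
    (halves m p + b * 1) % 2             ≡⟨ cong₂ (λ x y → (x + y) % 2) halves≡0 (*-identityʳ b) ⟩
    b % 2                                ≡⟨ m<n⇒m%n≡m b<2 ⟩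
    b                                    ∎
    where
    open ≡-Reasoning
    halves≡0 : halves m p ≡ 0
    halves≡0 = n<1⇒n≡0 (halves-< m 0 p (subst (λ e → p < 2 ^ e) (sym (+-identityʳ m)) p<2^m))

  -- The rank at level i consults only the binary digits below i.
  rank-periodic : ∀ {i m} n q → i ≤ m → rank i (n + q * 2 ^ m) ≡ rank i n
  rank-periodic {zero}  n q _   = refl
  rank-periodic {suc i} n q i<m = cong₂ (λ r b → ifzero (r ∸ N i) 0 (suc (2 * (r ∸ suc (N i)) + b)))
    (rank-periodic n q (<⇒≤ i<m)) (digit-periodic n q i<m)

  label-periodic : ∀ m n q → label m (n + q * 2 ^ m) ≡ label m n
  label-periodic m n q = cong (λ r → ifzero (r ∸ N m) r 0) (rank-periodic n q (≤-refl {m}))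

  -- Inverts the splitting of classes: rank v + 1 at level m + 1 comes from rank N m + v/2 + 1 at
  -- level m, with v mod 2 as the new top digit.
  rank-surjective : ∀ m v → v + scaledSum N m < 2 ^ m → ∃[ p ] p < 2 ^ m × rank m p ≡ suc v
  rank-surjective zero    zero    _ = 0 , s≤s z≤n , refl
  rank-surjective zero    (suc v) (s≤s ())
  rank-surjective (suc m) v v< with rank-surjective m (N m + v / 2) (*-cancelˡ-< 2 _ _ (begin-strict
    2 * (N m + v / 2 + scaledSum N m)              ≡⟨ regroup (N m) (v / 2) (scaledSum N m) ⟩
    v / 2 * 2 + 2 * (scaledSum N m + N m)          ≤⟨ +-monoˡ-≤ (2 * (scaledSum N m + N m)) (m/n*n≤m v 2) ⟩
    v + 2 * (scaledSum N m + N m)                  <⟨ v< ⟩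
    2 * 2 ^ m                                      ∎))
    where
    open ≤-Reasoning
    open +-*-Solver
    regroup : ∀ a b c → 2 * (a + b + c) ≡ b * 2 + 2 * (c + a)
    regroup = solve 3 (λ a b c → con 2 :* (a :+ b :+ c) := b :* con 2 :+ con 2 :* (c :+ a)) refl
  ... | p , p<2^m , rank≡ = p + v % 2 * 2 ^ m , bound , rank′≡
    where
    open ≡-Reasoning
    b<2 : v % 2 < 2
    b<2 = m%n<n v 2
    bound : p + v % 2 * 2 ^ m < 2 ^ m + (2 ^ m + 0)
    bound = +-mono-<-≤ p<2^m (*-monoˡ-≤ (2 ^ m) (s≤s⁻¹ b<2))
    same : rank m (p + v % 2 * 2 ^ m) ≡ suc (N m + v / 2)
    same = trans (rank-periodic p (v % 2) (≤-refl {m})) rank≡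
    rank′≡ : rank (suc m) (p + v % 2 * 2 ^ m) ≡ suc v
    rank′≡ = begin
      rank (suc m) (p + v % 2 * 2 ^ m)
        ≡⟨ cong₂ (λ r b → ifzero (r ∸ N m) 0 (suc (2 * (r ∸ suc (N m)) + b))) same (digit-top m p (v % 2) p<2^m b<2) ⟩
      ifzero (suc (N m + v / 2) ∸ N m) 0 (suc (2 * (N m + v / 2 ∸ N m) + v % 2))
        ≡⟨ ifzero-> (s≤s (m≤m+n (N m) (v / 2))) ⟩
      suc (2 * (N m + v / 2 ∸ N m) + v % 2)
        ≡⟨ cong (λ x → suc (2 * x + v % 2)) (m+n∸m≡n (N m) (v / 2)) ⟩
      suc (2 * (v / 2) + v % 2)
        ≡⟨ cong suc (trans (+-comm _ (v % 2)) (trans (cong (v % 2 +_) (*-comm 2 (v / 2))) (sym (m≡m%n+[m/n]*n v 2)))) ⟩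
      suc v ∎

  -- `capacity` guarantees that the class of rank j + 1 exists, and a block of 2^m consecutive
  -- positions meets every class mod 2^m.
  label-hit : ∀ m j r → j < N m → r < 2 ^ m → ∃[ x ] x < 2 ^ m × label m (r + x) ≡ suc j
  label-hit m j r j<N r<2^m
    with rank-surjective m j (<-≤-trans (+-monoˡ-< (scaledSum N m) j<N) (≤-trans (≤-reflexive (+-comm (N m) _)) (capacity m)))
  ... | p , p<2^m , rank≡ with r ≤? p
  ...   | yes r≤p = p ∸ r , ≤-<-trans (m∸n≤m p r) p<2^m , trans (cong (label m) (m+[n∸m]≡n r≤p)) labelled
    where
    labelled : label m p ≡ suc j
    labelled = trans (cong (λ s → ifzero (s ∸ N m) s 0) rank≡) (ifzero-≤ j<N)
  -- The representative lies before the start of the block, so its translate by one period is taken.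
  ...   | no  r≰p = p + 2 ^ m ∸ r , below , trans (cong (label m) shift) (trans (label-periodic m p 1) labelled)
    where
    labelled : label m p ≡ suc j
    labelled = trans (cong (λ s → ifzero (s ∸ N m) s 0) rank≡) (ifzero-≤ j<N)
    r≤ : r ≤ p + 2 ^ m
    r≤ = ≤-trans (<⇒≤ r<2^m) (m≤n+m (2 ^ m) p)
    below : p + 2 ^ m ∸ r < 2 ^ m
    below = +-cancelˡ-< r _ _ (subst (_< r + 2 ^ m) (sym (m+[n∸m]≡n r≤)) (+-monoˡ-< (2 ^ m) (≰⇒> r≰p)))
    shift : r + (p + 2 ^ m ∸ r) ≡ p + 1 * 2 ^ m
    shift = trans (m+[n∸m]≡n r≤) (cong (p +_) (sym (*-identityˡ (2 ^ m))))

  label-rank : ∀ m n {j} → label m n ≡ suc j → rank m n ≡ suc j × rank m n ≤ N m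
  label-rank m n eq with rank m n ≤? N m
  ... | yes le rewrite ifzero-≤ le {rank m n} {0} = eq , le
  ... | no ¬le rewrite ifzero-> (≰⇒> ¬le) {rank m n} {0} = contradiction eq λ ()

  used : ∀ m n → rank m n ≤ N m → rank (suc m) n ≡ 0
  used m n le = ifzero-≤ le

  -- A positive rank shows that all earlier levels passed the position over, each contributing label
  -- 0.
  labelSum-alive : ∀ m n {v} → rank m n ≡ suc v → labelSum m n ≡ 0
  labelSum-alive zero    n alive = refl
  labelSum-alive (suc m) n alive with rank m n ≤? N m
  ... | yes le = contradiction (trans (sym alive) (used m n le)) λ ()
  ... | no ¬le = cong₂ _+_
    (labelSum-alive m n (sym (suc-pred (rank m n) {{>-nonZero (≤-<-trans z≤n (≰⇒> ¬le))}})))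
    (ifzero-> (≰⇒> ¬le))

  -- Rank 0 is absorbing: it lies below every N b, so it counts as used again, and the label it
  -- yields is 0.
  dead : ∀ {m b} n → m < b → rank m n ≤ N m → rank b n ≡ 0
  dead {m} n m<b le = go (≤⇒≤′ m<b)
    where
    go : ∀ {b} → suc m ≤′ b → rank b n ≡ 0
    go ≤′-refl         = used m n le
    go (≤′-step {b} p) = used b n (subst (_≤ N b) (sym (go p)) z≤n)

  labelSum-label : ∀ {m b} n {j} → label m n ≡ suc j → m < b → labelSum b n ≡ suc j
  labelSum-label {m} n {j} eq m<b with label-rank m n eq
  ... | rank≡ , le = go (≤⇒≤′ m<b)
    where
    go : ∀ {b} → suc m ≤′ b → labelSum b n ≡ suc j
    go ≤′-refl         = cong₂ _+_ (labelSum-alive m n rank≡) eq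
    go (≤′-step {b} p) = trans (cong₂ _+_ (go p) (trans (cong (λ r → ifzero (r ∸ N b) r 0) (dead n (≤′⇒≤ p) le)) (ifzero-≤ (z≤n {N b}))))
                           (+-identityʳ (suc j))

  index-label : ∀ m n {j} → m < n → label m n ≡ suc j → index n ≡ j
  index-label m n m<n eq = cong pred (labelSum-label n eq m<n)

  module _ (Nʳ : Recursive₁ N) where
    halvesʳ : Recursive₂ halves
    halvesʳ = curried₂ (natrecʳ (var 1F) (ap₂ /ʳ (var 1F) (const 1)) (var 0F))

    digitʳ : Recursive₂ digit
    digitʳ = curried₂ (ap₂ %ʳ (ap₂ halvesʳ (var 0F) (var 1F)) (const 1))

    rankʳ : Recursive₂ rank
    rankʳ = curried₂ (Recursive-resp-≗ (λ xs → eq (lookup xs 0F) (lookup xs 1F)) (natrecʳ (const 1)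
      (ap₃ ifzeroʳ (ap₂ ∸ʳ (var 1F) (ap₁ Nʳ (var 0F))) (const 0)
        (sucʳ (ap₂ +ʳ (ap₂ *ʳ (const 2) (ap₂ ∸ʳ (var 1F) (sucʳ (ap₁ Nʳ (var 0F))))) (ap₂ digitʳ (var 0F) (var 3F)))))
      (var 0F)))
      where
      open import Data.Fin.Patterns using (3F)
      eq : ∀ m n → natrec 1 (λ i r → ifzero (r ∸ N i) 0 (suc (2 * (r ∸ suc (N i)) + digit i n))) m ≡ rank m n
      eq zero    n = refl
      eq (suc m) n = cong (λ r → ifzero (r ∸ N m) 0 (suc (2 * (r ∸ suc (N m)) + digit m n))) (eq m n)

    labelʳ : Recursive₂ label
    labelʳ = curried₂ (ap₃ ifzeroʳ (ap₂ ∸ʳ (ap₂ rankʳ (var 0F) (var 1F)) (ap₁ Nʳ (var 0F)))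
               (ap₂ rankʳ (var 0F) (var 1F)) (const 0))

    indexʳ : Recursive₁ index
    indexʳ = curried₁ (ap₁ predʳ (natrecʳ (const 0) (ap₂ +ʳ (var 1F) (ap₂ labelʳ (var 0F) (var 2F))) (var 0F)))

-- Recursive operations on encoded strings.

module Strings where
  open Recursion
  open import Data.Bool.Base using (Bool; true; false)
  open import Data.Fin.Patterns using (0F; 1F)
  open import Data.List.Base using ([]; _∷_; drop; applyUpTo)
  open import Data.Nat.Base
  open import Data.Nat.Properties
  open import Data.Nat.DivMod
  open import Data.Product using (_×_; _,_; proj₁)
  open import Data.Sum.Base using (inj₁; inj₂)
  open import Function.Base using (_∘_)
  open import Relation.Binary.PropositionalEquality
  open import Relation.Nullary using (contradiction)

  -- The first letter of an encoded nonempty string is the parity of the predecessor of its code, so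
  -- removing that letter is a halving.
  tailᶜ : ℕ → ℕ
  tailᶜ x = pred x / 2

  -- 0 for the empty string, suc (bit b) for a string starting with b.
  headᶜ : ℕ → ℕ
  headᶜ x = ifzero x 0 (suc (pred x % 2))

  encode-∷ : ∀ b σ → encode (b ∷ σ) ≡ suc (bit b + encode σ * 2)
  encode-∷ false σ = cong suc (*-comm 2 (encode σ))
  encode-∷ true  σ = cong (suc ∘ suc) (*-comm 2 (encode σ))

  bit<2 : ∀ b → bit b < 2
  bit<2 false = s≤s z≤n
  bit<2 true  = s≤s (s≤s z≤n)

  tailᶜ-∷ : ∀ b σ → tailᶜ (encode (b ∷ σ)) ≡ encode σ
  tailᶜ-∷ b σ = begin
    tailᶜ (encode (b ∷ σ))                   ≡⟨ cong tailᶜ (encode-∷ b σ) ⟩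
    (bit b + encode σ * 2) / 2               ≡⟨ +-distrib-/ (bit b) (encode σ * 2) no-carry ⟩
    bit b / 2 + encode σ * 2 / 2             ≡⟨ cong₂ _+_ (m<n⇒m/n≡0 (bit<2 b)) (m*n/n≡m (encode σ) 2) ⟩
    encode σ                                 ∎
    where
    open ≡-Reasoning
    no-carry : bit b % 2 + encode σ * 2 % 2 < 2
    no-carry = subst (_< 2) (sym (trans (cong₂ _+_ (m<n⇒m%n≡m (bit<2 b)) (m*n%n≡0 (encode σ) 2)) (+-identityʳ (bit b)))) (bit<2 b)

  headᶜ-∷ : ∀ b σ → headᶜ (encode (b ∷ σ)) ≡ suc (bit b)
  headᶜ-∷ b σ = trans (cong headᶜ (encode-∷ b σ))
    (cong suc (trans ([m+kn]%n≡m%n (bit b) (encode σ) 2) (m<n⇒m%n≡m (bit<2 b))))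

  tailᶜ-drop : ∀ σ → tailᶜ (encode σ) ≡ encode (drop 1 σ)
  tailᶜ-drop []      = refl
  tailᶜ-drop (b ∷ σ) = tailᶜ-∷ b σ

  iterate : (ℕ → ℕ) → ℕ → ℕ → ℕ
  iterate f k x = natrec x (λ _ → f) k

  iterate-front : ∀ f k x → iterate f (suc k) x ≡ iterate f k (f x)
  iterate-front f zero    x = refl
  iterate-front f (suc k) x = cong f (iterate-front f k x)

  bitAt : ℕ → ℕ → ℕ
  bitAt p x = pred (headᶜ (iterate tailᶜ p x))

  bitAt-applyUpTo : ∀ (Y : ℕ → Bool) {p L} → p < L → bitAt p (encode (applyUpTo Y L)) ≡ bit (Y p)
  bitAt-applyUpTo Y {zero}  {suc L} _ = cong pred (headᶜ-∷ (Y 0) _)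
  bitAt-applyUpTo Y {suc p} {suc L} (s≤s p<L) = trans
    (cong (λ x → pred (headᶜ x)) (trans (iterate-front tailᶜ p _) (cong (iterate tailᶜ p) (tailᶜ-∷ (Y 0) _))))
    (bitAt-applyUpTo (Y ∘ suc) p<L)

  -- The string is built by prepending, hence from its last bit to its first.
  fromBits : (ℕ → ℕ) → ℕ → ℕ
  fromBits β n = natrec 0 (λ k s → suc (β (n ∸ suc k) + s * 2)) n

  applyUpTo-cong : ∀ {A : Set} {f g : ℕ → A} → (∀ i → f i ≡ g i) → ∀ n → applyUpTo f n ≡ applyUpTo g n
  applyUpTo-cong eq zero    = refl
  applyUpTo-cong eq (suc n) = cong₂ _∷_ (eq 0) (applyUpTo-cong (eq ∘ suc) n)

  fromBits-encode : ∀ β (X : ℕ → Bool) n → (∀ j → j < n → β j ≡ bit (X j)) → fromBits β n ≡ encode (X ↾ n)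
  fromBits-encode β X n eq = trans (go n ≤-refl) (cong encode (applyUpTo-cong (λ i → cong (λ z → X (z + i)) (n∸n≡0 n)) n))
    where
    open ≡-Reasoning
    -- Invariant: after k steps the last k bits have been assembled.
    go : ∀ k → k ≤ n → natrec 0 (λ k s → suc (β (n ∸ suc k) + s * 2)) k ≡ encode (applyUpTo (λ i → X (n ∸ k + i)) k)
    go zero    _   = refl
    go (suc k) k<n = begin
      suc (β d + natrec 0 (λ k s → suc (β (n ∸ suc k) + s * 2)) k * 2)
        ≡⟨ cong₂ (λ b s → suc (b + s * 2)) (trans (eq d d<n) (cong (bit ∘ X) (sym (+-identityʳ d)))) (go k (<⇒≤ k<n)) ⟩
      suc (bit (X (d + 0)) + encode (applyUpTo (λ i → X (n ∸ k + i)) k) * 2)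
        ≡⟨ cong (λ σ → suc (bit (X (d + 0)) + encode σ * 2)) (applyUpTo-cong (λ i → cong X (shift i)) k) ⟩
      suc (bit (X (d + 0)) + encode (applyUpTo (λ i → X (d + suc i)) k) * 2)
        ≡⟨ encode-∷ (X (d + 0)) _ ⟨
      encode (applyUpTo (λ i → X (d + i)) (suc k)) ∎
      where
      d = n ∸ suc k
      d<n : d < n
      d<n = ∸-monoʳ-< (s≤s z≤n) k<n
      shift : ∀ i → n ∸ k + i ≡ d + suc i
      shift i = trans (cong (_+ i) (+-∸-assoc 1 k<n)) (sym (+-suc d i))

  -- A bounded search by primitive recursion: a candidate that is a zero of `P` is kept, any other
  -- is replaced by the next. It is total, and the last candidate is returned if no zero occurs.
  locate : (ℕ → ℕ) → ℕ → ℕ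
  locate P b = natrec 0 (λ x y → ifzero (P y) y x) b

  locate-≤ : ∀ P b → locate P b ≤ b
  locate-≤ P zero    = z≤n
  locate-≤ P (suc b) with P (locate P b)
  ... | zero  = m≤n⇒m≤1+n (locate-≤ P b)
  ... | suc _ = n≤1+n b

  locate-spec : ∀ P b {x} → x < b → P x ≡ 0 → P (locate P b) ≡ 0 × locate P b < b
  locate-spec P (suc b) {x} x<1+b Px with P (locate P b) in eq
  ... | zero  = eq , s≤s (locate-≤ P b)
  ... | suc _ with m≤n⇒m<n∨m≡n (s≤s⁻¹ x<1+b)
  ...   | inj₁ x<b  = contradiction (trans (sym eq) (proj₁ (locate-spec P b x<b Px))) λ ()
  ...   | inj₂ refl = Px , ≤-refl

  tailʳ : Recursive₁ tailᶜ
  tailʳ = curried₁ (ap₂ /ʳ (ap₁ predʳ (var 0F)) (const 1))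

  headʳ : Recursive₁ headᶜ
  headʳ = curried₁ (ap₃ ifzeroʳ (var 0F) (const 0) (sucʳ (ap₂ %ʳ (ap₁ predʳ (var 0F)) (const 1))))

  bitAtʳ : Recursive₂ bitAt
  bitAtʳ = curried₂ (ap₁ predʳ (ap₁ headʳ (natrecʳ (var 1F) (ap₁ tailʳ (var 1F)) (var 0F))))

-- A prefix-free machine reading a self-delimiting header.

module HeaderMachine where
  open Recursion
  open Strings
  open import Data.Bool.Base using (Bool; true; false)
  open import Data.Empty using (⊥-elim)
  open import Data.Fin.Patterns using (0F; 1F; 2F; 3F)
  open import Data.List.Base using (List; []; _∷_; _++_; drop; length)
  open import Data.List.Properties using (++-identityʳ-unique)
  open import Data.List.Relation.Binary.Prefix.Heterogeneous using (Prefix; []; _∷_)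
  open import Data.Nat.Base
  open import Data.Nat.Properties
  open import Data.Nat.DivMod
  open import Data.Product using (_×_; _,_; proj₁; proj₂; ∃-syntax)
  open import Data.Vec.Base using (Vec; []; _∷_; lookup)
  open import Relation.Binary.Definitions using (tri<; tri≈; tri>)
  open import Relation.Binary.PropositionalEquality

  skip : ℕ → ℕ → ℕ
  skip = iterate (λ x → tailᶜ (tailᶜ x))

  -- 0 exactly for the strings starting with false.
  continues : ℕ → ℕ
  continues x = ifzero x 1 (pred (headᶜ x))

  payload : ℕ → ℕ → ℕ
  payload k z = tailᶜ (skip k z)

  offset : ℕ → ℕ → ℕ
  offset k z = natrec 0 (λ i r → r + 2 ^ i * pred (headᶜ (tailᶜ (skip i z)))) k

  lowBit : ℕ → Bool
  lowBit r = if (r % 2 ≡ᵇ 0) then false else true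
    where open import Data.Bool.Base using (if_then_else_)

  bit-lowBit : ∀ r → bit (lowBit r) ≡ r % 2
  bit-lowBit r with r % 2 | m%n<n r 2
  ... | 0 | _ = refl
  ... | 1 | _ = refl
  ... | suc (suc _) | s≤s (s≤s ())

  -- 1 b₀ 1 b₁ … 1 bₘ₋₁ 0, where b₀, b₁, … are the binary digits of r.
  header : ℕ → ℕ → List Bool
  header zero    r = false ∷ []
  header (suc m) r = true ∷ lowBit r ∷ header m (r / 2)

  length-header : ∀ m r → length (header m r) ≡ suc (2 * m)
  length-header zero    r = refl
  length-header (suc m) r = trans (cong (2 +_) (length-header m (r / 2))) (cong (λ x → suc (suc x)) (sym (+-suc m (m + 0))))

  skip-∷∷ : ∀ k a b σ → skip (suc k) (encode (a ∷ b ∷ σ)) ≡ skip k (encode σ)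
  skip-∷∷ k a b σ = trans (iterate-front _ k _)
    (cong (skip k) (trans (cong tailᶜ (tailᶜ-∷ a (b ∷ σ))) (tailᶜ-∷ b σ)))

  continues-false : ∀ σ → continues (encode (false ∷ σ)) ≡ 0
  continues-false σ = cong pred (headᶜ-∷ false σ)

  continues-true : ∀ σ → continues (encode (true ∷ σ)) ≡ 1
  continues-true σ = cong pred (headᶜ-∷ true σ)

  header-continues : ∀ m r π i → i < m → continues (skip i (encode (header m r ++ π))) ≡ 1
  header-continues (suc m) r π zero    _         = continues-true (lowBit r ∷ header m (r / 2) ++ π)
  header-continues (suc m) r π (suc i) (s≤s i<m) =
    trans (cong continues (skip-∷∷ i true (lowBit r) _)) (header-continues m (r / 2) π i i<m)

  header-ends : ∀ m r π → continues (skip m (encode (header m r ++ π))) ≡ 0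
  header-ends zero    r π = continues-false π
  header-ends (suc m) r π = trans (cong continues (skip-∷∷ m true (lowBit r) _)) (header-ends m (r / 2) π)

  header-payload : ∀ m r π → payload m (encode (header m r ++ π)) ≡ encode π
  header-payload zero    r π = tailᶜ-∷ false π
  header-payload (suc m) r π = trans (cong tailᶜ (skip-∷∷ m true (lowBit r) _)) (header-payload m (r / 2) π)

  -- `header` peels off the lowest digit first, whereas `offset` accumulates towards the highest;
  -- this Horner step reconciles the two.
  offset-∷∷ : ∀ m b σ → offset (suc m) (encode (true ∷ b ∷ σ)) ≡ bit b + 2 * offset m (encode σ)
  offset-∷∷ zero    b σ = trans (+-identityʳ _) (trans (cong (λ x → pred (headᶜ x)) (tailᶜ-∷ true (b ∷ σ)))
    (trans (cong pred (headᶜ-∷ b σ)) (sym (+-identityʳ (bit b)))))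
  offset-∷∷ (suc m) b σ = begin
    offset (suc m) (encode (true ∷ b ∷ σ)) + 2 ^ suc m * pred (headᶜ (tailᶜ (skip (suc m) (encode (true ∷ b ∷ σ)))))
      ≡⟨ cong₂ (λ x y → x + 2 ^ suc m * pred (headᶜ (tailᶜ y))) (offset-∷∷ m b σ) (skip-∷∷ m true b σ) ⟩
    bit b + 2 * offset m (encode σ) + 2 * 2 ^ m * c
      ≡⟨ solve 4 (λ x y z w → x :+ con 2 :* y :+ con 2 :* z :* w := x :+ con 2 :* (y :+ z :* w)) refl
           (bit b) (offset m (encode σ)) (2 ^ m) c ⟩
    bit b + 2 * (offset m (encode σ) + 2 ^ m * c) ∎
    where
    open ≡-Reasoning
    open import Data.Nat.Solver using (module +-*-Solver)
    open +-*-Solver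
    c = pred (headᶜ (tailᶜ (skip m (encode σ))))

  header-offset : ∀ m r π → r < 2 ^ m → offset m (encode (header m r ++ π)) ≡ r
  header-offset zero    zero    π _        = refl
  header-offset zero    (suc r) π (s≤s ())
  header-offset (suc m) r π r< = begin
    offset (suc m) (encode (true ∷ lowBit r ∷ header m (r / 2) ++ π))   ≡⟨ offset-∷∷ m (lowBit r) _ ⟩
    bit (lowBit r) + 2 * offset m (encode (header m (r / 2) ++ π))      ≡⟨ cong₂ (λ x y → x + 2 * y) (bit-lowBit r)
                                                                            (header-offset m (r / 2) π (m<n*o⇒m/o<n (subst (r <_) (*-comm 2 (2 ^ m)) r<))) ⟩
    r % 2 + 2 * (r / 2)                                                 ≡⟨ cong (r % 2 +_) (*-comm 2 (r / 2)) ⟩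
    r % 2 + r / 2 * 2                                                   ≡⟨ m≡m%n+[m/n]*n r 2 ⟨
    r                                                                   ∎
    where open ≡-Reasoning

  dropPairs : ℕ → List Bool → List Bool
  dropPairs zero    σ = σ
  dropPairs (suc k) σ = drop 1 (drop 1 (dropPairs k σ))

  skip-dropPairs : ∀ k σ → skip k (encode σ) ≡ encode (dropPairs k σ)
  skip-dropPairs zero    σ = refl
  skip-dropPairs (suc k) σ = trans (cong (λ x → tailᶜ (tailᶜ x)) (skip-dropPairs k σ))
    (trans (cong tailᶜ (tailᶜ-drop (dropPairs k σ))) (tailᶜ-drop (drop 1 (dropPairs k σ))))

  -- Nonemptiness of the remainder guarantees that no letter of `ρ` was consumed.
  dropPairs-++ : ∀ k σ ρ {a σ′} → dropPairs k σ ≡ a ∷ σ′ → dropPairs k (σ ++ ρ) ≡ a ∷ σ′ ++ ρ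
  dropPairs-++ zero    σ ρ eq = cong (_++ ρ) eq
  dropPairs-++ (suc k) σ ρ eq with dropPairs k σ in eq′
  dropPairs-++ (suc k) σ ρ refl | x ∷ y ∷ _ = cong (λ σ → drop 1 (drop 1 σ)) (dropPairs-++ k σ ρ eq′)

  dropPairs-nonempty : ∀ {i k} σ {a σ′} → i ≤ k → dropPairs k σ ≡ a ∷ σ′ → ∃[ b ] ∃[ σ″ ] dropPairs i σ ≡ b ∷ σ″
  dropPairs-nonempty {i} σ i≤k = go (≤⇒≤′ i≤k)
    where
    go : ∀ {k a σ′} → i ≤′ k → dropPairs k σ ≡ a ∷ σ′ → ∃[ b ] ∃[ σ″ ] dropPairs i σ ≡ b ∷ σ″
    go ≤′-refl         eq = _ , _ , eq
    go (≤′-step {k} p) eq with dropPairs k σ in eq′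
    go (≤′-step {k} p) refl | x ∷ y ∷ _ = go p eq′

  continues≡0 : ∀ σ → continues (encode σ) ≡ 0 → ∃[ σ′ ] σ ≡ false ∷ σ′
  continues≡0 (false ∷ σ) _  = σ , refl
  continues≡0 (true ∷ σ)  eq = ⊥-elim (1+n≢0 (trans (sym (continues-true σ)) eq))

  module _ (U : PartialRecursive 1) {D : ℕ → ℕ → ℕ → ℕ} (Dʳ : Recursive₃ D) where
    abstract
      continuesʳ : Recursive {2} (λ xs → continues (skip (lookup xs 0F) (lookup xs 1F)))
      continuesʳ = ap₃ ifzeroʳ s (const 1) (ap₁ predʳ (ap₁ headʳ s))
        where
        s : Recursive {2} (λ xs → skip (lookup xs 0F) (lookup xs 1F))
        s = natrecʳ (var 1F) (ap₁ tailʳ (ap₁ tailʳ (var 1F))) (var 0F)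

      payloadʳ : Recursive {2} (λ xs → payload (lookup xs 0F) (lookup xs 1F))
      payloadʳ = ap₁ tailʳ (natrecʳ (var 1F) (ap₁ tailʳ (ap₁ tailʳ (var 1F))) (var 0F))

      offsetʳ : Recursive {2} (λ xs → offset (lookup xs 0F) (lookup xs 1F))
      offsetʳ = natrecʳ (const 0) (ap₂ +ʳ (var 1F) (ap₂ *ʳ (ap₁ 2^ʳ (var 0F))
                  (ap₁ predʳ (ap₁ headʳ (ap₁ tailʳ (natrecʳ (var 3F) (ap₁ tailʳ (ap₁ tailʳ (var 1F))) (var 0F)))))))
                (var 0F)

    -- Searches for the end marker of the header. The empty string counts as continuing, so the
    -- search diverges on inputs whose header never ends.
    lengthᶜ : PartialRecursive 1
    lengthᶜ = muᶜ (proj₁ continuesʳ)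

    with-length : ∀ {F : Vec ℕ 2 → ℕ} → Recursive F → PartialRecursive 1
    with-length (c , _) = compᶜ c (lengthᶜ ∷ projᶜ 0F ∷ [])

    machine : PartialRecursive 1
    machine = compᶜ (proj₁ (Recursive₃.uncurried Dʳ))
      (lengthᶜ ∷ with-length offsetʳ ∷ compᶜ U (with-length payloadʳ ∷ []) ∷ [])

    with-length⇓ : ∀ {F : Vec ℕ 2 → ℕ} (Fʳ : Recursive F) {z k} → lengthᶜ [ z ∷ [] ]⇓ k →
                   with-length Fʳ [ z ∷ [] ]⇓ F (k ∷ z ∷ [])
    with-length⇓ (c , c⇓) k⇓ = comp⇓ (λ { 0F → k⇓ ; 1F → proj⇓ }) (c⇓ _)

    machine⇓ : ∀ m r {π u} → r < 2 ^ m → U [ encode π ∷ [] ]⇓ u → machine [ encode (header m r ++ π) ∷ [] ]⇓ D m r u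
    machine⇓ m r {π} {u} r< u⇓ = comp⇓ {ys = m ∷ r ∷ u ∷ []}
      (λ { 0F → length⇓
         ; 1F → subst (with-length offsetʳ [ z ∷ [] ]⇓_) (header-offset m r π r<) (with-length⇓ offsetʳ length⇓)
         ; 2F → comp⇓ (λ { 0F → subst (with-length payloadʳ [ z ∷ [] ]⇓_) (header-payload m r π) (with-length⇓ payloadʳ length⇓) }) u⇓ })
      (proj₂ (Recursive₃.uncurried Dʳ) _)
      where
      z = encode (header m r ++ π)
      length⇓ : lengthᶜ [ z ∷ [] ]⇓ m
      length⇓ = mu⇓ (λ i i<m → 0 , subst (proj₁ continuesʳ [ i ∷ z ∷ [] ]⇓_) (header-continues m r π i i<m) (proj₂ continuesʳ _))
                    (subst (proj₁ continuesʳ [ m ∷ z ∷ [] ]⇓_) (header-ends m r π) (proj₂ continuesʳ _))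

    Parsed : List Bool → ℕ → List Bool → Set
    Parsed σ k σ′ = (∀ i → i < k → continues (skip i (encode σ)) ≢ 0) × dropPairs k σ ≡ false ∷ σ′ × Dom U σ′

    -- Inverts a halting derivation: by determinism its subcomputations must have found the first
    -- end marker and run `U` on what follows it.
    parse : ∀ σ → Dom machine σ → ∃[ k ] ∃[ σ′ ] Parsed σ k σ′
    parse σ (_ , comp⇓ {ys = k ∷ _ ∷ _ ∷ []} ds _) with ds 0F | ds 2F
    ... | mu⇓ below ends | comp⇓ {ys = w ∷ []} es u⇓ =
      k , σ′ , (λ i i<k eq → 0≢1+n (trans (sym eq) (deterministic (proj₂ continuesʳ _) (proj₂ (below i i<k))))) , split
        , _ , subst (λ x → U [ x ∷ [] ]⇓ _) w≡ u⇓
      where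
      open ≡-Reasoning
      stop : continues (encode (dropPairs k σ)) ≡ 0
      stop = trans (cong continues (sym (skip-dropPairs k σ))) (deterministic (proj₂ continuesʳ _) ends)
      σ′ = proj₁ (continues≡0 (dropPairs k σ) stop)
      split : dropPairs k σ ≡ false ∷ σ′
      split = proj₂ (continues≡0 (dropPairs k σ) stop)
      w≡ : w ≡ encode σ′
      w≡ = begin
        w                               ≡⟨ deterministic (es 0F) (with-length⇓ payloadʳ (ds 0F)) ⟩
        tailᶜ (skip k (encode σ))       ≡⟨ cong tailᶜ (skip-dropPairs k σ) ⟩
        tailᶜ (encode (dropPairs k σ))  ≡⟨ cong (λ x → tailᶜ (encode x)) split ⟩
        tailᶜ (encode (false ∷ σ′))     ≡⟨ tailᶜ-∷ false σ′ ⟩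
        encode σ′                       ∎

    prefix-++ : ∀ {σ τ : List Bool} → Prefix _≡_ σ τ → ∃[ ρ ] τ ≡ σ ++ ρ
    prefix-++ []         = _ , refl
    prefix-++ (refl ∷ p) with prefix-++ p
    ... | ρ , refl = ρ , refl

    ++-prefix : ∀ (σ ρ : List Bool) → Prefix _≡_ σ (σ ++ ρ)
    ++-prefix []      ρ = []
    ++-prefix (x ∷ σ) ρ = refl ∷ ++-prefix σ ρ

    -- If the headers of comparable inputs had different lengths, the end marker of the shorter
    -- would contradict the longer; with equal lengths the payloads are comparable, and
    -- prefix-freeness of `U` applies.
    machine-prefixFree : PrefixFreeMachine U → PrefixFreeMachine machine
    machine-prefixFree pf σ τ dσ dτ p with prefix-++ p
    ... | ρ , refl with parse σ dσ | parse (σ ++ ρ) dτ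
    ...   | j , σ′ , before , split , u | k , τ′ , before′ , split′ , u′ with <-cmp j k
    ...     | tri< j<k _ _ = ⊥-elim (before′ j j<k (trans (cong continues
                (trans (skip-dropPairs j (σ ++ ρ)) (cong encode (dropPairs-++ j σ ρ split)))) (continues-false (σ′ ++ ρ))))
    -- As `σ` still has letters after j pairs, it has some after k pairs, so the early marker found
    -- in `σ ++ ρ` already lies in `σ`.
    ...     | tri> _ _ k<j = ⊥-elim (before k k<j (trans (cong continues
                (trans (skip-dropPairs k σ) (cong encode start))) (continues-false rest)))
      where
      open import Data.List.Properties using (∷-injectiveˡ)
      nonempty = dropPairs-nonempty σ (<⇒≤ k<j) split
      rest = proj₁ (proj₂ nonempty)
      start : dropPairs k σ ≡ false ∷ rest
      start = trans (proj₂ (proj₂ nonempty)) (cong (_∷ rest) (∷-injectiveˡ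
        (trans (sym (dropPairs-++ k σ ρ (proj₂ (proj₂ nonempty)))) split′)))
    ...     | tri≈ _ refl _ = sym (trans (cong (σ ++_) ρ≡[]) (++-identityʳ σ))
      where
      open import Data.List.Properties using (∷-injectiveʳ; ++-identityʳ)
      τ′≡ : τ′ ≡ σ′ ++ ρ
      τ′≡ = ∷-injectiveʳ (trans (sym split′) (dropPairs-++ j σ ρ split))
      ρ≡[] : ρ ≡ []
      ρ≡[] = ++-identityʳ-unique σ′ (trans (pf σ′ τ′ u u′ (subst (Prefix _≡_ σ′) (sym τ′≡) (++-prefix σ′ ρ))) τ′≡)

-- Minimal programs, classically.

module Complexity where
  open Bounds
  open import Data.List.Base using (length)
  open import Data.Nat.Base
  open import Data.Nat.Properties
  open import Data.Product using (_×_; _,_; ∃-syntax)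
  open import Relation.Nullary using (¬_; yes; no)
  open import Relation.Nullary.Decidable using (decidable-stable)
  open import Relation.Binary.PropositionalEquality

  -- Whether a shorter program halts is undecidable, so the minimum is only not-not attained; the
  -- recursion is on a bound for the length.
  minimal-program : ∀ U σ π → U ⟨ π ⟩≃ σ → ¬ ¬ (∃[ k ] k ≤ length π × IsK U σ k)
  minimal-program U σ π Uπ = go (length π) π Uπ ≤-refl
    where
    go : ∀ n π → U ⟨ π ⟩≃ σ → length π ≤ n → ¬ ¬ (∃[ k ] k ≤ length π × IsK U σ k)
    go n π Uπ π≤n none = none (length π , ≤-refl , (π , refl , Uπ) , shortest n π≤n)
      where
      shortest : ∀ n → length π ≤ n → ∀ τ → U ⟨ τ ⟩≃ σ → length π ≤ length τ
      shortest n π≤n τ Uτ with length π ≤? length τ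
      ... | yes le = le
      shortest zero    π≤n τ Uτ | no ≰ = ≤-trans π≤n z≤n
      -- A strictly shorter program satisfies the smaller length bound, so the recursive call
      -- refutes `none`.
      shortest (suc n) π≤n τ Uτ | no ≰ = decidable-stable (length π ≤? length τ) λ _ →
        go n τ Uτ (s≤s⁻¹ (≤-trans (≰⇒> ≰) π≤n)) λ { (k , k≤τ , isK) → none (k , ≤-trans k≤τ (<⇒≤ (≰⇒> ≰)) , isK) }

  -- The conclusion is a decidable inequality, hence stable, which discharges the double negation.
  K≥⇒program-length : ∀ {U σ a c} π → K[ U ] σ ≥ (fromℕ a -ᴿ fromℕ c) → U ⟨ π ⟩≃ σ → a ≤ length π + c
  K≥⇒program-length {U} {σ} {a} {c} π K≥ Uπ = decidable-stable (a ≤? length π + c) λ a≰ →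
    minimal-program U σ π Uπ λ { (k , k≤π , isK) → a≰ (≤-trans (fromℕ-∸-≤ {a} {c} {k} (K≥ k isK)) (+-monoˡ-≤ c k≤π)) }

-- Recovering a prefix of X from a window of Y.

module Decoding
  (N : ℕ → ℕ) (Nʳ : Recursion.Recursive₁ N)
  (capacity : ∀ m → DyadicSums.scaledSum N m ℕ.+ N m ℕ.≤ 2 ℕ.^ m)
  where
  open Recursion
  open Strings
  open HeaderMachine
  open Layout N capacity
  open import Data.Fin.Patterns using (0F; 1F; 2F; 3F; 4F)
  open import Data.List.Base using (List; _++_; length; applyUpTo)
  open import Data.List.Properties using (length-++)
  open import Data.Nat.Base
  open import Data.Nat.Properties
  open import Data.Nat.DivMod
  open import Data.Product using (_×_; _,_; ∃-syntax)
  open import Data.Vec.Base using (lookup)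
  open import Function.Bundles using (module Equivalence)
  open import Relation.Binary.PropositionalEquality

  mismatch : ℕ → ℕ → ℕ
  mismatch a b = (a ∸ b) + (b ∸ a)

  mismatch-refl : ∀ a → mismatch a a ≡ 0
  mismatch-refl a = cong₂ _+_ (n∸n≡0 a) (n∸n≡0 a)

  mismatch≡0 : ∀ a b → mismatch a b ≡ 0 → a ≡ b
  mismatch≡0 a b eq = ≤-antisym (m∸n≡0⇒m≤n (m+n≡0⇒m≡0 (a ∸ b) eq)) (m∸n≡0⇒m≤n (m+n≡0⇒n≡0 (a ∸ b) eq))

  -- The decoder knows the start of the window only mod 2^m, which is enough because labels of level
  -- m are periodic with that period.
  position : ℕ → ℕ → ℕ → ℕ
  position m r j = locate (λ x → mismatch (label m (r + x)) (suc j)) (2 ^ m)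

  position-spec : ∀ m r j → j < N m → r < 2 ^ m → label m (r + position m r j) ≡ suc j × position m r j < 2 ^ m
  position-spec m r j j<N r<2^m with label-hit m j r j<N r<2^m
  ... | x , x<2^m , hit with locate-spec (λ x → mismatch (label m (r + x)) (suc j)) (2 ^ m) x<2^m
                               (trans (cong (λ l → mismatch l (suc j)) hit) (mismatch-refl (suc j)))
  ...   | found , below = mismatch≡0 _ _ found , below

  decode : ℕ → ℕ → ℕ → ℕ
  decode m r t = fromBits (λ j → bitAt (2 ^ m + position m r j) t) (N m)

  -- The first 2 ^ m positions of a window are skipped so that every position read exceeds m,
  -- as index requires.
  decode-window : ∀ X i m L → 2 * 2 ^ m ≤ L →
                  decode m ((i % 2 ^ m) {{m^n≢0 2 m}}) (encode (applyUpTo (λ j → X (index (i + j))) L)) ≡ encode (X ↾ N m)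
  decode-window X i m L 2^≤L = fromBits-encode _ X (N m) λ j j<N → read j j<N
    where
    instance _ = m^n≢0 2 m
    r = i % 2 ^ m
    q = i / 2 ^ m
    open ≡-Reasoning
    read : ∀ j → j < N m → bitAt (2 ^ m + position m r j) (encode (applyUpTo (λ j → X (index (i + j))) L)) ≡ bit (X j)
    read j j<N with position-spec m r j j<N (m%n<n i (2 ^ m))
    ... | label≡ , x<2^m = trans (bitAt-applyUpTo (λ j → X (index (i + j))) inside) (cong (λ n → bit (X n)) found)
      where
      x = position m r j
      inside : 2 ^ m + x < L
      inside = <-≤-trans (+-monoʳ-< (2 ^ m) x<2^m) (≤-trans (+-monoʳ-≤ (2 ^ m) (≤-reflexive (sym (+-identityʳ (2 ^ m))))) 2^≤L)
      regroup : i + (2 ^ m + x) ≡ r + x + suc q * 2 ^ m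
      regroup = begin
        i + (2 ^ m + x)                 ≡⟨ cong (_+ (2 ^ m + x)) (m≡m%n+[m/n]*n i (2 ^ m)) ⟩
        r + q * 2 ^ m + (2 ^ m + x)     ≡⟨ solve 4 (λ r y p x → r :+ y :+ (p :+ x) := r :+ x :+ (p :+ y)) refl r (q * 2 ^ m) (2 ^ m) x ⟩
        r + x + suc q * 2 ^ m           ∎
        where
        open import Data.Nat.Solver using (module +-*-Solver)
        open +-*-Solver
      found : index (i + (2 ^ m + x)) ≡ j
      found = index-label m (i + (2 ^ m + x))
        (<-≤-trans (Rationals.2^>n m) (≤-trans (m≤m+n (2 ^ m) x) (m≤n+m _ i)))
        (trans (cong (label m) regroup) (trans (label-periodic m (r + x) (suc q)) label≡))

  abstract
    positionʳ : Recursive₃ position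
    positionʳ = curried₃ (natrecʳ (const 0)
      (ap₃ ifzeroʳ (ap₂ +ʳ (ap₂ ∸ʳ l (sucʳ (var 4F))) (ap₂ ∸ʳ (sucʳ (var 4F)) l)) (var 1F) (var 0F))
      (ap₁ 2^ʳ (var 0F)))
      where
      l : Recursive {5} (λ xs → label (lookup xs 2F) (lookup xs 3F + lookup xs 1F))
      l = ap₂ (labelʳ Nʳ) (var 2F) (ap₂ +ʳ (var 3F) (var 1F))

    decodeʳ : Recursive₃ decode
    decodeʳ = curried₃ (natrecʳ (const 0)
      (sucʳ (ap₂ +ʳ
        (ap₂ bitAtʳ
          (ap₂ +ʳ (ap₁ 2^ʳ (var 2F)) (ap₃ positionʳ (var 2F) (var 3F) (ap₂ ∸ʳ (ap₁ Nʳ (var 2F)) (sucʳ (var 0F)))))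
          (var 4F))
        (ap₂ *ʳ (var 1F) (const 2))))
      (ap₁ Nʳ (var 0F)))

  -- The constant consists of the length of the prefix that simulates the machine and the closing
  -- bit of the header; it is uniform in the sequence, the window and the level.
  prefix-from-window : ∀ {U} → UniversalPrefixFree U → ∃[ C ] ∀ X i m L π → 2 * 2 ^ m ≤ L →
    U ⟨ π ⟩≃ applyUpTo (λ j → X (index (i + j))) L →
    ∃[ π′ ] U ⟨ π′ ⟩≃ (X ↾ N m) × length π′ ≡ C + (2 * m + length π)
  prefix-from-window {U} universalU with UniversalPrefixFree.universal universalU (machine U decodeʳ)
                                           (machine-prefixFree U decodeʳ (UniversalPrefixFree.prefixFree universalU))
  ... | ρ , simulates = suc (length ρ) , λ X i m L π 2^≤L Uπ →
    let r = (i % 2 ^ m) {{m^n≢0 2 m}} in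
    ρ ++ (header m r ++ π) ,
    Equivalence.from (simulates (header m r ++ π) (X ↾ N m))
      (subst (machine U decodeʳ [ _ ]⇓_) (decode-window X i m L 2^≤L)
        (machine⇓ U decodeʳ m r (m%n<n i (2 ^ m) {{m^n≢0 2 m}}) Uπ)) ,
    (begin
      length (ρ ++ (header m r ++ π))            ≡⟨ length-++ ρ ⟩
      length ρ + length (header m r ++ π)        ≡⟨ cong (length ρ +_) (length-++ (header m r)) ⟩
      length ρ + (length (header m r) + length π) ≡⟨ cong (λ l → length ρ + (l + length π)) (length-header m r) ⟩
      length ρ + suc (2 * m + length π)          ≡⟨ +-suc (length ρ) _ ⟩
      suc (length ρ) + (2 * m + length π)        ∎)
    where open ≡-Reasoning

-- The demands made by f and the test for their tails.

module Profile
  (f : ℕ → ℝ) (order : OrderFunction f) (0≤f : NonNegativeValued f)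
  (s : ℝ) (s-recursive : RecursiveReal s) (sums : SumsTo (dyadicTerm f) s)
  where
  open Rationals
  open Bounds
  open Approximation
  open DyadicSums
  open Recursion
  open import Data.Fin.Patterns using (0F; 1F)
  open import Data.Nat.Base as ℕ using (ℕ; zero; suc)
  import Data.Nat.Properties as ℕ
  open import Data.Product using (_,_; proj₁; proj₂; ∃-syntax)
  open import Data.Rational.Base hiding (_÷_)
  open import Data.Rational.Properties
  open import Data.Rational.Solver using (module +-*-Solver)
  open import Data.Vec.Base using ([]; _∷_; head; lookup)
  open import Relation.Binary.PropositionalEquality
  open +-*-Solver using (solve; con; _:=_; _:+_; _:*_; _:-_; :-_)

  0≤f′ : ∀ n → Lower 0ℚ (f n)
  0≤f′ n = 0≤ᴿ-Lower (0≤f n)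

  term-Upper : ∀ {q} m → Upper (f (2 ℕ.^ m)) q → Upper (dyadicTerm f m) (q * 2^- m)
  term-Upper {q} m u = subst (λ r → Upper (dyadicTerm f m) (q * r)) (1/2^≡2^- m)
    (Upper-÷ {f (2 ℕ.^ m)} (2 ℕ.^ m) {{ℕ.m^n≢0 2 m}} u)

  term-Lower : ∀ {q} m → Lower q (f (2 ℕ.^ m)) → Lower (q * 2^- m) (dyadicTerm f m)
  term-Lower {q} m l = subst (λ r → Lower (q * r) (dyadicTerm f m)) (1/2^≡2^- m)
    (Lower-÷ {f (2 ℕ.^ m)} (2 ℕ.^ m) {{ℕ.m^n≢0 2 m}} l)

  0≤term : ∀ m → Lower 0ℚ (dyadicTerm f m)
  0≤term m = subst (λ q → Lower q (dyadicTerm f m)) (*-zeroˡ (2^- m)) (term-Lower m (0≤f′ (2 ℕ.^ m)))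

  -- Nonnegativity is what `dyadicApprox` requires; it is inherited from the partial sums.
  0≤s : Lower 0ℚ s
  0≤s = limit-Lower (λ k → partialSum (dyadicTerm f) (N k)) (λ k → proj₂ (sums k) (N k) ℕ.≤-refl) (λ k → 0≤partialSum (N k))
    where
    N : ℕ → ℕ
    N k = proj₁ (sums k)
    0≤partialSum : ∀ n → Lower 0ℚ (partialSum (dyadicTerm f) n)
    0≤partialSum zero    = Lower-fromℚ 0ℚ
    0≤partialSum (suc n) = Lower-+ {partialSum (dyadicTerm f) n} {dyadicTerm f n} (0≤partialSum n) (0≤term n)

  A = dyadicApprox (OrderFunction.computable order) (λ xs → 0≤f′ (head xs))
  B = dyadicApprox s-recursive (λ _ → 0≤s)

  a : ℕ → ℕ → ℕ
  a k m = proj₁ A (k ∷ 2 ℕ.^ m ∷ [])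

  b : ℕ → ℕ
  b k = proj₁ B (k ∷ [])

  aʳ : Recursive₂ a
  aʳ = curried₂ (comp₂ (proj₁ (proj₂ A)) (var 0F) (ap₁ 2^ʳ (var 1F)))

  bʳ : Recursive₁ b
  bʳ = curried₁ (comp₁ (proj₁ (proj₂ B)) (var 0F))

  f≤ : ∀ m → Upper (f (2 ℕ.^ m)) (ι (a 0 m ℕ.+ 2))
  f≤ m = subst (Upper (f (2 ℕ.^ m))) (trans (*-identityʳ _) (sym (ι-+ (a 0 m) 2))) (proj₁ (proj₂ (proj₂ A)) 0 (2 ℕ.^ m ∷ []))

  term≤ : ∀ k m → Upper (dyadicTerm f m) ((ι (a k m) + ι 2) * 2^- k * 2^- m)
  term≤ k m = term-Upper m (proj₁ (proj₂ (proj₂ A)) k (2 ℕ.^ m ∷ []))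

  ≤term : ∀ k m → Lower ((ι (a k m) - ι 2) * 2^- k * 2^- m) (dyadicTerm f m)
  ≤term k m = term-Lower m (proj₂ (proj₂ (proj₂ A)) k (2 ℕ.^ m ∷ []))

  open SeriesTail (dyadicTerm f) s sums a b term≤ ≤term
    (λ k → proj₁ (proj₂ (proj₂ B)) k []) (λ k → proj₂ (proj₂ (proj₂ B)) k [])

  -- Level m serves the substrings of length below 2^(m + 2); the summand 2m pays for
  -- the header of the decoding machine.
  demand : ℕ → ℕ
  demand m = a 0 (2 ℕ.+ m) ℕ.+ 2 ℕ.* m

  m≤demand : ∀ m → m ℕ.≤ demand m
  m≤demand m = ℕ.≤-trans (ℕ.m≤m+n m (m ℕ.+ 0)) (ℕ.m≤n+m (2 ℕ.* m) (a 0 (2 ℕ.+ m)))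

  demandʳ : Recursive₁ demand
  demandʳ = curried₁ (ap₂ +ʳ (ap₂ aʳ (const 0) (sucʳ (sucʳ (var 0F)))) (ap₂ *ʳ (const 2) (var 0F)))

  -- Shifting the series for f by two levels costs the factor 4.
  dyadic-demand : ∀ N l → dyadic demand N l ≡ ι 4 * dyadic (a 0) (2 ℕ.+ N) l + dyadic (2 ℕ.*_) N l
  dyadic-demand N zero    = refl
  dyadic-demand N (suc l) = begin
    dyadic demand N l + ι (x ℕ.+ 2 ℕ.* m) * u                    ≡⟨ cong₂ (λ p q → p + q * u) (dyadic-demand N l) (ι-+ x (2 ℕ.* m)) ⟩
    ι 4 * d + e + (ι x + ι (2 ℕ.* m)) * u
      ≡⟨ solve 5 (λ d e x y u → con (ι 4) :* d :+ e :+ (x :+ y) :* u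
                := con (ι 4) :* (d :+ x :* (con ½ :* (con ½ :* u))) :+ (e :+ y :* u)) refl d e (ι x) (ι (2 ℕ.* m)) u ⟩
    ι 4 * (d + ι (a 0 (2 ℕ.+ m)) * 2^- (2 ℕ.+ m)) + (e + ι (2 ℕ.* m) * u)
      ≡⟨ cong (λ n → ι 4 * (d + ι (a 0 n) * 2^- n) + (e + ι (2 ℕ.* m) * u)) shift ⟩
    ι 4 * (d + ι (a 0 (l ℕ.+ (2 ℕ.+ N))) * 2^- (l ℕ.+ (2 ℕ.+ N))) + (e + ι (2 ℕ.* m) * u) ∎
    where
    open ≡-Reasoning
    m = l ℕ.+ N
    x = a 0 (2 ℕ.+ m)
    u = 2^- m
    d = dyadic (a 0) (2 ℕ.+ N) l
    e = dyadic (2 ℕ.*_) N l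
    shift : 2 ℕ.+ m ≡ l ℕ.+ (2 ℕ.+ N)
    shift = sym (trans (ℕ.+-suc l (suc N)) (cong suc (ℕ.+-suc l N)))

  closeTest : ℕ → ℕ → ℕ
  closeTest k N = b k ℕ.* 2 ℕ.^ N ℕ.∸ (scaledSum (a k) N ℕ.+ 8 ℕ.* 2 ℕ.^ N)

  -- In 4N + 8, the part 4N + 4 bounds the tail of Σ 2m/2^m and the other 4 is the rounding error 4
  -- * 4 * 2^-(N+2) of `Close-tail`.
  linearTest : ℕ → ℕ → ℕ
  linearTest K N = (4 ℕ.* N ℕ.+ 8) ℕ.* 2 ℕ.^ suc K ℕ.∸ 2 ℕ.^ N

  -- Precision 7 + K reduces the 4 * 15 units of `Close-tail` to 60/128 of 2^-K, and `linearTest`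
  -- keeps the remaining error within half of 2^-K.
  test : ℕ → ℕ → ℕ
  test K N = closeTest (7 ℕ.+ K) (2 ℕ.+ N) ℕ.+ linearTest K N

  linear-≤ : ∀ K N → (4 ℕ.* N ℕ.+ 8) ℕ.* 2 ℕ.^ suc K ℕ.≤ 2 ℕ.^ N → (ι 4 * ι N + ι 8) * 2^- N ≤ ½ * 2^- K
  linear-≤ K N le = ≤-of-*2^ N (≤-of-*2^ (suc K) (begin
    (ι 4 * ι N + ι 8) * 2^- N * p * q        ≡⟨ solve 4 (λ x u p q → x :* u :* p :* q := x :* q :* (p :* u)) refl (ι 4 * ι N + ι 8) (2^- N) p q ⟩
    (ι 4 * ι N + ι 8) * q * (p * 2^- N)      ≡⟨ trans (cong ((ι 4 * ι N + ι 8) * q *_) (2^-inverse N)) (*-identityʳ _) ⟩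
    (ι 4 * ι N + ι 8) * q                    ≡⟨ cong (_* q) (trans (ι-+ (4 ℕ.* N) 8) (cong (_+ ι 8) (ι-* 4 N))) ⟨
    ι (4 ℕ.* N ℕ.+ 8) * q                    ≡⟨ ι-* (4 ℕ.* N ℕ.+ 8) (2 ℕ.^ suc K) ⟨
    ι ((4 ℕ.* N ℕ.+ 8) ℕ.* 2 ℕ.^ suc K)      ≤⟨ ι-mono-≤ le ⟩
    p                                        ≡⟨ trans (cong (p *_) (2^-inverse (suc K))) (*-identityʳ p) ⟨
    p * (q * 2^- suc K)                      ≡⟨ solve 3 (λ p q v → p :* (q :* v) := v :* p :* q) refl p q (2^- suc K) ⟩
    2^- suc K * p * q                        ∎))
    where
    open ≤-Reasoning
    p = ι (2 ℕ.^ N)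
    q = ι (2 ℕ.^ suc K)

  test-sound : ∀ K N → test K N ≡ 0 → ∀ l → dyadic demand N l ≤ 2^- K
  test-sound K N passed l = subst (_≤ 2^- K) (sym (dyadic-demand N l)) (fromDiff
    -- As 60/128 + 1/2 = 31/32, the summand 2^-(5+K) is exactly the slack.
    (+-mono-≤ (+-mono-≤ (+-mono-≤ (*-monoˡ-≤-nonNeg (ι 4) {{nonNegative (0≤ι 4)}} tail) (dyadic-linear-≤ N l)) (linear-≤ K N small)) (0≤2^- (5 ℕ.+ K)))
    (solve 5 (λ d e n u w → w :- (con (ι 4) :* d :+ e)
        := (con (ι 4) :* (con (ι 15) :* (con ½ :* (con ½ :* (con ½ :* (con ½ :* (con ½ :* (con ½ :* (con ½ :* w)))))))
              :+ con (ι 4) :* (con ½ :* (con ½ :* u)))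
            :+ (con (ι 4) :* n :+ con (ι 4)) :* u :+ con ½ :* w :+ con ½ :* (con ½ :* (con ½ :* (con ½ :* (con ½ :* w)))))
           :- (con (ι 4) :* d :+ e :+ (con (ι 4) :* n :+ con (ι 8)) :* u :+ con 0ℚ)) refl
      (dyadic (a 0) (2 ℕ.+ N) l) (dyadic (2 ℕ.*_) N l) (ι N) (2^- N) (2^- K)))
    where
    tail : dyadic (a 0) (2 ℕ.+ N) l ≤ ι 15 * 2^- (7 ℕ.+ K) + ι 4 * 2^- (2 ℕ.+ N)
    tail = Close-tail (7 ℕ.+ K) (2 ℕ.+ N) (ℕ.m∸n≡0⇒m≤n (ℕ.m+n≡0⇒m≡0 (closeTest (7 ℕ.+ K) (2 ℕ.+ N)) passed)) l
    small : (4 ℕ.* N ℕ.+ 8) ℕ.* 2 ℕ.^ suc K ℕ.≤ 2 ℕ.^ N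
    small = ℕ.m∸n≡0⇒m≤n (ℕ.m+n≡0⇒n≡0 (closeTest (7 ℕ.+ K) (2 ℕ.+ N)) passed)

  -- Each step doubles the right side, while 4(n + 1) + 8 ≤ 2(4n + 8); at n = 7 + 2K the bound
  -- follows from 36 + 8K ≤ 64(K + 1) ≤ 2^(6+K).
  linear-eventually : ∀ K d → (4 ℕ.* (d ℕ.+ (7 ℕ.+ 2 ℕ.* K)) ℕ.+ 8) ℕ.* 2 ℕ.^ suc K ℕ.≤ 2 ℕ.^ (d ℕ.+ (7 ℕ.+ 2 ℕ.* K))
  linear-eventually K zero = begin
    (4 ℕ.* (7 ℕ.+ 2 ℕ.* K) ℕ.+ 8) ℕ.* 2 ℕ.^ suc K  ≤⟨ ℕ.*-monoˡ-≤ (2 ℕ.^ suc K) (begin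
      4 ℕ.* (7 ℕ.+ 2 ℕ.* K) ℕ.+ 8         ≡⟨ (N.solve 1 (λ K → N.con 4 N.:* (N.con 7 N.:+ N.con 2 N.:* K) N.:+ N.con 8 N.:= N.con 36 N.:+ N.con 8 N.:* K) refl K) ⟩
      36 ℕ.+ 8 ℕ.* K                      ≤⟨ ℕ.+-mono-≤ (ℕ.m≤m+n 36 28) (ℕ.*-monoˡ-≤ K (ℕ.m≤m+n 8 56)) ⟩
      64 ℕ.+ 64 ℕ.* K                     ≡⟨ ℕ.*-suc 64 K ⟨
      64 ℕ.* suc K                        ≤⟨ ℕ.*-monoʳ-≤ 64 (2^>n K) ⟩
      2 ℕ.^ 6 ℕ.* 2 ℕ.^ K                 ≡⟨ ℕ.^-distribˡ-+-* 2 6 K ⟨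
      2 ℕ.^ (6 ℕ.+ K)                     ∎) ⟩
    2 ℕ.^ (6 ℕ.+ K) ℕ.* 2 ℕ.^ suc K       ≡⟨ ℕ.^-distribˡ-+-* 2 (6 ℕ.+ K) (suc K) ⟨
    2 ℕ.^ (6 ℕ.+ K ℕ.+ suc K)             ≡⟨ cong (2 ℕ.^_) (N.solve 1 (λ K → N.con 6 N.:+ K N.:+ (N.con 1 N.:+ K) N.:= N.con 7 N.:+ N.con 2 N.:* K) refl K) ⟩
    2 ℕ.^ (7 ℕ.+ 2 ℕ.* K)                 ∎
    where
    open ℕ.≤-Reasoning
    import Data.Nat.Solver
    module N = Data.Nat.Solver.+-*-Solver
  linear-eventually K (suc d) = begin
    (4 ℕ.* suc n ℕ.+ 8) ℕ.* t             ≤⟨ ℕ.*-monoˡ-≤ t (begin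
      4 ℕ.* suc n ℕ.+ 8                   ≡⟨ N.solve 1 (λ n → N.con 4 N.:* (N.con 1 N.:+ n) N.:+ N.con 8 N.:= N.con 4 N.:* n N.:+ N.con 12) refl n ⟩
      4 ℕ.* n ℕ.+ 12                      ≤⟨ ℕ.+-mono-≤ (ℕ.*-monoˡ-≤ n (ℕ.m≤m+n 4 4)) (ℕ.m≤m+n 12 4) ⟩
      8 ℕ.* n ℕ.+ 16                      ≡⟨ N.solve 1 (λ n → N.con 8 N.:* n N.:+ N.con 16 N.:= N.con 2 N.:* (N.con 4 N.:* n N.:+ N.con 8)) refl n ⟩
      2 ℕ.* (4 ℕ.* n ℕ.+ 8)               ∎) ⟩
    2 ℕ.* (4 ℕ.* n ℕ.+ 8) ℕ.* t           ≡⟨ ℕ.*-assoc 2 (4 ℕ.* n ℕ.+ 8) t ⟩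
    2 ℕ.* ((4 ℕ.* n ℕ.+ 8) ℕ.* t)         ≤⟨ ℕ.*-monoʳ-≤ 2 (linear-eventually K d) ⟩
    2 ℕ.* 2 ℕ.^ n                         ∎
    where
    open ℕ.≤-Reasoning
    import Data.Nat.Solver
    module N = Data.Nat.Solver.+-*-Solver
    n = d ℕ.+ (7 ℕ.+ 2 ℕ.* K)
    t = 2 ℕ.^ suc K

  test-eventually : ∀ K → ∃[ N₀ ] ∀ N → N₀ ℕ.≤ N → test K N ≡ 0
  test-eventually K = proj₁ close ℕ.+ c , λ N le → cong₂ ℕ._+_
    (ℕ.m≤n⇒m∸n≡0 (proj₂ close (2 ℕ.+ N) (ℕ.≤-trans (ℕ.m≤m+n (proj₁ close) c) (ℕ.≤-trans le (ℕ.m≤n+m N 2)))))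
    (ℕ.m≤n⇒m∸n≡0 (subst (λ n → (4 ℕ.* n ℕ.+ 8) ℕ.* 2 ℕ.^ suc K ℕ.≤ 2 ℕ.^ n)
      (ℕ.m∸n+n≡m (ℕ.≤-trans (ℕ.m≤n+m c (proj₁ close)) le)) (linear-eventually K (N ℕ.∸ c))))
    where
    close = Close-eventually (7 ℕ.+ K)
    c = 7 ℕ.+ 2 ℕ.* K

  scaledSumʳ : Recursive₂ (λ k N → scaledSum (a k) N)
  scaledSumʳ = curried₂ (Recursive-resp-≗ (λ xs → eq (lookup xs 0F) (lookup xs 1F))
    (natrecʳ (const 0) (ap₂ *ʳ (const 2) (ap₂ +ʳ (var 1F) (ap₂ aʳ (var 2F) (var 0F)))) (var 1F)))
    where
    open import Data.Fin.Patterns using (2F)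
    eq : ∀ k N → natrec 0 (λ m r → 2 ℕ.* (r ℕ.+ a k m)) N ≡ scaledSum (a k) N
    eq k zero    = refl
    eq k (suc N) = cong (λ r → 2 ℕ.* (r ℕ.+ a k N)) (eq k N)

  closeTestʳ : Recursive₂ closeTest
  closeTestʳ = curried₂ (ap₂ ∸ʳ (ap₂ *ʳ (ap₁ bʳ (var 0F)) (ap₁ 2^ʳ (var 1F)))
    (ap₂ +ʳ (ap₂ scaledSumʳ (var 0F) (var 1F)) (ap₂ *ʳ (const 8) (ap₁ 2^ʳ (var 1F)))))

  linearTestʳ : Recursive₂ linearTest
  linearTestʳ = curried₂ (ap₂ ∸ʳ (ap₂ *ʳ (ap₂ +ʳ (ap₂ *ʳ (const 4) (var 1F)) (const 8)) (ap₁ 2^ʳ (sucʳ (var 0F))))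
    (ap₁ 2^ʳ (var 1F)))

  testʳ : Recursive₂ test
  testʳ = curried₂ (ap₂ +ʳ (ap₂ closeTestʳ (ap₂ +ʳ (const 7) (var 0F)) (sucʳ (sucʳ (var 1F))))
    (ap₂ linearTestʳ (var 0F) (var 1F)))

  private
    module W = Weights demand test test-sound test-eventually

  open W public using (weight; capacity; growth; growth-mono; growth-sublinear)

  weightʳ : Recursive₁ weight
  weightʳ = W.weightʳ demandʳ testʳ

  growthʳ : Recursive₁ growth
  growthʳ = W.growthʳ demandʳ testʳ

  threshold : ℕ
  threshold = proj₁ (W.multiplicity-unbounded 1)

  -- From the threshold on the multiplicity is positive, so level m is among the candidates for n =
  -- `weight m`.
  demand≤growth : ∀ m → threshold ℕ.≤ m → demand m ℕ.≤ growth (weight m)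
  demand≤growth m le = W.G≤growth {m} {weight m}
    (W.m≤weight m≤demand m (proj₂ (W.multiplicity-unbounded 1) m le)) ℕ.≤-refl

  growth-unbounded : ∀ b → ∃[ n ] b ℕ.≤ growth n
  growth-unbounded b = weight m , ℕ.≤-trans (ℕ.≤-trans (ℕ.m≤n+m b threshold) (m≤demand m))
    (demand≤growth m (ℕ.m≤m+n threshold b))
    where m = threshold ℕ.+ b

-- Order functions with natural values.

module NaturalOrderFunctions where
  open Rationals
  open Bounds
  open Recursion
  open import Data.Fin.Patterns using (1F)
  open import Data.Nat.Base as ℕ using (ℕ; suc)
  import Data.Nat.Properties as ℕ
  import Data.Integer.Base as ℤ
  import Data.Integer.Properties as ℤ
  open import Data.Product using (_,_; ∃-syntax)
  open import Data.Rational.Base hiding (_÷_)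
  open import Data.Rational.Properties
  open import Data.Vec.Base using (Vec; []; _∷_; head; lookup)
  open import Relation.Binary.PropositionalEquality

  ∣p∣≤r : ∀ {p r} → 0ℚ ≤ p → p ≤ r → ∣ p ∣ ≤ r
  ∣p∣≤r {p} {r} 0≤p p≤r = subst (_≤ r) (sym (0≤p⇒∣p∣≡p 0≤p)) p≤r

  0≤error : ∀ k j → 0ℚ ≤ 2^- k + (2^- j + 2^- j)
  0≤error k j = +-mono-≤ (0≤2^- k) (+-mono-≤ (0≤2^- j) (0≤2^- j))

  natural-computable : ∀ {g} → Recursive₁ g → Computable {1} (λ xs → fromℕ (g (head xs)))
  natural-computable {g} gʳ =
    (λ xs → g (lookup xs 1F)) , (λ _ → 0) , (λ _ → 0) , ap₁ gʳ (var 1F) , const 0 , const 0 , close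
    where
    close : ∀ k (xs : Vec ℕ 1) →
      ∣ fromℕ (g (head xs)) -ᴿ fromℚ ((ℤ.+ g (lookup (k ∷ xs) 1F) ℤ.- ℤ.+ 0) / 1) ∣ᴿ ≤ᴿ fromℚ (2^- k)
    close k (n ∷ []) j = ∣p∣≤r (≤-reflexive (sym zero-error)) (≤-trans (≤-reflexive zero-error) (0≤error k j))
      where
      zero-error : ℤ.+ g n / 1 - (ℤ.+ g n ℤ.- ℤ.+ 0) / 1 ≡ 0ℚ
      zero-error = trans (cong (λ i → ℤ.+ g n / 1 - i / 1) (ℤ.+-identityʳ (ℤ.+ g n))) (+-inverseʳ (ℤ.+ g n / 1))

  natural-orderFunction : ∀ {g} → Recursive₁ g → (∀ {m n} → m ℕ.≤ n → g m ℕ.≤ g n) →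
                          (∀ b → ∃[ n ] b ℕ.≤ g n) → OrderFunction (λ n → fromℕ (g n))
  natural-orderFunction gʳ mono unb = record
    { computable = natural-computable gʳ
    ; monotone   = λ m≤n → fromℕ-mono (mono m≤n)
    ; unbounded  = λ b → let n , b≤ = unb b in n , fromℕ-mono b≤
    }

  -- Sublinearity with the factor 2^k is the bound 2^-k on the ratio.
  ratio-null : ∀ {g : ℕ → ℕ} → (∀ c → ∃[ n₀ ] ∀ n → n₀ ℕ.≤ n → g n ℕ.* c ℕ.≤ n) →
               ConvergesTo (ratioToIndex (λ n → fromℕ (g n))) 0ℝ
  ratio-null {g} sublinear k with sublinear (2 ℕ.^ k)
  ... | n₀ , small = n₀ , λ n n₀≤n j → ∣p∣≤r
      (subst (0ℚ ≤_) (sym (+-identityʳ _)) (*-nonNeg (subst (0ℚ ≤_) (ι-def (g (suc n))) (0≤ι (g (suc n)))) (0≤1/n (suc n))))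
      (≤-trans (≤-trans (≤-reflexive (+-identityʳ _)) (ratio≤ (suc n) n (small (suc n) (ℕ.m≤n⇒m≤1+n n₀≤n))))
        (subst (_≤ 2^- k + (2^- j + 2^- j)) (+-identityʳ (2^- k)) (+-monoʳ-≤ (2^- k) (+-mono-≤ (0≤2^- j) (0≤2^- j)))))
    where
    ratio≤ : ∀ n d → g n ℕ.* 2 ℕ.^ k ℕ.≤ suc d → ℤ.+ g n / 1 * (ℤ.+ 1 / suc d) ≤ 2^- k
    ratio≤ n d le = ≤-of-*ι d (≤-of-*2^ k (begin
      ℤ.+ g n / 1 * r * ι (suc d) * ι (2 ℕ.^ k)       ≡⟨ cong (λ q → q * r * ι (suc d) * ι (2 ℕ.^ k)) (ι-def (g n)) ⟨
      ι (g n) * r * ι (suc d) * ι (2 ℕ.^ k)           ≡⟨ cong (_* ι (2 ℕ.^ k)) (*-assoc (ι (g n)) r (ι (suc d))) ⟩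
      ι (g n) * (r * ι (suc d)) * ι (2 ℕ.^ k)         ≡⟨ cong (λ q → ι (g n) * q * ι (2 ℕ.^ k)) (/-def (ℤ.+ 1) d) ⟩
      ι (g n) * 1ℚ * ι (2 ℕ.^ k)                      ≡⟨ cong (_* ι (2 ℕ.^ k)) (*-identityʳ (ι (g n))) ⟩
      ι (g n) * ι (2 ℕ.^ k)                           ≡⟨ ι-* (g n) (2 ℕ.^ k) ⟨
      ι (g n ℕ.* 2 ℕ.^ k)                             ≤⟨ ι-mono-≤ le ⟩
      ι (suc d)                                       ≡⟨ trans (cong (ι (suc d) *_) (2^-inverse k)) (*-identityʳ (ι (suc d))) ⟨
      ι (suc d) * (ι (2 ℕ.^ k) * 2^- k)               ≡⟨ solve 3 (λ x y z → x :* (y :* z) := z :* x :* y) refl (ι (suc d)) (ι (2 ℕ.^ k)) (2^- k) ⟩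
      2^- k * ι (suc d) * ι (2 ℕ.^ k)                 ∎))
      where
      open ≤-Reasoning
      open import Data.Rational.Solver using (module +-*-Solver)
      open +-*-Solver using (solve; _:=_; _:*_)
      r = ℤ.+ 1 / suc d

-- The reduction from SC(f) to COMPLEX(g).

module Reduction
  (U : PartialRecursive 1) (universalU : UniversalPrefixFree U)
  (f : ℕ → ℝ) (f-mono : ∀ {m n} → m ℕ.≤ n → f m ≤ᴿ f n)
  (a : ℕ → ℕ) (f≤ : ∀ m → Bounds.Upper (f (2 ℕ.^ m)) (Rationals.ι (a m ℕ.+ 2)))
  (weight growth : ℕ → ℕ) (weightʳ : Recursion.Recursive₁ weight)
  (capacity : ∀ m → DyadicSums.scaledSum weight m ℕ.+ weight m ℕ.≤ 2 ℕ.^ m)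
  (M : ℕ) (demand≤growth : ∀ m → M ℕ.≤ m → a (2 ℕ.+ m) ℕ.+ 2 ℕ.* m ℕ.≤ growth (weight m))
  where
  open Recursion
  open Bounds
  open Rationals using (ι; 2^>n)
  open Complexity
  open Layout weight capacity
  open Decoding weight weightʳ capacity
  open import Data.Fin.Patterns using (0F)
  open import Data.List.Base using (length; applyUpTo)
  open import Data.Nat.Base
  open import Data.Nat.Properties
  open import Data.Nat.Solver using (module +-*-Solver)
  open import Data.Product using (_,_; proj₁; proj₂; ∃-syntax)
  open import Data.Sum.Base using (_⊎_; inj₁; inj₂)
  open import Data.Unit.Base using (tt)
  open import Data.Empty using (⊥-elim)
  open import Data.Vec.Base using ([]; _∷_)
  open import Function.Base using (_∘_)
  open import Relation.Binary.PropositionalEquality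
  open import Relation.Nullary using (yes; no)

  -- `d` is the number of exponents still possible and serves as fuel.
  log₂-between : ∀ d a n → 2 ^ a ≤ n → n < 2 ^ (a + d) → ∃[ m ] a ≤ m × 2 ^ m ≤ n × n < 2 ^ suc m
  log₂-between zero    a n lo hi = ⊥-elim (<⇒≱ hi (subst (λ e → 2 ^ e ≤ n) (sym (+-identityʳ a)) lo))
  log₂-between (suc d) a n lo hi with 2 ^ suc a ≤? n
  ... | no ≰  = a , ≤-refl , lo , ≰⇒> ≰
  ... | yes ≤n with log₂-between d (suc a) n ≤n (subst (λ e → n < 2 ^ e) (+-suc a d) hi)
  ...   | m , a<m , bounds = m , <⇒≤ a<m , bounds

  log₂ : ∀ a n → 2 ^ a ≤ n → ∃[ m ] a ≤ m × 2 ^ m ≤ n × n < 2 ^ suc m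
  log₂ a n lo = log₂-between n a n lo (<-≤-trans (2^>n n) (^-monoʳ-≤ 2 (m≤n+m n a)))

  g : ℕ → ℝ
  g n = fromℕ (growth n)

  f-Upper : ∀ {n m} → n ≤ 2 ^ m → Upper (f n) (ι (a m + 2))
  f-Upper {n} {m} n≤ = ≤ᴿ-Upper {f n} {f (2 ^ m)} (f-mono n≤) (f≤ m)

  C : ℕ
  C = proj₁ (prefix-from-window universalU)

  -- The summand 2m of the demand cancels against the header, leaving an error independent of m.
  demand≤program : ∀ X c → (∀ n → K[ U ] (X ↾ n) ≥ (g n -ᴿ fromℕ c)) → ∀ i L m π → M ≤ m → 2 * 2 ^ m ≤ L →
    U ⟨ π ⟩≃ applyUpTo (λ j → X (index (i + j))) L → a (2 + m) ≤ length π + (C + c)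
  demand≤program X c complex i L m π M≤m 2^≤L Uπ with proj₂ (prefix-from-window universalU) X i m L π 2^≤L Uπ
  ... | π′ , Uπ′ , ∣π′∣≡ = +-cancelʳ-≤ (2 * m) (a (2 + m)) (length π + (C + c)) (begin
      a (2 + m) + 2 * m                               ≤⟨ demand≤growth m M≤m ⟩
      growth (weight m)                               ≤⟨ K≥⇒program-length {U} {X ↾ weight m} {growth (weight m)} {c} π′ (complex (weight m)) Uπ′ ⟩
      length π′ + c                                   ≡⟨ cong (_+ c) ∣π′∣≡ ⟩
      C + (2 * m + length π) + c                      ≡⟨ solve 4 (λ C m p c → C :+ (m :+ p) :+ c := p :+ (C :+ c) :+ m) refl C (2 * m) (length π) c ⟩
      length π + (C + c) + 2 * m                      ∎)
      where
      open ≤-Reasoning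
      open +-*-Solver

  -- The first alternative collects the lengths below 2^(M+1), for which no level from M on fits
  -- inside the window; the additive constant absorbs them.
  covering-level : ∀ L → ∃[ m ] L ≤ 2 ^ m × (m ≡ suc M ⊎ ∃[ m′ ] m ≡ 2 + m′ × M ≤ m′ × 2 * 2 ^ m′ ≤ L)
  covering-level L with 2 ^ suc M ≤? L
  ... | no ≰ = suc M , <⇒≤ (≰⇒> ≰) , inj₁ refl
  ... | yes ≤L with log₂ (suc M) L ≤L
  ...   | suc m , s≤s M≤m , lo , hi = 2 + m , <⇒≤ hi , inj₂ (m , refl , M≤m , lo)

  spread-complex : ∀ X → COMPLEX U g X → SC U f (X ∘ index)
  spread-complex X (c , complex) = c′ , λ { τ (i , τ≡) k ((π , ∣π∣≡k , Uπ) , _) →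
    let m , L≤2^m , level = covering-level (length τ) in
    Upper-∸-≤ {f (length τ)} {a m + 2} {c′} {k} (f-Upper L≤2^m)
      (subst (λ k → a m + 2 ≤ k + c′) ∣π∣≡k (bound i (length τ) π (subst (U ⟨ π ⟩≃_) τ≡ Uπ) level)) }
    where
    -- `a (suc M)` pays for short substrings, `C + c` for decoding and for the constant of X, and 2
    -- for the rounding of f.
    c′ : ℕ
    c′ = a (suc M) + (C + c + 2)
    bound : ∀ {m} i L π → U ⟨ π ⟩≃ applyUpTo (λ j → X (index (i + j))) L →
            m ≡ suc M ⊎ (∃[ m′ ] m ≡ 2 + m′ × M ≤ m′ × 2 * 2 ^ m′ ≤ L) → a m + 2 ≤ length π + c′
    bound i L π Uπ (inj₁ refl) = ≤-trans (+-monoʳ-≤ (a (suc M)) (m≤n+m 2 (C + c))) (m≤n+m c′ (length π))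
    bound i L π Uπ (inj₂ (m , refl , M≤m , 2^≤L)) = begin
      a (2 + m) + 2                     ≤⟨ +-monoˡ-≤ 2 (demand≤program X c complex i L m π M≤m 2^≤L Uπ) ⟩
      length π + (C + c) + 2            ≡⟨ +-assoc (length π) (C + c) 2 ⟩
      length π + (C + c + 2)            ≤⟨ +-monoʳ-≤ (length π) (m≤n+m (C + c + 2) (a (suc M))) ⟩
      length π + c′                     ∎
      where open ≤-Reasoning

  reduction : ⌜ SC U f ⌝ ≤ₛ ⌜ COMPLEX U g ⌝
  reduction = compᶜ (oracleᶜ tt) (relativise (proj₁ indexRecursive) ∷ []) , λ y → λ { (X , y≡ , complex) →
    (λ n → y (index n)) ,
    (λ n → comp⇓ {ys = index n ∷ []} (λ { 0F → relativise-⇓ (proj₂ indexRecursive (n ∷ [])) }) oracle⇓) ,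
    X ∘ index , (λ n → y≡ (index n)) , spread-complex X complex }
    where
    indexRecursive = Recursive₁.uncurried (indexʳ weightʳ)

mainTheorem5 : (U : PartialRecursive 1) → UniversalPrefixFree U →
    (f : ℕ → ℝ) → OrderFunction f → NonNegativeValued f → SubIdentical f →
    (Σ[ s ∈ ℝ ] RecursiveReal s × SumsTo (dyadicTerm f) s) →
    Σ[ g ∈ (ℕ → ℝ) ] OrderFunction g × NonNegativeValued g ×
    (⌜ SC U f ⌝ ≤ₛ ⌜ COMPLEX U g ⌝) × ConvergesTo (ratioToIndex g) 0ℝ
mainTheorem5 U universalU f order 0≤f _ (s , s-recursive , sums) =
  (λ n → fromℕ (growth n)) ,
  natural-orderFunction {growth} growthʳ growth-mono growth-unbounded ,
  (λ n → fromℕ-mono {0} {growth n} ℕ.z≤n) ,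
  reduction ,
  ratio-null {growth} growth-sublinear
  where
  open Bounds using (fromℕ-mono)
  open NaturalOrderFunctions
  open Profile f order 0≤f s s-recursive sums
  open Reduction U universalU f (OrderFunction.monotone order) (a 0) f≤
         weight growth weightʳ capacity threshold demand≤growth
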